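{- For every prime $p\ge 7$ with $p\equiv 1\pmod 3$ and every integer $m\ge 1$, \[ A_{mp}^{\mathrm{mix}}\equiv A_m^{\mathrm{mix}}\pmod{p^4}. \]
   Context: For $n\ge 0$, $A_n^{\mathrm{mix}}:=108^n[z^n]\,{}_2F_1\!\left(\tfrac16,\tfrac13;1;z\right)^3$, where $[z^n]$ denotes the coefficient of $z^n$ in the power series in $z$. These are integers: $1,18,864,55152,\dots$. -}

module Defs where

open import Data.Nat as ℕ using (ℕ; zero; suc)
open import Data.Integer as ℤ using (ℤ; +_)
open import Data.Rational using (ℚ; _/_; _+_; _*_; 0ℚ; 1ℚ)

ℕ→ℚ : ℕ → ℚ
ℕ→ℚ n = + n / 1

poch : ℚ → ℕ → ℚ
poch a zero    = 1ℚ
poch a (suc k) = poch a k * (a + ℕ→ℚ k)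

invFact : ℕ → ℚ
invFact zero    = 1ℚ
invFact (suc k) = invFact k * (+ 1 / suc k)

_^ℚ_ : ℚ → ℕ → ℚ
x ^ℚ zero  = 1ℚ
x ^ℚ suc n = x * (x ^ℚ n)

-- coefficient of z^k in 2F1(1/6, 1/3; 1; z):  (1/6)_k (1/3)_k / (k!)^2
hypCoef : ℕ → ℚ
hypCoef k = poch (+ 1 / 6) k * poch (+ 1 / 3) k * (invFact k * invFact k)

convAux : (ℕ → ℚ) → (ℕ → ℚ) → ℕ → ℕ → ℚ
convAux f g n zero    = f zero * g n
convAux f g n (suc i) = convAux f g n i + f (suc i) * g (n ℕ.∸ suc i)

conv : (ℕ → ℚ) → (ℕ → ℚ) → ℕ → ℚ
conv f g n = convAux f g n n

cubeCoef : ℕ → ℚ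
cubeCoef = conv hypCoef (conv hypCoef hypCoef)

Amix : ℕ → ℚ
Amix n = (ℕ→ℚ 108 ^ℚ n) * cubeCoef n

{-# OPTIONS --safe #-}
module Submission where

-- Let u_k = 108^k (1/6)_k (1/3)_k / k!², F = Σ u_k t^k, and let A_n be the coefficients of F³. Clausen's identity is
-- F² = Σ v_k t^k with v_k = C(2k,k)² C(3k,k); since 4 divides v_k for k ≥ 1, the square root F has integral coefficients.
--
-- Let p = 6d + 1. The recurrences show that u_n is divisible by p² if n mod p > 2d, and v_n by p³ if n mod p > 4d.
-- Write F = lo + hi by residues ≤ 2d and > 2d, so hi² ≡ 0 (mod p⁴) and 2F³ ≡ 3 lo F² - lo³. The residues occurring in
-- lo³ are at most 6d < p, so extracting the coefficients of t^{mp} (the operator C) gives (C F)³ there; and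
-- C (lo F²) ≡ C F · C (f F²) with f = Σ_{r ≤ 2d} u_r t^r. Here C F ≡ F (mod p²) and C (f F²) ≡ F² + e (mod p⁴) with
-- e_m = p² κ m³ v_m for a constant κ, whence 2 C F³ ≡ 2 F³ + 3 F e.
--
-- To see e ≡ 0, expand C (f F²) with F = lo + hi once more: the result is e ≡ 2 F β, where β = C (f² F) - F satisfies
-- 6 D₀ β_m ≡ u_m P(m) for a cubic P with P(0) = 0. The instances m = 1, 2, 3, 4 and the vanishing of the fourth
-- difference of P force p² κ ≡ 0 (mod p⁴).

-- The cubic 3 x F² - x³ takes the value 2 F³ at x = F and is stationary there: the difference from
-- 2 F³ is (F - x)² (2F + x). This is used twice, at x = lo, which misses F by hi ≡ 0 (mod p²), and
-- after extraction at x = C F, which misses F by a multiple of p².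
--
-- The thresholds are the zeros of the recurrence numerators modulo p: 1 + 6k at k = d and 1 + 3k at
-- k = 2d for u; 1 + 3k, 1 + 2k and 2 + 3k at 2d, 3d and 4d for v. As 2d + 4d = p - 1, residues up
-- to 2d and up to 4d add without a carry.
--
-- The obstacle is κ, a constant collected from long sums with no visible closed form; it is never
-- evaluated. The correction to v_m has the shape m³ v_m because 2 + 3 = 5 cancels the linear terms
-- of (2m)! (3m)! / m!⁵. The relation e ≡ 2 F β confronts this shape with u_m P(m), where P brings
-- three further unknown coefficients. Four instances eliminate them, and the integer left in front
-- of p² κ, up to units, is 2³ 3⁸ 5, which is prime to p.

open import Defs
open import Level using (0ℓ)
open import Algebra.Bundles using (CommutativeRing; CommutativeSemiring)
open import Algebra.Structures.Biased using (isCommutativeSemiringˡ)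
import Algebra.Solver.Ring.NaturalCoefficients.Default as SemiringSolver
open import Data.Integer as ℤ using (ℤ; +_; 1ℤ; 0ℤ)
import Data.Integer.Properties as ℤ
open import Data.Integer.Tactic.RingSolver using () renaming (solve-∀ to ℤ-solve)
open import Data.Maybe using (nothing)
open import Data.Nat as ℕ using (ℕ; zero; suc; _≤_; _<_; _∸_; z≤n; s≤s; _!)
import Data.Nat.Properties as ℕ
open import Data.Nat.Combinatorics using (nCk≡nC[n∸k]; nCk+nC[k+1]≡[n+1]C[k+1]; k![n∸k]!∣n!)
  renaming (_C_ to _choose_)
open import Data.Nat.Combinatorics.Specification using (nCk≡n!/k![n-k]!)
open import Data.Nat.Coprimality using (prime⇒coprime; coprime-Bézout)
import Data.Nat.Divisibility as ℕ∣
open import Data.Nat.DivMod using (m≡m%n+[m/n]*n; m%n<n; m%n≤m; m<n⇒m%n≡m; [m+kn]%n≡m%n; %-distribˡ-+; m/n*n≡m)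
open import Data.Nat.GCD using (module Bézout)
open import Data.Nat.Primality using (Prime; prime⇒irreducible)
open import Data.Nat.Tactic.RingSolver using () renaming (solve-∀ to ℕ-solve)
open import Data.Product using (_,_; _×_; proj₁; proj₂; ∃-syntax)
open import Data.Rational as ℚ using (ℚ; _/_; 0ℚ; 1ℚ)
import Data.Rational.Properties as ℚ
import Data.Rational.Unnormalised as ℚᵘ
import Data.Rational.Unnormalised.Properties as ℚᵘ
open import Data.Sum using (_⊎_; inj₁; inj₂)
open import Function using (_∘_)
open import Relation.Binary.PropositionalEquality as ≡ using (_≡_)
import Relation.Binary.Reasoning.Setoid as SetoidReasoning
open import Relation.Nullary using (¬_; Dec; yes; no; contradiction)
import Tactic.RingSolver as RingSolver
open import Tactic.RingSolver.Core.AlmostCommutativeRing using (AlmostCommutativeRing; fromCommutativeRing)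

-- Formal power series

module Series (R : CommutativeRing 0ℓ 0ℓ) where

  open CommutativeRing R
  open SetoidReasoning setoid

  private
    variable
      f g h f′ g′ : ℕ → Carrier

    interchange : ∀ a b c d → (a + b) + (c + d) ≈ (a + c) + (b + d)
    interchange a b c d = begin
      (a + b) + (c + d) ≈⟨ +-assoc a b (c + d) ⟩
      a + (b + (c + d)) ≈⟨ +-congˡ (+-assoc b c d) ⟨
      a + ((b + c) + d) ≈⟨ +-congˡ (+-congʳ (+-comm b c)) ⟩
      a + ((c + b) + d) ≈⟨ +-congˡ (+-assoc c b d) ⟩
      a + (c + (b + d)) ≈⟨ +-assoc a c (b + d) ⟨
      (a + c) + (b + d) ∎

  infix 4 _≋_
  _≋_ : (ℕ → Carrier) → (ℕ → Carrier) → Set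
  f ≋ g = ∀ n → f n ≈ g n

  ∑ : ℕ → (ℕ → Carrier) → Carrier
  ∑ zero    f = 0#
  ∑ (suc n) f = f 0 + ∑ n (f ∘ suc)

  ∑-cong : ∀ n → (∀ i → i < n → f i ≈ g i) → ∑ n f ≈ ∑ n g
  ∑-cong zero    _   = refl
  ∑-cong (suc n) f≈g = +-cong (f≈g 0 (s≤s z≤n)) (∑-cong n (λ i i<n → f≈g (suc i) (s≤s i<n)))

  ∑-zero : ∀ n → (∀ i → i < n → f i ≈ 0#) → ∑ n f ≈ 0#
  ∑-zero         zero    _   = refl
  ∑-zero {f = f} (suc n) f≈0 = begin
    f 0 + ∑ n (f ∘ suc) ≈⟨ +-cong (f≈0 0 (s≤s z≤n)) (∑-zero n (λ i i<n → f≈0 (suc i) (s≤s i<n))) ⟩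
    0# + 0#             ≈⟨ +-identityˡ 0# ⟩
    0#                  ∎

  ∑-+ : ∀ n f g → ∑ n (λ i → f i + g i) ≈ ∑ n f + ∑ n g
  ∑-+ zero    f g = sym (+-identityˡ 0#)
  ∑-+ (suc n) f g = begin
    (f 0 + g 0) + ∑ n (λ i → f (suc i) + g (suc i)) ≈⟨ +-congˡ (∑-+ n (f ∘ suc) (g ∘ suc)) ⟩
    (f 0 + g 0) + (∑ n (f ∘ suc) + ∑ n (g ∘ suc))   ≈⟨ interchange (f 0) (g 0) _ _ ⟩
    ∑ (suc n) f + ∑ (suc n) g                       ∎

  ∑-*ˡ : ∀ n c f → ∑ n (λ i → c * f i) ≈ c * ∑ n f
  ∑-*ˡ zero    c f = sym (zeroʳ c)
  ∑-*ˡ (suc n) c f = begin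
    c * f 0 + ∑ n (λ i → c * f (suc i)) ≈⟨ +-congˡ (∑-*ˡ n c (f ∘ suc)) ⟩
    c * f 0 + c * ∑ n (f ∘ suc)         ≈⟨ distribˡ c (f 0) _ ⟨
    c * ∑ (suc n) f                     ∎

  ∑-split : ∀ m n f → ∑ (m ℕ.+ n) f ≈ ∑ m f + ∑ n (λ i → f (m ℕ.+ i))
  ∑-split zero    n f = sym (+-identityˡ _)
  ∑-split (suc m) n f = begin
    f 0 + ∑ (m ℕ.+ n) (f ∘ suc)                               ≈⟨ +-congˡ (∑-split m n (f ∘ suc)) ⟩
    f 0 + (∑ m (f ∘ suc) + ∑ n (λ i → f (suc (m ℕ.+ i))))     ≈⟨ +-assoc _ _ _ ⟨
    ∑ (suc m) f + ∑ n (λ i → f (suc m ℕ.+ i))                 ∎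

  ∑-snoc : ∀ n f → ∑ (suc n) f ≈ ∑ n f + f n
  ∑-snoc zero    f = +-comm (f 0) 0#
  ∑-snoc (suc n) f = begin
    f 0 + ∑ (suc n) (f ∘ suc)         ≈⟨ +-congˡ (∑-snoc n (f ∘ suc)) ⟩
    f 0 + (∑ n (f ∘ suc) + f (suc n)) ≈⟨ +-assoc _ _ _ ⟨
    ∑ (suc n) f + f (suc n)           ∎

  ∑-blocks : ∀ p m f → ∑ (m ℕ.* p) f ≈ ∑ m (λ a → ∑ p (λ r → f (a ℕ.* p ℕ.+ r)))
  ∑-blocks p zero    f = refl
  ∑-blocks p (suc m) f = begin
    ∑ (p ℕ.+ m ℕ.* p) f                            ≈⟨ ∑-split p (m ℕ.* p) f ⟩
    ∑ p f + ∑ (m ℕ.* p) (λ i → f (p ℕ.+ i))        ≈⟨ +-congˡ (∑-blocks p m (λ i → f (p ℕ.+ i))) ⟩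
    ∑ p f + ∑ m (λ a → ∑ p (λ r → f (p ℕ.+ (a ℕ.* p ℕ.+ r))))
      ≈⟨ +-congˡ (∑-cong m (λ a _ → ∑-cong p (λ r _ →
           reflexive (≡.cong f (≡.sym (ℕ.+-assoc p (a ℕ.* p) r)))))) ⟩
    ∑ (suc m) (λ a → ∑ p (λ r → f (a ℕ.* p ℕ.+ r))) ∎

  infixl 7 _⊛_
  infixl 6 _⊕_
  _⊛_ _⊕_ : (ℕ → Carrier) → (ℕ → Carrier) → ℕ → Carrier
  (f ⊛ g) n = ∑ (suc n) (λ i → f i * g (n ∸ i))
  (f ⊕ g) n = f n + g n

  0ₛ 1ₛ : ℕ → Carrier
  0ₛ n = 0#
  1ₛ zero    = 1#
  1ₛ (suc n) = 0#

  ⊛-cong : f ≋ f′ → g ≋ g′ → f ⊛ g ≋ f′ ⊛ g′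
  ⊛-cong f≋f′ g≋g′ n = ∑-cong (suc n) (λ i _ → *-cong (f≋f′ i) (g≋g′ (n ∸ i)))

  ⊛-distribʳ : ∀ h f g → (f ⊕ g) ⊛ h ≋ (f ⊛ h) ⊕ (g ⊛ h)
  ⊛-distribʳ h f g n = begin
    ∑ (suc n) (λ i → (f i + g i) * h (n ∸ i))                 ≈⟨ ∑-cong (suc n) (λ i _ → distribʳ (h (n ∸ i)) (f i) (g i)) ⟩
    ∑ (suc n) (λ i → f i * h (n ∸ i) + g i * h (n ∸ i))       ≈⟨ ∑-+ (suc n) (λ i → f i * h (n ∸ i)) (λ i → g i * h (n ∸ i)) ⟩
    (f ⊛ h) n + (g ⊛ h) n                                     ∎

  ⊛-zeroˡ : ∀ f → 0ₛ ⊛ f ≋ 0ₛ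
  ⊛-zeroˡ f n = ∑-zero (suc n) (λ i _ → zeroˡ (f (n ∸ i)))

  ⊛-identityˡ : ∀ f → 1ₛ ⊛ f ≋ f
  ⊛-identityˡ f n = begin
    1# * f n + ∑ n (λ i → 0# * f (n ∸ suc i)) ≈⟨ +-cong (*-identityˡ (f n)) (∑-zero n (λ i _ → zeroˡ _)) ⟩
    f n + 0#                                  ≈⟨ +-identityʳ (f n) ⟩
    f n                                       ∎

  ⊛-scaleˡ : ∀ c f g n → ((λ i → c * f i) ⊛ g) n ≈ c * (f ⊛ g) n
  ⊛-scaleˡ c f g n = begin
    ∑ (suc n) (λ i → (c * f i) * g (n ∸ i)) ≈⟨ ∑-cong (suc n) (λ i _ → *-assoc c (f i) (g (n ∸ i))) ⟩
    ∑ (suc n) (λ i → c * (f i * g (n ∸ i))) ≈⟨ ∑-*ˡ (suc n) c (λ i → f i * g (n ∸ i)) ⟩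
    c * (f ⊛ g) n                           ∎

  ⊛-snoc : ∀ f g n → (f ⊛ g) (suc n) ≈ (f ⊛ (g ∘ suc)) n + f (suc n) * g 0
  ⊛-snoc f g zero    = +-cong (sym (+-identityʳ _)) (+-identityʳ _)
  ⊛-snoc f g (suc n) = begin
    f 0 * g (suc (suc n)) + ((f ∘ suc) ⊛ g) (suc n)
      ≈⟨ +-congˡ (⊛-snoc (f ∘ suc) g n) ⟩
    f 0 * g (suc (suc n)) + (((f ∘ suc) ⊛ (g ∘ suc)) n + f (suc (suc n)) * g 0)
      ≈⟨ +-assoc _ _ _ ⟨
    (f ⊛ (g ∘ suc)) (suc n) + f (suc (suc n)) * g 0 ∎

  ⊛-comm : ∀ f g → f ⊛ g ≋ g ⊛ f
  ⊛-comm f g zero    = +-congʳ (*-comm (f 0) (g 0))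
  ⊛-comm f g (suc n) = begin
    f 0 * g (suc n) + ((f ∘ suc) ⊛ g) n ≈⟨ +-cong (*-comm _ _) (⊛-comm (f ∘ suc) g n) ⟩
    g (suc n) * f 0 + (g ⊛ (f ∘ suc)) n ≈⟨ +-comm _ _ ⟩
    (g ⊛ (f ∘ suc)) n + g (suc n) * f 0 ≈⟨ ⊛-snoc g f n ⟨
    (g ⊛ f) (suc n)                     ∎

  ⊛-assoc : ∀ f g h → (f ⊛ g) ⊛ h ≋ f ⊛ (g ⊛ h)
  ⊛-assoc f g h zero = begin
    (f 0 * g 0 + 0#) * h 0 + 0# ≈⟨ +-congʳ (*-congʳ (+-identityʳ _)) ⟩
    f 0 * g 0 * h 0 + 0#        ≈⟨ +-congʳ (*-assoc _ _ _) ⟩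
    f 0 * (g 0 * h 0) + 0#      ≈⟨ +-congʳ (*-congˡ (+-identityʳ _)) ⟨
    f 0 * (g 0 * h 0 + 0#) + 0# ∎
  ⊛-assoc f g h (suc n) = begin
    (f 0 * g 0 + 0#) * h (suc n) + ((λ i → f 0 * g (suc i) + ((f ∘ suc) ⊛ g) i) ⊛ h) n
      ≈⟨ +-cong (trans (*-congʳ (+-identityʳ _)) (*-assoc _ _ _))
           (⊛-distribʳ h (λ i → f 0 * g (suc i)) ((f ∘ suc) ⊛ g) n) ⟩
    f 0 * (g 0 * h (suc n)) + (((λ i → f 0 * g (suc i)) ⊛ h) n + (((f ∘ suc) ⊛ g) ⊛ h) n)
      ≈⟨ +-congˡ (+-cong (⊛-scaleˡ (f 0) (g ∘ suc) h n) (⊛-assoc (f ∘ suc) g h n)) ⟩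
    f 0 * (g 0 * h (suc n)) + (f 0 * ((g ∘ suc) ⊛ h) n + ((f ∘ suc) ⊛ (g ⊛ h)) n)
      ≈⟨ +-assoc _ _ _ ⟨
    (f 0 * (g 0 * h (suc n)) + f 0 * ((g ∘ suc) ⊛ h) n) + ((f ∘ suc) ⊛ (g ⊛ h)) n
      ≈⟨ +-congʳ (distribˡ (f 0) _ _) ⟨
    (f ⊛ (g ⊛ h)) (suc n) ∎

  seriesSemiring : CommutativeSemiring 0ℓ 0ℓ
  seriesSemiring = record
    { Carrier = ℕ → Carrier
    ; _≈_ = _≋_
    ; _+_ = _⊕_
    ; _*_ = _⊛_
    ; 0# = 0ₛ
    ; 1# = 1ₛ
    ; isCommutativeSemiring = isCommutativeSemiringˡ record
      { +-isCommutativeMonoid = record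
        { isMonoid = record
          { isSemigroup = record
            { isMagma = record
              { isEquivalence = record
                { refl  = λ _ → refl
                ; sym   = λ f≋g n → sym (f≋g n)
                ; trans = λ f≋g g≋h n → trans (f≋g n) (g≋h n)
                }
              ; ∙-cong = λ f≋g h≋k n → +-cong (f≋g n) (h≋k n)
              }
            ; assoc = λ f g h n → +-assoc (f n) (g n) (h n)
            }
          ; identity = (λ f n → +-identityˡ (f n)) , (λ f n → +-identityʳ (f n))
          }
        ; comm = λ f g n → +-comm (f n) (g n)
        }
      ; *-isCommutativeMonoid = record
        { isMonoid = record
          { isSemigroup = record
            { isMagma = record
              { isEquivalence = record
                { refl  = λ _ → refl
                ; sym   = λ f≋g n → sym (f≋g n)
                ; trans = λ f≋g g≋h n → trans (f≋g n) (g≋h n)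
                }
              ; ∙-cong = ⊛-cong
              }
            ; assoc = ⊛-assoc
            }
          ; identity = ⊛-identityˡ , (λ f n → trans (⊛-comm f 1ₛ n) (⊛-identityˡ f n))
          }
        ; comm = ⊛-comm
        }
      ; distribʳ = ⊛-distribʳ
      ; zeroˡ = ⊛-zeroˡ
      }
    }

  ⊛-cancel-0 : f 0 ≈ 1# → f ⊛ g ≋ 0ₛ → g ≋ 0ₛ
  ⊛-cancel-0 {f} {g} f0≈1 fg≋0 n = below (suc n) n ℕ.≤-refl
    where
    below : ∀ k i → i < k → g i ≈ 0#
    below (suc k) i (s≤s i≤k) = begin
      g i                                            ≈⟨ *-identityˡ (g i) ⟨
      1# * g i                                       ≈⟨ *-congʳ f0≈1 ⟨
      f 0 * g i                                      ≈⟨ +-identityʳ _ ⟨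
      f 0 * g i + 0#                                 ≈⟨ +-congˡ (∑-zero i tail) ⟨
      (f ⊛ g) i                                      ≈⟨ fg≋0 i ⟩
      0#                                             ∎
      where
      tail : ∀ j → j < i → f (suc j) * g (i ∸ suc j) ≈ 0#
      tail j j<i = trans
        (*-congˡ (below k (i ∸ suc j) (ℕ.<-≤-trans (ℕ.∸-monoʳ-< {o = 0} (s≤s z≤n) j<i) i≤k)))
        (zeroʳ _)

  -- Sections of a series along residue classes modulo p

  module Sections (p : ℕ) (0<p : 0 < p) where

    open import Data.Nat using (_%_)

    instance
      p≢0 : ℕ.NonZero p
      p≢0 = ℕ.>-nonZero 0<p

    section : ℕ → (ℕ → Carrier) → ℕ → Carrier
    section s f m = f (m ℕ.* p ℕ.+ s)

    C : (ℕ → Carrier) → ℕ → Carrier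
    C f m = f (m ℕ.* p)

    residue : ∀ m {s} → s < p → (m ℕ.* p ℕ.+ s) % p ≡ s
    residue m {s} s<p = ≡.trans (≡.cong (_% p) (ℕ.+-comm (m ℕ.* p) s))
      (≡.trans ([m+kn]%n≡m%n s m p) (m<n⇒m%n≡m s<p))

    residue-0 : ∀ m → (m ℕ.* p) % p ≡ 0
    residue-0 m = ≡.trans (≡.cong (_% p) (≡.sym (ℕ.+-identityʳ (m ℕ.* p)))) (residue m 0<p)

    -- Cut the convolution sum into blocks of length p. By hypothesis each block keeps only its
    -- first term, the one at a multiple of p; the last block is shorter and has s + 1 terms.
    ⊛-section : ∀ f g m {s} → s < p →
      (∀ i → i ≤ m ℕ.* p ℕ.+ s → ¬ i % p ≡ 0 → f i * g (m ℕ.* p ℕ.+ s ∸ i) ≈ 0#) →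
      section s (f ⊛ g) m ≈ (C f ⊛ section s g) m
    ⊛-section f g m {s} s<p vanish = begin
      ∑ (suc (m ℕ.* p ℕ.+ s)) t
        ≡⟨ ≡.cong (λ k → ∑ k t) (ℕ.+-suc (m ℕ.* p) s) ⟨
      ∑ (m ℕ.* p ℕ.+ suc s) t
        ≈⟨ ∑-split (m ℕ.* p) (suc s) t ⟩
      ∑ (m ℕ.* p) t + ∑ (suc s) (λ r → t (m ℕ.* p ℕ.+ r))
        ≈⟨ +-cong (trans (∑-blocks p m t) (∑-cong m inner)) outer ⟩
      ∑ m (λ a → t (a ℕ.* p)) + t (m ℕ.* p)
        ≈⟨ ∑-snoc m (λ a → t (a ℕ.* p)) ⟨
      ∑ (suc m) (λ a → t (a ℕ.* p))
        ≈⟨ ∑-cong (suc m) (λ { a (s≤s a≤m) → *-congˡ {f (a ℕ.* p)} (reflexive (≡.cong g (index a a≤m))) }) ⟩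
      (C f ⊛ section s g) m ∎
      where
      t : ℕ → Carrier
      t i = f i * g (m ℕ.* p ℕ.+ s ∸ i)

      index : ∀ a → a ≤ m → m ℕ.* p ℕ.+ s ∸ a ℕ.* p ≡ (m ∸ a) ℕ.* p ℕ.+ s
      index a a≤m = ≡.trans (ℕ.+-∸-comm s (ℕ.*-monoˡ-≤ p a≤m))
        (≡.cong (ℕ._+ s) (≡.sym (ℕ.*-distribʳ-∸ p m a)))

      nonzero : ∀ a {r} → suc r < p → ¬ (a ℕ.* p ℕ.+ suc r) % p ≡ 0
      nonzero a r<p e with () ← ≡.trans (≡.sym (residue a r<p)) e

      block : ∀ k → k < p → ∀ a → (∀ r → r < k → a ℕ.* p ℕ.+ suc r ≤ m ℕ.* p ℕ.+ s) →
              ∑ (suc k) (λ r → t (a ℕ.* p ℕ.+ r)) ≈ t (a ℕ.* p)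
      block k k<p a bound = begin
        t (a ℕ.* p ℕ.+ 0) + ∑ k (λ r → t (a ℕ.* p ℕ.+ suc r))
          ≈⟨ +-cong (reflexive (≡.cong t (ℕ.+-identityʳ (a ℕ.* p))))
               (∑-zero k (λ r r<k → vanish _ (bound r r<k) (nonzero a (ℕ.≤-<-trans r<k k<p)))) ⟩
        t (a ℕ.* p) + 0# ≈⟨ +-identityʳ _ ⟩
        t (a ℕ.* p) ∎

      inner : ∀ a → a < m → ∑ p (λ r → t (a ℕ.* p ℕ.+ r)) ≈ t (a ℕ.* p)
      -- `block` counts `suc k` terms, so a full block is the case k = p - 1.
      inner a a<m = ≡.subst (λ q → ∑ q (λ r → t (a ℕ.* p ℕ.+ r)) ≈ t (a ℕ.* p))
        (ℕ.suc-pred p)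
        (block (ℕ.pred p) (≡.subst (ℕ.pred p <_) (ℕ.suc-pred p) ℕ.≤-refl) a
          (λ r r<k → ℕ.≤-trans
            (ℕ.≤-trans (ℕ.+-monoʳ-≤ (a ℕ.* p) (ℕ.≤-trans (ℕ.m<n⇒m<1+n r<k) (ℕ.≤-reflexive (ℕ.suc-pred p))))
              (ℕ.≤-trans (ℕ.≤-reflexive (ℕ.+-comm (a ℕ.* p) p)) (ℕ.*-monoˡ-≤ p a<m)))
            (ℕ.m≤m+n (m ℕ.* p) s)))

      outer : ∑ (suc s) (λ r → t (m ℕ.* p ℕ.+ r)) ≈ t (m ℕ.* p)
      outer = block s s<p m (λ r r<s → ℕ.+-monoʳ-≤ (m ℕ.* p) r<s)

    C-⊛ : ∀ f g m → (∀ i → i ≤ m ℕ.* p → ¬ i % p ≡ 0 → f i * g (m ℕ.* p ∸ i) ≈ 0#) →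
          C (f ⊛ g) m ≈ (C f ⊛ C g) m
    C-⊛ f g m vanish = begin
      C (f ⊛ g) m               ≡⟨ ≡.cong (f ⊛ g) (ℕ.+-identityʳ (m ℕ.* p)) ⟨
      section 0 (f ⊛ g) m       ≈⟨ ⊛-section f g m 0<p (≡.subst (λ n → ∀ i → i ≤ n → ¬ i % p ≡ 0 → f i * g (n ∸ i) ≈ 0#)
                                     (≡.sym (ℕ.+-identityʳ (m ℕ.* p))) vanish) ⟩
      (C f ⊛ section 0 g) m     ≈⟨ ⊛-cong {f = C f} (λ _ → refl) (λ a → reflexive (≡.cong g (ℕ.+-identityʳ (a ℕ.* p)))) m ⟩
      (C f ⊛ C g) m             ∎

    Supported : ℕ → (ℕ → Carrier) → Set
    Supported k f = ∀ n → k < n % p → f n ≈ 0#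

    residue-+ : ∀ {i n} → i ≤ n → i % p ℕ.+ (n ∸ i) % p < p → n % p ≡ i % p ℕ.+ (n ∸ i) % p
    residue-+ {i} {n} i≤n lt = ≡.trans (≡.cong (_% p) (≡.sym (ℕ.m+[n∸m]≡n i≤n)))
      (≡.trans (%-distribˡ-+ i (n ∸ i) p) (m<n⇒m%n≡m lt))

    -- If neither factor is killed by its support, the residues of i and n - i are at most j and k.
    -- Their sum stays below p, so there is no carry and it is the residue of n.
    vanish-unless : ∀ {j k} → j ℕ.+ k < p → Supported j f → Supported k g →
      ∀ n i → i ≤ n → ¬ (n % p ≡ i % p ℕ.+ (n ∸ i) % p × n % p ≤ j ℕ.+ k) → f i * g (n ∸ i) ≈ 0#
    vanish-unless {j = j} {k} j+k<p sf sg n i i≤n not with i % p ℕ.≤? j | (n ∸ i) % p ℕ.≤? k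
    ... | no  i≰j | _       = trans (*-congʳ (sf i (ℕ.≰⇒> i≰j))) (zeroˡ _)
    ... | yes _   | no  i≰k = trans (*-congˡ (sg (n ∸ i) (ℕ.≰⇒> i≰k))) (zeroʳ _)
    ... | yes i≤j | yes i≤k = contradiction
      (eq , ℕ.≤-trans (ℕ.≤-reflexive eq) (ℕ.+-mono-≤ i≤j i≤k)) not
      where eq = residue-+ i≤n (ℕ.≤-<-trans (ℕ.+-mono-≤ i≤j i≤k) j+k<p)

    ⊛-supported : ∀ {j k} → j ℕ.+ k < p → Supported j f → Supported k g → Supported (j ℕ.+ k) (f ⊛ g)
    ⊛-supported j+k<p sf sg n lt = ∑-zero (suc n) (λ { i (s≤s i≤n) →
      vanish-unless j+k<p sf sg n i i≤n (λ { (_ , le) → ℕ.<⇒≱ lt le }) })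

    -- At a multiple of p the carry-free sum of the two residues is 0, so both are 0.
    C-⊛-supported : ∀ {j k} → j ℕ.+ k < p → Supported j f → Supported k g → C (f ⊛ g) ≋ C f ⊛ C g
    C-⊛-supported {f} {g} j+k<p sf sg m = C-⊛ f g m (λ i i≤n i%p≢0 →
      vanish-unless j+k<p sf sg (m ℕ.* p) i i≤n
        (λ { (eq , _) → i%p≢0 (ℕ.m+n≡0⇒m≡0 (i % p) (≡.trans (≡.sym eq) (residue-0 m))) }))

-- The sequences u and v

open ≡ using (refl; sym; trans; cong; cong₂; subst)

-- Integers inside the rationals

ι : ℤ → ℚ
ι z = z / 1

toℚᵘ-ι : ∀ z → ℚ.toℚᵘ (ι z) ℚᵘ.≃ ℚᵘ.mkℚᵘ z 0
toℚᵘ-ι z = ℚ.toℚᵘ-fromℚᵘ (ℚᵘ.mkℚᵘ z 0)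

ι-+ : ∀ a b → ι (a ℤ.+ b) ≡ ι a ℚ.+ ι b
ι-+ a b = ℚ.toℚᵘ-injective (ℚᵘ.≃-trans (toℚᵘ-ι (a ℤ.+ b))
  (ℚᵘ.≃-sym (ℚᵘ.≃-trans (ℚ.toℚᵘ-homo-+ (ι a) (ι b))
    (ℚᵘ.≃-trans (ℚᵘ.+-cong (toℚᵘ-ι a) (toℚᵘ-ι b)) (ℚᵘ.*≡* (identity a b))))))
  where
  identity : ∀ a b → (a ℤ.* + 1 ℤ.+ b ℤ.* + 1) ℤ.* + 1 ≡ (a ℤ.+ b) ℤ.* + 1
  identity = ℤ-solve

ι-* : ∀ a b → ι (a ℤ.* b) ≡ ι a ℚ.* ι b
ι-* a b = ℚ.toℚᵘ-injective (ℚᵘ.≃-trans (toℚᵘ-ι (a ℤ.* b))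
  (ℚᵘ.≃-sym (ℚᵘ.≃-trans (ℚ.toℚᵘ-homo-* (ι a) (ι b))
    (ℚᵘ.≃-trans (ℚᵘ.*-cong (toℚᵘ-ι a) (toℚᵘ-ι b)) (ℚᵘ.*≡* refl)))))

ι-injective : ∀ {a b} → ι a ≡ ι b → a ≡ b
ι-injective {a} {b} eq with ℚᵘ.≃-trans (ℚᵘ.≃-sym (toℚᵘ-ι a)) (ℚᵘ.≃-trans (ℚᵘ.≃-reflexive (cong ℚ.toℚᵘ eq)) (toℚᵘ-ι b))
... | ℚᵘ.*≡* e = trans (sym (ℤ.*-identityʳ a)) (trans e (ℤ.*-identityʳ b))

ι-1/ : ∀ n → ι (+ suc n) ℚ.* (+ 1 / suc n) ≡ 1ℚ
ι-1/ n = ℚ.toℚᵘ-injective (ℚᵘ.≃-trans (ℚ.toℚᵘ-homo-* (ι (+ suc n)) (+ 1 / suc n))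
  (ℚᵘ.≃-trans (ℚᵘ.*-cong (toℚᵘ-ι (+ suc n)) (ℚ.toℚᵘ-fromℚᵘ (ℚᵘ.mkℚᵘ (+ 1) n)))
    (ℚᵘ.*≡* (identity (+ suc n) _ (cong +_ (ℕ.+-identityʳ (suc n)))))))
  where
  identity : ∀ a b → b ≡ a → (a ℤ.* + 1) ℤ.* + 1 ≡ + 1 ℤ.* b
  identity a .a refl = ring a
    where
    ring : ∀ a → (a ℤ.* + 1) ℤ.* + 1 ≡ + 1 ℤ.* a
    ring = ℤ-solve

ℚ-ring : AlmostCommutativeRing 0ℓ 0ℓ
ℚ-ring = fromCommutativeRing ℚ.+-*-commutativeRing (λ _ → nothing)

module ℤ[[t]] = Series ℤ.+-*-commutativeRing
module ℚ[[t]] = Series ℚ.+-*-commutativeRing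

ι-⊛ : ∀ f g n → ι ((f ℤ[[t]].⊛ g) n) ≡ ((ι ∘ f) ℚ[[t]].⊛ (ι ∘ g)) n
ι-⊛ f g n = sum (suc n) (λ i → f i) (λ i → g (n ∸ i))
  where
  sum : ∀ k (f g : ℕ → ℤ) → ι (ℤ[[t]].∑ k (λ i → f i ℤ.* g i)) ≡ ℚ[[t]].∑ k (λ i → ι (f i) ℚ.* ι (g i))
  sum zero    f g = refl
  sum (suc k) f g = trans (ι-+ (f 0 ℤ.* g 0) _) (cong₂ ℚ._+_ (ι-* (f 0) (g 0)) (sum k (f ∘ suc) (g ∘ suc)))

conv≡⊛ : ∀ f g n → conv f g n ≡ (f ℚ[[t]].⊛ g) n
conv≡⊛ f g zero    = sym (ℚ.+-identityʳ _)
conv≡⊛ f g (suc n) = trans (shift n f n) (cong (f 0 ℚ.* g (suc n) ℚ.+_) (conv≡⊛ (f ∘ suc) g n))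
  where
  shift : ∀ n f i → convAux f g (suc n) (suc i) ≡ f 0 ℚ.* g (suc n) ℚ.+ convAux (f ∘ suc) g n i
  shift n f zero    = refl
  shift n f (suc i) = trans (cong (ℚ._+ f (suc (suc i)) ℚ.* g (n ∸ suc i)) (shift n f i))
                            (ℚ.+-assoc (f 0 ℚ.* g (suc n)) _ _)

-- The rescaled hypergeometric coefficients

rescaled : (ℕ → ℚ) → ℕ → ℚ
rescaled f n = (ℕ→ℚ 108 ^ℚ n) ℚ.* f n

^ℚ-+ : ∀ x i j → x ^ℚ (i ℕ.+ j) ≡ (x ^ℚ i) ℚ.* (x ^ℚ j)
^ℚ-+ x zero    j = sym (ℚ.*-identityˡ _)
^ℚ-+ x (suc i) j = trans (cong (x ℚ.*_) (^ℚ-+ x i j)) (sym (ℚ.*-assoc x _ _))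

rescaled-⊛ : ∀ f g n → rescaled (f ℚ[[t]].⊛ g) n ≡ (rescaled f ℚ[[t]].⊛ rescaled g) n
rescaled-⊛ f g n = trans (sym (ℚ[[t]].∑-*ˡ (suc n) (ℕ→ℚ 108 ^ℚ n) (λ i → f i ℚ.* g (n ∸ i))))
  (ℚ[[t]].∑-cong {f = λ i → (ℕ→ℚ 108 ^ℚ n) ℚ.* (f i ℚ.* g (n ∸ i))} {g = λ i → rescaled f i ℚ.* rescaled g (n ∸ i)}
    (suc n) (λ { i (s≤s i≤n) → trans
    (cong (ℚ._* (f i ℚ.* g (n ∸ i))) (trans (cong (ℕ→ℚ 108 ^ℚ_) (sym (ℕ.m+[n∸m]≡n i≤n))) (^ℚ-+ _ i (n ∸ i))))
    (exchange (ℕ→ℚ 108 ^ℚ i) (ℕ→ℚ 108 ^ℚ (n ∸ i)) (f i) (g (n ∸ i))) }))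
  where
  exchange : ∀ a b c d → (a ℚ.* b) ℚ.* (c ℚ.* d) ≡ (a ℚ.* c) ℚ.* (b ℚ.* d)
  exchange = RingSolver.solve-∀ ℚ-ring

a : ℕ → ℚ
a = rescaled hypCoef

Amix≡a³ : ∀ n → Amix n ≡ (a ℚ[[t]].⊛ (a ℚ[[t]].⊛ a)) n
Amix≡a³ n = trans (cong ((ℕ→ℚ 108 ^ℚ n) ℚ.*_) (trans (conv≡⊛ hypCoef (conv hypCoef hypCoef) n)
    (ℚ[[t]].⊛-cong {f = hypCoef} {g = conv hypCoef hypCoef} {g′ = hypCoef ℚ[[t]].⊛ hypCoef} (λ _ → refl) (conv≡⊛ hypCoef hypCoef) n)))
  (trans (rescaled-⊛ hypCoef (hypCoef ℚ[[t]].⊛ hypCoef) n)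
    (ℚ[[t]].⊛-cong {f = a} {g = rescaled (hypCoef ℚ[[t]].⊛ hypCoef)} {g′ = a ℚ[[t]].⊛ a} (λ _ → refl) (rescaled-⊛ hypCoef hypCoef) n))

-- With 108 = 6 · 6 · 3, one 6 and the 3 clear the denominators of 1/6 + n and 1/3 + n. The
-- right-hand side is 6 (1 + 6n)(1 + 3n) `a n` multiplied out, the form suited to the operator `θ`
-- below.
a-recurrence : ∀ n → ι (+ suc n) ℚ.* (ι (+ suc n) ℚ.* a (suc n)) ≡
  ι (+ 108) ℚ.* (ι (+ n) ℚ.* (ι (+ n) ℚ.* a n)) ℚ.+ (ι (+ 54) ℚ.* (ι (+ n) ℚ.* a n) ℚ.+ ι (+ 6) ℚ.* a n)
a-recurrence n = trans
  (rearrange (ι (+ 6)) (ι (+ 3)) (ℕ→ℚ 108 ^ℚ n) (poch (+ 1 / 6) n) (poch (+ 1 / 3) n) (invFact n)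
    (+ 1 / 6) (+ 1 / 3) (ι (+ n)) (ι (+ suc n)) (+ 1 / suc n))
  (trans (cong (λ z → (z ℚ.* z) ℚ.* (ι (+ 6) ℚ.* ((1ℚ ℚ.+ ι (+ 6) ℚ.* ι (+ n)) ℚ.* (1ℚ ℚ.+ ι (+ 3) ℚ.* ι (+ n)))
      ℚ.* a n)) (ι-1/ n))
    (expand (ι (+ n)) (a n)))
  where
  rearrange : ∀ c₆ c₃ X P₁ P₂ F s t K K₁ w →
    K₁ ℚ.* (K₁ ℚ.* (((c₆ ℚ.* (c₆ ℚ.* c₃)) ℚ.* X) ℚ.* ((P₁ ℚ.* (s ℚ.+ K)) ℚ.* (P₂ ℚ.* (t ℚ.+ K)) ℚ.* ((F ℚ.* w) ℚ.* (F ℚ.* w))))) ≡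
    ((K₁ ℚ.* w) ℚ.* (K₁ ℚ.* w)) ℚ.* (c₆ ℚ.* ((c₆ ℚ.* s ℚ.+ c₆ ℚ.* K) ℚ.* (c₃ ℚ.* t ℚ.+ c₃ ℚ.* K)) ℚ.* (X ℚ.* (P₁ ℚ.* P₂ ℚ.* (F ℚ.* F))))
  rearrange = RingSolver.solve-∀ ℚ-ring
  expand : ∀ N y → (1ℚ ℚ.* 1ℚ) ℚ.* (ι (+ 6) ℚ.* ((1ℚ ℚ.+ ι (+ 6) ℚ.* N) ℚ.* (1ℚ ℚ.+ ι (+ 3) ℚ.* N)) ℚ.* y) ≡
    ι (+ 108) ℚ.* (N ℚ.* (N ℚ.* y)) ℚ.+ (ι (+ 54) ℚ.* (N ℚ.* y) ℚ.+ ι (+ 6) ℚ.* y)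
  expand = RingSolver.solve-∀ ℚ-ring

-- The binomial sequence v and its recurrence

[m+n]Cm*m!*n! : ∀ m n → ((m ℕ.+ n) choose m) ℕ.* (m ! ℕ.* n !) ≡ (m ℕ.+ n) !
[m+n]Cm*m!*n! m n = subst (λ k → ((m ℕ.+ n) choose m) ℕ.* (m ! ℕ.* k !) ≡ (m ℕ.+ n) !) (ℕ.m+n∸m≡n m n)
  (trans (cong (ℕ._* (m ! ℕ.* (m ℕ.+ n ∸ m) !)) (nCk≡n!/k![n-k]! m≤))
         (m/n*n≡m {{m ℕ.!* (m ℕ.+ n ∸ m) !≢0}} (k![n∸k]!∣n! m≤)))
  where
  m≤ : m ≤ m ℕ.+ n
  m≤ = ℕ.m≤m+n m n

central : ℕ → ℕ
central n = (n ℕ.+ n) choose n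

central-even : ∀ n → ∃[ k ] central (suc n) ≡ 2 ℕ.* k
central-even n = k , (begin
  (suc n ℕ.+ suc n) choose suc n    ≡⟨ cong (_choose suc n) (cong suc (ℕ.+-suc n n)) ⟩
  suc (suc (n ℕ.+ n)) choose suc n  ≡⟨ nCk+nC[k+1]≡[n+1]C[k+1] (suc (n ℕ.+ n)) n ⟨
  k ℕ.+ suc (n ℕ.+ n) choose suc n  ≡⟨ cong (k ℕ.+_) (nCk≡nC[n∸k] (s≤s (ℕ.m≤m+n n n))) ⟩
  k ℕ.+ suc (n ℕ.+ n) choose (n ℕ.+ n ∸ n) ≡⟨ cong (λ j → k ℕ.+ suc (n ℕ.+ n) choose j) (ℕ.m+n∸m≡n n n) ⟩
  k ℕ.+ k                      ≡⟨ cong (k ℕ.+_) (ℕ.+-identityʳ k) ⟨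
  2 ℕ.* k                      ∎)
  where
  open ≡.≡-Reasoning
  k = suc (n ℕ.+ n) choose n

V : ℕ → ℕ
V n = (central n ℕ.* central n) ℕ.* ((n ℕ.+ (n ℕ.+ n)) choose n)

4∣V : ∀ n → ∃[ k ] V (suc n) ≡ 4 ℕ.* k
4∣V n with central-even n
... | k , e = k ℕ.* k ℕ.* c , trans (cong (λ z → (z ℕ.* z) ℕ.* c) e) (identity k c)
  where
  c = (suc n ℕ.+ (suc n ℕ.+ suc n)) choose suc n
  identity : ∀ k c → (2 ℕ.* k ℕ.* (2 ℕ.* k)) ℕ.* c ≡ 4 ℕ.* (k ℕ.* k ℕ.* c)
  identity = ℕ-solve

5! : ℕ → ℕ
5! n = (n ! ℕ.* n !) ℕ.* (n ! ℕ.* n !) ℕ.* n !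

-- The two central binomials contribute (2n)!², and C(3n, n) has one (2n)! in its denominator.
-- Multiplying by (2n)! makes all three binomials expressible by factorials.
V*n!⁵ : ∀ n → V n ℕ.* 5! n ≡ (n ℕ.+ n) ! ℕ.* (n ℕ.+ (n ℕ.+ n)) !
V*n!⁵ n = ℕ.*-cancelʳ-≡ _ _ ((n ℕ.+ n) !) {{(n ℕ.+ n) ℕ.!≢0}} (begin
  V n ℕ.* 5! n ℕ.* (n ℕ.+ n) !
    ≡⟨ rearrange (central n) ((n ℕ.+ (n ℕ.+ n)) choose n) (n !) ((n ℕ.+ n) !) ⟩
  (central n ℕ.* (n ! ℕ.* n !)) ℕ.* (central n ℕ.* (n ! ℕ.* n !)) ℕ.* (((n ℕ.+ (n ℕ.+ n)) choose n) ℕ.* (n ! ℕ.* (n ℕ.+ n) !))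
    ≡⟨ cong₂ (λ x y → x ℕ.* x ℕ.* y) ([m+n]Cm*m!*n! n n) ([m+n]Cm*m!*n! n (n ℕ.+ n)) ⟩
  (n ℕ.+ n) ! ℕ.* (n ℕ.+ n) ! ℕ.* (n ℕ.+ (n ℕ.+ n)) !
    ≡⟨ swap ((n ℕ.+ n) !) _ ⟩
  (n ℕ.+ n) ! ℕ.* (n ℕ.+ (n ℕ.+ n)) ! ℕ.* (n ℕ.+ n) ! ∎)
  where
  open ≡.≡-Reasoning
  rearrange : ∀ c d f g → (c ℕ.* c) ℕ.* d ℕ.* ((f ℕ.* f) ℕ.* (f ℕ.* f) ℕ.* f) ℕ.* g ≡
    (c ℕ.* (f ℕ.* f)) ℕ.* (c ℕ.* (f ℕ.* f)) ℕ.* (d ℕ.* (f ℕ.* g))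
  rearrange = ℕ-solve
  swap : ∀ x y → x ℕ.* x ℕ.* y ≡ x ℕ.* y ℕ.* x
  swap = ℕ-solve

V-recurrence : ∀ n → suc n ℕ.* (suc n ℕ.* suc n) ℕ.* V (suc n) ≡
  6 ℕ.* ((1 ℕ.+ 2 ℕ.* n) ℕ.* ((1 ℕ.+ 3 ℕ.* n) ℕ.* (2 ℕ.+ 3 ℕ.* n))) ℕ.* V n
-- The extra factor (n+1)² n!⁵ completes (n+1)³ to the (n+1)!⁵ of `V*n!⁵`.
V-recurrence n = ℕ.*-cancelʳ-≡ _ _ (suc n ℕ.* suc n ℕ.* 5! n) {{nonZero}} (begin
  suc n ℕ.* (suc n ℕ.* suc n) ℕ.* V (suc n) ℕ.* (suc n ℕ.* suc n ℕ.* 5! n)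
    ≡⟨ gather (suc n) (V (suc n)) (n !) ⟩
  V (suc n) ℕ.* 5! (suc n)
    ≡⟨ V*n!⁵ (suc n) ⟩
  (suc n ℕ.+ suc n) ! ℕ.* (suc n ℕ.+ (suc n ℕ.+ suc n)) !
    ≡⟨ cong₂ (λ i j → i ! ℕ.* j !) (double n) (triple n) ⟩
  (2 ℕ.+ (n ℕ.+ n)) ! ℕ.* (3 ℕ.+ (n ℕ.+ (n ℕ.+ n))) !
    ≡⟨ expand n ((n ℕ.+ n) !) ((n ℕ.+ (n ℕ.+ n)) !) ⟩
  6 ℕ.* ((1 ℕ.+ 2 ℕ.* n) ℕ.* ((1 ℕ.+ 3 ℕ.* n) ℕ.* (2 ℕ.+ 3 ℕ.* n))) ℕ.* (suc n ℕ.* suc n) ℕ.* ((n ℕ.+ n) ! ℕ.* (n ℕ.+ (n ℕ.+ n)) !)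
    ≡⟨ cong (6 ℕ.* ((1 ℕ.+ 2 ℕ.* n) ℕ.* ((1 ℕ.+ 3 ℕ.* n) ℕ.* (2 ℕ.+ 3 ℕ.* n))) ℕ.* (suc n ℕ.* suc n) ℕ.*_) (V*n!⁵ n) ⟨
  6 ℕ.* ((1 ℕ.+ 2 ℕ.* n) ℕ.* ((1 ℕ.+ 3 ℕ.* n) ℕ.* (2 ℕ.+ 3 ℕ.* n))) ℕ.* (suc n ℕ.* suc n) ℕ.* (V n ℕ.* 5! n)
    ≡⟨ exchange (6 ℕ.* ((1 ℕ.+ 2 ℕ.* n) ℕ.* ((1 ℕ.+ 3 ℕ.* n) ℕ.* (2 ℕ.+ 3 ℕ.* n)))) (suc n ℕ.* suc n) (V n) (5! n) ⟩
  6 ℕ.* ((1 ℕ.+ 2 ℕ.* n) ℕ.* ((1 ℕ.+ 3 ℕ.* n) ℕ.* (2 ℕ.+ 3 ℕ.* n))) ℕ.* V n ℕ.* (suc n ℕ.* suc n ℕ.* 5! n) ∎)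
  where
  open ≡.≡-Reasoning
  nonZero : ℕ.NonZero (suc n ℕ.* suc n ℕ.* 5! n)
  nonZero = ℕ.m*n≢0 (suc n ℕ.* suc n) (5! n) {{_}}
    {{ℕ.m*n≢0 ((n ! ℕ.* n !) ℕ.* (n ! ℕ.* n !)) (n !) {{ℕ.m*n≢0 (n ! ℕ.* n !) (n ! ℕ.* n !) {{n ℕ.!* n !≢0}} {{n ℕ.!* n !≢0}}}} {{n ℕ.!≢0}}}}
  gather : ∀ s v f → s ℕ.* (s ℕ.* s) ℕ.* v ℕ.* (s ℕ.* s ℕ.* ((f ℕ.* f) ℕ.* (f ℕ.* f) ℕ.* f)) ≡
    v ℕ.* (((s ℕ.* f) ℕ.* (s ℕ.* f)) ℕ.* ((s ℕ.* f) ℕ.* (s ℕ.* f)) ℕ.* (s ℕ.* f))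
  gather = ℕ-solve
  double : ∀ n → suc n ℕ.+ suc n ≡ 2 ℕ.+ (n ℕ.+ n)
  double = ℕ-solve
  triple : ∀ n → suc n ℕ.+ (suc n ℕ.+ suc n) ≡ 3 ℕ.+ (n ℕ.+ (n ℕ.+ n))
  triple = ℕ-solve
  expand : ∀ n f g → ((2 ℕ.+ (n ℕ.+ n)) ℕ.* ((1 ℕ.+ (n ℕ.+ n)) ℕ.* f)) ℕ.*
      ((3 ℕ.+ (n ℕ.+ (n ℕ.+ n))) ℕ.* ((2 ℕ.+ (n ℕ.+ (n ℕ.+ n))) ℕ.* ((1 ℕ.+ (n ℕ.+ (n ℕ.+ n))) ℕ.* g))) ≡
    6 ℕ.* ((1 ℕ.+ 2 ℕ.* n) ℕ.* ((1 ℕ.+ 3 ℕ.* n) ℕ.* (2 ℕ.+ 3 ℕ.* n))) ℕ.* ((1 ℕ.+ n) ℕ.* (1 ℕ.+ n)) ℕ.* (f ℕ.* g)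
  expand = ℕ-solve
  exchange : ∀ a b c d → a ℕ.* b ℕ.* (c ℕ.* d) ≡ a ℕ.* c ℕ.* (b ℕ.* d)
  exchange = ℕ-solve

-- Clausen's identity by comparison of recurrences

module Clausen where

  open ≡.≡-Reasoning
  open import Data.Rational using (_+_; _*_)
  open ℚ[[t]] using (∑; ∑-cong; ∑-+; ∑-*ˡ; _⊛_; ⊛-comm; ⊛-cong; ⊛-distribʳ; ⊛-scaleˡ)

  N : ℕ → ℚ
  N n = ι (+ n)

  N-suc : ∀ n → N (suc n) ≡ 1ℚ + N n
  N-suc n = ι-+ (+ 1) (+ n)

  θ : (ℕ → ℚ) → ℕ → ℚ
  θ f n = N n * f n

  θ-⊛ : ∀ f g n → N n * (f ⊛ g) n ≡ (θ f ⊛ g) n + (f ⊛ θ g) n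
  θ-⊛ f g n = begin
    N n * (f ⊛ g) n
      ≡⟨ ∑-*ˡ (suc n) (N n) (λ i → f i * g (n ∸ i)) ⟨
    ∑ (suc n) (λ i → N n * (f i * g (n ∸ i)))
      ≡⟨ ∑-cong {f = λ i → N n * (f i * g (n ∸ i))} (suc n) (λ { i (s≤s i≤n) → trans
           (cong (_* (f i * g (n ∸ i))) (trans (cong N (sym (ℕ.m+[n∸m]≡n i≤n))) (ι-+ (+ i) (+ (n ∸ i)))))
           (leibniz (N i) (N (n ∸ i)) (f i) (g (n ∸ i))) }) ⟩
    ∑ (suc n) (λ i → θ f i * g (n ∸ i) + f i * θ g (n ∸ i))
      ≡⟨ ∑-+ (suc n) (λ i → θ f i * g (n ∸ i)) (λ i → f i * θ g (n ∸ i)) ⟩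
    (θ f ⊛ g) n + (f ⊛ θ g) n ∎
    where
    leibniz : ∀ i j x y → (i + j) * (x * y) ≡ (i * x) * y + x * (j * y)
    leibniz = RingSolver.solve-∀ ℚ-ring

  b c e : ℕ → ℚ
  b = θ a
  c = θ b
  e = θ c

  linear : ∀ α f g h n → ((λ i → ι α * f i + g i) ⊛ h) n ≡ ι α * (f ⊛ h) n + (g ⊛ h) n
  linear α f g h n = trans (⊛-distribʳ h (λ i → ι α * f i) g n) (cong (_+ (g ⊛ h) n) (⊛-scaleˡ (ι α) f h n))

  shift : ∀ f h n → f 0 ≡ 0ℚ → (f ⊛ h) (suc n) ≡ ((f ∘ suc) ⊛ h) n
  shift f h n f0≡0 = trans (cong (λ z → z * h (suc n) + ((f ∘ suc) ⊛ h) n) f0≡0)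
    (trans (cong (_+ ((f ∘ suc) ⊛ h) n) (ℚ.*-zeroˡ (h (suc n)))) (ℚ.+-identityˡ _))

  c-suc : ∀ n → c (suc n) ≡ ι (+ 108) * c n + (ι (+ 54) * b n + ι (+ 6) * a n)
  c-suc = a-recurrence

  e-suc : ∀ n → e (suc n) ≡ ι (+ 108) * e n + (ι (+ 162) * c n + (ι (+ 60) * b n + ι (+ 6) * a n))
  e-suc n = trans (cong₂ _*_ (N-suc n) (c-suc n)) (expand (N n) (a n))
    where
    expand : ∀ k x → (1ℚ + k) * (ι (+ 108) * (k * (k * x)) + (ι (+ 54) * (k * x) + ι (+ 6) * x)) ≡
      ι (+ 108) * (k * (k * (k * x))) + (ι (+ 162) * (k * (k * x)) + (ι (+ 60) * (k * x) + ι (+ 6) * x))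
    expand = RingSolver.solve-∀ ℚ-ring

  c⊛-suc : ∀ h n → (c ⊛ h) (suc n) ≡ ι (+ 108) * (c ⊛ h) n + (ι (+ 54) * (b ⊛ h) n + ι (+ 6) * (a ⊛ h) n)
  c⊛-suc h n = begin
    (c ⊛ h) (suc n)   ≡⟨ shift c h n (ℚ.*-zeroˡ (b 0)) ⟩
    ((c ∘ suc) ⊛ h) n ≡⟨ ⊛-cong {g = h} c-suc (λ _ → refl) n ⟩
    ((λ i → ι (+ 108) * c i + (ι (+ 54) * b i + ι (+ 6) * a i)) ⊛ h) n
      ≡⟨ linear (+ 108) c (λ i → ι (+ 54) * b i + ι (+ 6) * a i) h n ⟩
    ι (+ 108) * (c ⊛ h) n + ((λ i → ι (+ 54) * b i + ι (+ 6) * a i) ⊛ h) n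
      ≡⟨ cong (ι (+ 108) * (c ⊛ h) n ℚ.+_) (trans (linear (+ 54) b (λ i → ι (+ 6) * a i) h n)
           (cong (ι (+ 54) * (b ⊛ h) n ℚ.+_) (⊛-scaleˡ (ι (+ 6)) a h n))) ⟩
    ι (+ 108) * (c ⊛ h) n + (ι (+ 54) * (b ⊛ h) n + ι (+ 6) * (a ⊛ h) n) ∎

  e⊛-suc : ∀ h n → (e ⊛ h) (suc n) ≡
    ι (+ 108) * (e ⊛ h) n + (ι (+ 162) * (c ⊛ h) n + (ι (+ 60) * (b ⊛ h) n + ι (+ 6) * (a ⊛ h) n))
  e⊛-suc h n = begin
    (e ⊛ h) (suc n)   ≡⟨ shift e h n (ℚ.*-zeroˡ (c 0)) ⟩
    ((e ∘ suc) ⊛ h) n ≡⟨ ⊛-cong {g = h} e-suc (λ _ → refl) n ⟩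
    ((λ i → ι (+ 108) * e i + (ι (+ 162) * c i + (ι (+ 60) * b i + ι (+ 6) * a i))) ⊛ h) n
      ≡⟨ linear (+ 108) e (λ i → ι (+ 162) * c i + (ι (+ 60) * b i + ι (+ 6) * a i)) h n ⟩
    ι (+ 108) * (e ⊛ h) n + ((λ i → ι (+ 162) * c i + (ι (+ 60) * b i + ι (+ 6) * a i)) ⊛ h) n
      ≡⟨ cong (ι (+ 108) * (e ⊛ h) n ℚ.+_) (trans (linear (+ 162) c (λ i → ι (+ 60) * b i + ι (+ 6) * a i) h n)
           (cong (ι (+ 162) * (c ⊛ h) n ℚ.+_) (trans (linear (+ 60) b (λ i → ι (+ 6) * a i) h n)
             (cong (ι (+ 60) * (b ⊛ h) n ℚ.+_) (⊛-scaleˡ (ι (+ 6)) a h n))))) ⟩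
    ι (+ 108) * (e ⊛ h) n + (ι (+ 162) * (c ⊛ h) n + (ι (+ 60) * (b ⊛ h) n + ι (+ 6) * (a ⊛ h) n)) ∎

  a² : ℕ → ℚ
  a² = a ⊛ a

  N*a² : ∀ n → N n * a² n ≡ ι (+ 2) * (b ⊛ a) n
  N*a² n = trans (θ-⊛ a a n) (trans (cong ((b ⊛ a) n ℚ.+_) (⊛-comm a b n)) (double ((b ⊛ a) n)))
    where
    double : ∀ x → x + x ≡ ι (+ 2) * x
    double = RingSolver.solve-∀ ℚ-ring

  N²*a² : ∀ n → N n * (N n * a² n) ≡ ι (+ 2) * ((c ⊛ a) n + (b ⊛ b) n)
  N²*a² n = trans (cong (N n *_) (N*a² n)) (trans (swap (N n) ((b ⊛ a) n)) (cong (ι (+ 2) *_) (θ-⊛ b a n)))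
    where
    swap : ∀ x y → x * (ι (+ 2) * y) ≡ ι (+ 2) * (x * y)
    swap = RingSolver.solve-∀ ℚ-ring

  N³*a² : ∀ n → N n * (N n * (N n * a² n)) ≡ ι (+ 2) * (e ⊛ a) n + ι (+ 6) * (c ⊛ b) n
  N³*a² n = trans (cong (N n *_) (N²*a² n)) (trans (split (N n) ((c ⊛ a) n) ((b ⊛ b) n))
    (trans (cong₂ (λ x y → ι (+ 2) * (x + y)) (θ-⊛ c a n)
             (trans (θ-⊛ b b n) (cong ((c ⊛ b) n ℚ.+_) (⊛-comm b c n))))
           (collect ((e ⊛ a) n) ((c ⊛ b) n))))
    where
    split : ∀ k x y → k * (ι (+ 2) * (x + y)) ≡ ι (+ 2) * (k * x + k * y)
    split = RingSolver.solve-∀ ℚ-ring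
    collect : ∀ x y → ι (+ 2) * ((x + y) + (y + y)) ≡ ι (+ 2) * x + ι (+ 6) * y
    collect = RingSolver.solve-∀ ℚ-ring

  -- In general the square of a solution of a second-order equation satisfies one of order three
  -- involving mixed products. Here (θ²a) a and (θa)² occur with the same coefficient 324, so
  -- everything can be written through θ-powers of a², and a two-term recurrence results.
  a²-recurrence : ∀ n → N (suc n) * (N (suc n) * (N (suc n) * a² (suc n))) ≡
    ι (+ 6) * ((1ℚ + ι (+ 2) * N n) * ((1ℚ + ι (+ 3) * N n) * (ι (+ 2) + ι (+ 3) * N n))) * a² n
  a²-recurrence n = begin
    N (suc n) * (N (suc n) * (N (suc n) * a² (suc n)))
      ≡⟨ N³*a² (suc n) ⟩
    ι (+ 2) * (e ⊛ a) (suc n) + ι (+ 6) * (c ⊛ b) (suc n)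
      ≡⟨ cong₂ (λ x y → ι (+ 2) * x + ι (+ 6) * y) (e⊛-suc a n)
           (trans (c⊛-suc b n) (cong (λ z → ι (+ 108) * (c ⊛ b) n + (ι (+ 54) * (b ⊛ b) n + ι (+ 6) * z)) (⊛-comm a b n))) ⟩
    ι (+ 2) * (ι (+ 108) * E + (ι (+ 162) * C + (ι (+ 60) * B + ι (+ 6) * A))) +
      ι (+ 6) * (ι (+ 108) * G + (ι (+ 54) * D + ι (+ 6) * B))
      ≡⟨ regroup A B C D E G ⟩
    ι (+ 108) * (ι (+ 2) * E + ι (+ 6) * G) + (ι (+ 162) * (ι (+ 2) * (C + D)) + (ι (+ 78) * (ι (+ 2) * B) + ι (+ 12) * A))
      ≡⟨ cong₂ (λ x y → ι (+ 108) * x + y) (N³*a² n)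
           (cong₂ (λ x y → ι (+ 162) * x + (ι (+ 78) * y + ι (+ 12) * A)) (N²*a² n) (N*a² n)) ⟨
    ι (+ 108) * (N n * (N n * (N n * A))) + (ι (+ 162) * (N n * (N n * A)) + (ι (+ 78) * (N n * A) + ι (+ 12) * A))
      ≡⟨ factor (N n) A ⟩
    ι (+ 6) * ((1ℚ + ι (+ 2) * N n) * ((1ℚ + ι (+ 3) * N n) * (ι (+ 2) + ι (+ 3) * N n))) * A ∎
    where
    A = a² n
    B = (b ⊛ a) n
    C = (c ⊛ a) n
    D = (b ⊛ b) n
    E = (e ⊛ a) n
    G = (c ⊛ b) n
    regroup : ∀ A B C D E G →
      ι (+ 2) * (ι (+ 108) * E + (ι (+ 162) * C + (ι (+ 60) * B + ι (+ 6) * A))) +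
        ι (+ 6) * (ι (+ 108) * G + (ι (+ 54) * D + ι (+ 6) * B)) ≡
      ι (+ 108) * (ι (+ 2) * E + ι (+ 6) * G) + (ι (+ 162) * (ι (+ 2) * (C + D)) + (ι (+ 78) * (ι (+ 2) * B) + ι (+ 12) * A))
    regroup = RingSolver.solve-∀ ℚ-ring
    factor : ∀ k x → ι (+ 108) * (k * (k * (k * x))) + (ι (+ 162) * (k * (k * x)) + (ι (+ 78) * (k * x) + ι (+ 12) * x)) ≡
      ι (+ 6) * ((1ℚ + ι (+ 2) * k) * ((1ℚ + ι (+ 3) * k) * (ι (+ 2) + ι (+ 3) * k))) * x
    factor = RingSolver.solve-∀ ℚ-ring

open Clausen using (N; a²; a²-recurrence)

v : ℕ → ℤ

v n = + V n

v-recurrence : ∀ n → + suc n ℤ.* (+ suc n ℤ.* (+ suc n ℤ.* v (suc n))) ≡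
  + 6 ℤ.* ((+ 1 ℤ.+ + 2 ℤ.* + n) ℤ.* ((+ 1 ℤ.+ + 3 ℤ.* + n) ℤ.* (+ 2 ℤ.+ + 3 ℤ.* + n))) ℤ.* v n
v-recurrence n = trans (assoc (+ suc n) (v (suc n)))
  (trans (cong (ℤ._* v (suc n)) (sym (trans (ℤ.pos-* s (s ℕ.* s)) (cong (+ s ℤ.*_) (ℤ.pos-* s s)))))
  (trans (sym (ℤ.pos-* (s ℕ.* (s ℕ.* s)) (V s)))
  (trans (cong +_ (V-recurrence n))
  (trans (ℤ.pos-* (6 ℕ.* (q₂ ℕ.* (q₃ ℕ.* q₃′))) (V n))
    (cong (ℤ._* v n) (trans (ℤ.pos-* 6 (q₂ ℕ.* (q₃ ℕ.* q₃′))) (cong (+ 6 ℤ.*_)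
      (trans (ℤ.pos-* q₂ (q₃ ℕ.* q₃′)) (cong₂ ℤ._*_ (cong (ℤ._+_ (+ 1)) (ℤ.pos-* 2 n))
        (trans (ℤ.pos-* q₃ q₃′) (cong₂ ℤ._*_ (cong (ℤ._+_ (+ 1)) (ℤ.pos-* 3 n)) (cong (ℤ._+_ (+ 2)) (ℤ.pos-* 3 n)))))))))))))
  where
  s = suc n
  q₂ = 1 ℕ.+ 2 ℕ.* n
  q₃ = 1 ℕ.+ 3 ℕ.* n
  q₃′ = 2 ℕ.+ 3 ℕ.* n
  assoc : ∀ x y → x ℤ.* (x ℤ.* (x ℤ.* y)) ≡ (x ℤ.* (x ℤ.* x)) ℤ.* y
  assoc = ℤ-solve

cancel-N-suc : ∀ n {x y} → N (suc n) ℚ.* x ≡ N (suc n) ℚ.* y → x ≡ y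
cancel-N-suc n {x} {y} eq = trans (sym (inverse x)) (trans (cong ((+ 1 / suc n) ℚ.*_) eq) (inverse y))
  where
  inverse : ∀ x → (+ 1 / suc n) ℚ.* (N (suc n) ℚ.* x) ≡ x
  inverse x = trans (sym (ℚ.*-assoc (+ 1 / suc n) (N (suc n)) x))
    (trans (cong (ℚ._* x) (trans (ℚ.*-comm (+ 1 / suc n) (N (suc n))) (ι-1/ n))) (ℚ.*-identityˡ x))

a²≡v : ∀ n → a² n ≡ ι (v n)
a²≡v zero    = refl
a²≡v (suc n) = cancel-N-suc n (cancel-N-suc n (cancel-N-suc n (trans (a²-recurrence n)
  (trans (cong (ι (+ 6) ℚ.* ((1ℚ ℚ.+ ι (+ 2) ℚ.* N n) ℚ.* ((1ℚ ℚ.+ ι (+ 3) ℚ.* N n) ℚ.* (ι (+ 2) ℚ.+ ι (+ 3) ℚ.* N n))) ℚ.*_) (a²≡v n))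
  (trans (sym right) (trans (cong ι (sym (v-recurrence n))) left))))))
  where
  affine : ∀ c k → ι (c ℤ.+ k ℤ.* + n) ≡ ι c ℚ.+ ι k ℚ.* N n
  affine c k = trans (ι-+ c (k ℤ.* + n)) (cong (ι c ℚ.+_) (ι-* k (+ n)))
  left : ι (+ suc n ℤ.* (+ suc n ℤ.* (+ suc n ℤ.* v (suc n)))) ≡ N (suc n) ℚ.* (N (suc n) ℚ.* (N (suc n) ℚ.* ι (v (suc n))))
  left = trans (ι-* (+ suc n) (+ suc n ℤ.* (+ suc n ℤ.* v (suc n)))) (cong (N (suc n) ℚ.*_)
    (trans (ι-* (+ suc n) (+ suc n ℤ.* v (suc n))) (cong (N (suc n) ℚ.*_) (ι-* (+ suc n) (v (suc n))))))
  right : ι (+ 6 ℤ.* ((+ 1 ℤ.+ + 2 ℤ.* + n) ℤ.* ((+ 1 ℤ.+ + 3 ℤ.* + n) ℤ.* (+ 2 ℤ.+ + 3 ℤ.* + n))) ℤ.* v n) ≡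
    ι (+ 6) ℚ.* ((1ℚ ℚ.+ ι (+ 2) ℚ.* N n) ℚ.* ((1ℚ ℚ.+ ι (+ 3) ℚ.* N n) ℚ.* (ι (+ 2) ℚ.+ ι (+ 3) ℚ.* N n))) ℚ.* ι (v n)
  right = trans (ι-* (+ 6 ℤ.* (q₂ ℤ.* (q₃ ℤ.* q₃′))) (v n)) (cong (ℚ._* ι (v n))
    (trans (ι-* (+ 6) (q₂ ℤ.* (q₃ ℤ.* q₃′))) (cong (ι (+ 6) ℚ.*_)
      (trans (ι-* q₂ (q₃ ℤ.* q₃′)) (cong₂ ℚ._*_ (affine (+ 1) (+ 2))
        (trans (ι-* q₃ q₃′) (cong₂ ℚ._*_ (affine (+ 1) (+ 3)) (affine (+ 2) (+ 3)))))))))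
    where
    q₂ = + 1 ℤ.+ + 2 ℤ.* + n
    q₃ = + 1 ℤ.+ + 3 ℤ.* + n
    q₃′ = + 2 ℤ.+ + 3 ℤ.* + n

4∣v : ∀ n → ∃[ k ] v (suc n) ≡ + 4 ℤ.* k
4∣v n with 4∣V n
... | k , e = + k , trans (cong +_ e) (ℤ.pos-* 4 k)

-- Integrality of the square root of v

EvenInteger : ℚ → Set
EvenInteger x = ∃[ k ] x ≡ ι (+ 2 ℤ.* k)

even*even : ∀ n (f g : ℕ → ℚ) → (∀ i → i < n → EvenInteger (f i)) → (∀ i → i < n → EvenInteger (g i)) →
  ∃[ k ] ℚ[[t]].∑ n (λ i → f i ℚ.* g i) ≡ ι (+ 4 ℤ.* k)
even*even zero    f g ef eg = 0ℤ , refl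
even*even (suc n) f g ef eg
  with ef 0 (s≤s z≤n) | eg 0 (s≤s z≤n)
     | even*even n (f ∘ suc) (g ∘ suc) (λ i i<n → ef (suc i) (s≤s i<n)) (λ i i<n → eg (suc i) (s≤s i<n))
... | x , ex | y , ey | k , ek = x ℤ.* y ℤ.+ k ,
  trans (cong₂ ℚ._+_ (trans (cong₂ ℚ._*_ ex ey) (sym (ι-* (+ 2 ℤ.* x) (+ 2 ℤ.* y)))) ek)
    (trans (sym (ι-+ (+ 2 ℤ.* x ℤ.* (+ 2 ℤ.* y)) (+ 4 ℤ.* k))) (cong ι (collect x y k)))
  where
  collect : ∀ x y k → + 2 ℤ.* x ℤ.* (+ 2 ℤ.* y) ℤ.+ + 4 ℤ.* k ≡ + 4 ℤ.* (x ℤ.* y ℤ.+ k)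
  collect = ℤ-solve

abstract
  -- F² = 1 + 4(…) over ℤ, so the square root F lies in 1 + 2ℤ[[t]].
  a-even : ∀ n → EvenInteger (a (suc n))
  a-even n = below (suc n) n ℕ.≤-refl
    where
    halve : ∀ {x k l} → ι (+ 2) ℚ.* x ℚ.+ ι (+ 4 ℤ.* k) ≡ ι (+ 4 ℤ.* l) → x ≡ ι (+ 2 ℤ.* (l ℤ.- k))
    halve {x} {k} {l} eq = cancel-N-suc 1 (trans (isolate (ι (+ 2) ℚ.* x) (ι (+ 4 ℤ.* k)))
      (trans (cong (ℚ._+ (ℚ.- ι (+ 4 ℤ.* k))) eq)
      (trans (cong (ℚ._+ (ℚ.- ι (+ 4 ℤ.* k))) (cong ι (split k l)))
      (trans (cong (ℚ._+ (ℚ.- ι (+ 4 ℤ.* k))) (ι-+ (+ 2 ℤ.* (+ 2 ℤ.* (l ℤ.- k))) (+ 4 ℤ.* k)))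
      (trans (sym (isolate _ (ι (+ 4 ℤ.* k)))) (ι-* (+ 2) (+ 2 ℤ.* (l ℤ.- k))))))))
      where
      isolate : ∀ x y → x ≡ (x ℚ.+ y) ℚ.+ (ℚ.- y)
      isolate x y = sym (trans (ℚ.+-assoc x y (ℚ.- y)) (trans (cong (x ℚ.+_) (ℚ.+-inverseʳ y)) (ℚ.+-identityʳ x)))
      split : ∀ k l → + 4 ℤ.* l ≡ + 2 ℤ.* (+ 2 ℤ.* (l ℤ.- k)) ℤ.+ + 4 ℤ.* k
      split = ℤ-solve
    double : ∀ o x y → o ≡ 1ℚ → o ℚ.* x ℚ.+ (y ℚ.+ x ℚ.* o) ≡ ι (+ 2) ℚ.* x ℚ.+ y
    double .1ℚ x y refl = identity x y
      where
      identity : ∀ x y → 1ℚ ℚ.* x ℚ.+ (y ℚ.+ x ℚ.* 1ℚ) ≡ ι (+ 2) ℚ.* x ℚ.+ y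
      identity = RingSolver.solve-∀ ℚ-ring
    a₁-even : EvenInteger (a 1)
    a₁-even = + 3 , refl
    -- In the coefficient of index n + 2 of a², the two end terms give 2 a, while the interior
    -- products of even integers sum to a multiple of 4. As v is a multiple of 4 too, a is even.
    combine : ∀ n → ∃[ k ] ((a ∘ suc) ℚ[[t]].⊛ (a ∘ suc)) n ≡ ι (+ 4 ℤ.* k) → ∃[ l ] v (suc (suc n)) ≡ + 4 ℤ.* l →
      EvenInteger (a (suc (suc n)))
    combine n (k , ek) (l , el) = l ℤ.- k , halve {a (suc (suc n))} {k} {l}
      (trans (cong (ι (+ 2) ℚ.* a (suc (suc n)) ℚ.+_) (sym ek))
      (trans (sym (double (a 0) (a (suc (suc n))) (((a ∘ suc) ℚ[[t]].⊛ (a ∘ suc)) n) refl))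
      (trans (cong (a 0 ℚ.* a (suc (suc n)) ℚ.+_) (sym (ℚ[[t]].⊛-snoc (a ∘ suc) a n)))
      (trans (a²≡v (suc (suc n))) (cong ι el)))))
    step : ∀ n → (∀ i → i < n → EvenInteger (a (suc i))) → EvenInteger (a (suc n))
    step zero    _  = a₁-even
    step (suc n) ih = combine n
      (even*even (suc n) (a ∘ suc) (λ i → a (suc (n ∸ i))) ih (λ i i≤n → ih (n ∸ i) (s≤s (ℕ.m∸n≤m n i))))
      (4∣v (suc n))
    below : ∀ n i → i < n → EvenInteger (a (suc i))
    below (suc n) i (s≤s i≤n) = step i (λ j j<i → below n j (ℕ.<-≤-trans j<i i≤n))

u : ℕ → ℤ
u zero    = 1ℤ
u (suc n) = + 2 ℤ.* proj₁ (a-even n)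

a≡u : ∀ n → a n ≡ ι (u n)
a≡u zero    = refl
a≡u (suc n) = proj₂ (a-even n)

clausen : ∀ n → (u ℤ[[t]].⊛ u) n ≡ v n
clausen n = ι-injective (trans (ι-⊛ u u n)
  (trans (ℚ[[t]].⊛-cong (λ i → sym (a≡u i)) (λ i → sym (a≡u i)) n) (a²≡v n)))

Amix≡u³ : ∀ n → Amix n ≡ ι ((u ℤ[[t]].⊛ (u ℤ[[t]].⊛ u)) n)
Amix≡u³ n = trans (Amix≡a³ n) (trans (ℚ[[t]].⊛-cong a≡u (λ i → trans (ℚ[[t]].⊛-cong a≡u a≡u i) (sym (ι-⊛ u u i))) n)
  (sym (ι-⊛ u (u ℤ[[t]].⊛ u) n)))

u-recurrence : ∀ n → + suc n ℤ.* (+ suc n ℤ.* u (suc n)) ≡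
  + 6 ℤ.* ((+ 1 ℤ.+ + 6 ℤ.* + n) ℤ.* (+ 1 ℤ.+ + 3 ℤ.* + n)) ℤ.* u n
u-recurrence n = ι-injective (trans (ι-* (+ suc n) (+ suc n ℤ.* u (suc n)))
  (trans (cong (N (suc n) ℚ.*_) (trans (ι-* (+ suc n) (u (suc n))) (cong (N (suc n) ℚ.*_) (sym (a≡u (suc n))))))
  (trans (a-recurrence n) (trans (cong (λ z → ι (+ 108) ℚ.* (N n ℚ.* (N n ℚ.* z)) ℚ.+ (ι (+ 54) ℚ.* (N n ℚ.* z) ℚ.+ ι (+ 6) ℚ.* z)) (a≡u n))
  (trans (sym push) (cong ι (expand (+ n) (u n))))))))
  where
  expand : ∀ k x → + 108 ℤ.* (k ℤ.* (k ℤ.* x)) ℤ.+ (+ 54 ℤ.* (k ℤ.* x) ℤ.+ + 6 ℤ.* x) ≡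
    + 6 ℤ.* ((+ 1 ℤ.+ + 6 ℤ.* k) ℤ.* (+ 1 ℤ.+ + 3 ℤ.* k)) ℤ.* x
  expand = ℤ-solve
  Nu N²u : ℤ
  Nu  = + n ℤ.* u n
  N²u = + n ℤ.* Nu
  push : ι (+ 108 ℤ.* N²u ℤ.+ (+ 54 ℤ.* Nu ℤ.+ + 6 ℤ.* u n)) ≡
    ι (+ 108) ℚ.* (N n ℚ.* (N n ℚ.* ι (u n))) ℚ.+ (ι (+ 54) ℚ.* (N n ℚ.* ι (u n)) ℚ.+ ι (+ 6) ℚ.* ι (u n))
  push = trans (ι-+ (+ 108 ℤ.* N²u) (+ 54 ℤ.* Nu ℤ.+ + 6 ℤ.* u n)) (cong₂ ℚ._+_
    (trans (ι-* (+ 108) N²u) (cong (ι (+ 108) ℚ.*_) (trans (ι-* (+ n) Nu) (cong (N n ℚ.*_) (ι-* (+ n) (u n))))))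
    (trans (ι-+ (+ 54 ℤ.* Nu) (+ 6 ℤ.* u n)) (cong₂ ℚ._+_
      (trans (ι-* (+ 54) Nu) (cong (ι (+ 54) ℚ.*_) (ι-* (+ n) (u n)))) (ι-* (+ 6) (u n)))))

-- Congruences modulo powers of p

module Congruence (𝕡 : ℤ) where

  open import Data.Integer using (_+_; _*_; _-_; -_; _^_)

  infix 4 _≈[_]_
  record _≈[_]_ (x : ℤ) (k : ℕ) (y : ℤ) : Set where
    constructor mk≈
    field
      quotient : ℤ
      equality : x ≡ y + quotient * 𝕡 ^ k

  ≈-reflexive : ∀ {k x y} → x ≡ y → x ≈[ k ] y
  ≈-reflexive {k} {x} refl = mk≈ 0ℤ (sym (trans (cong (λ z → x + z) (ℤ.*-zeroˡ (𝕡 ^ k))) (ℤ.+-identityʳ x)))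

  ≈-refl : ∀ {k x} → x ≈[ k ] x
  ≈-refl = ≈-reflexive refl

  ≈-sym : ∀ {k x y} → x ≈[ k ] y → y ≈[ k ] x
  ≈-sym {k} {y = y} (mk≈ q refl) = mk≈ (- q) (identity y q (𝕡 ^ k))
    where
    identity : ∀ y q m → y ≡ (y + q * m) + (- q) * m
    identity = ℤ-solve

  ≈-trans : ∀ {k x y z} → x ≈[ k ] y → y ≈[ k ] z → x ≈[ k ] z
  ≈-trans {k} {z = z} (mk≈ q refl) (mk≈ r refl) = mk≈ (q + r) (identity z q r (𝕡 ^ k))
    where
    identity : ∀ z q r m → z + r * m + q * m ≡ z + (q + r) * m
    identity = ℤ-solve

  +-cong : ∀ {k x y z w} → x ≈[ k ] y → z ≈[ k ] w → x + z ≈[ k ] y + w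
  +-cong {k} {y = y} {w = w} (mk≈ q refl) (mk≈ r refl) = mk≈ (q + r) (identity y w q r (𝕡 ^ k))
    where
    identity : ∀ y w q r m → (y + q * m) + (w + r * m) ≡ (y + w) + (q + r) * m
    identity = ℤ-solve

  *-cong : ∀ {k x y z w} → x ≈[ k ] y → z ≈[ k ] w → x * z ≈[ k ] y * w
  *-cong {k} {y = y} {w = w} (mk≈ q refl) (mk≈ r refl) =
    mk≈ (q * w + y * r + q * r * 𝕡 ^ k) (identity y w q r (𝕡 ^ k))
    where
    identity : ∀ y w q r m → (y + q * m) * (w + r * m) ≡ (y * w) + (q * w + y * r + q * r * m) * m
    identity = ℤ-solve

  *-congˡ : ∀ {k y z} x → y ≈[ k ] z → x * y ≈[ k ] x * z
  *-congˡ x = *-cong (≈-refl {x = x})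

  *-congʳ : ∀ {k y z} x → y ≈[ k ] z → y * x ≈[ k ] z * x
  *-congʳ x y≈z = *-cong y≈z (≈-refl {x = x})

  neg-cong : ∀ {k x y} → x ≈[ k ] y → - x ≈[ k ] - y
  neg-cong {k} {y = y} (mk≈ q refl) = mk≈ (- q) (identity y q (𝕡 ^ k))
    where
    identity : ∀ y q m → - (y + q * m) ≡ (- y) + (- q) * m
    identity = ℤ-solve

  ℤ/ : ℕ → CommutativeRing 0ℓ 0ℓ
  ℤ/ k = record
    { Carrier = ℤ
    ; _≈_ = _≈[ k ]_
    ; _+_ = _+_
    ; _*_ = _*_
    ; -_ = -_
    ; 0# = 0ℤ
    ; 1# = 1ℤ
    ; isCommutativeRing = record
      { isRing = record
        { +-isAbelianGroup = record
          { isGroup = record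
            { isMonoid = record
              { isSemigroup = record
                { isMagma = record
                  { isEquivalence = record { refl = ≈-refl ; sym = ≈-sym ; trans = ≈-trans }
                  ; ∙-cong = +-cong
                  }
                ; assoc = λ x y z → ≈-reflexive (ℤ.+-assoc x y z)
                }
              ; identity = (λ x → ≈-reflexive (ℤ.+-identityˡ x)) , (λ x → ≈-reflexive (ℤ.+-identityʳ x))
              }
            ; inverse = (λ x → ≈-reflexive (ℤ.+-inverseˡ x)) , (λ x → ≈-reflexive (ℤ.+-inverseʳ x))
            ; ⁻¹-cong = neg-cong
            }
          ; comm = λ x y → ≈-reflexive (ℤ.+-comm x y)
          }
        ; *-cong = *-cong
        ; *-assoc = λ x y z → ≈-reflexive (ℤ.*-assoc x y z)
        ; *-identity = (λ x → ≈-reflexive (ℤ.*-identityˡ x)) , (λ x → ≈-reflexive (ℤ.*-identityʳ x))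
        ; distrib = (λ x y z → ≈-reflexive (ℤ.*-distribˡ-+ x y z)) , (λ x y z → ≈-reflexive (ℤ.*-distribʳ-+ x y z))
        }
      ; *-comm = λ x y → ≈-reflexive (ℤ.*-comm x y)
      }
    }

  module ≈-Reasoning (k : ℕ) = SetoidReasoning (CommutativeRing.setoid (ℤ/ k))

  ≈-weaken : ∀ {k x y} j → x ≈[ j ℕ.+ k ] y → x ≈[ k ] y
  ≈-weaken {k} {y = y} j (mk≈ q refl) = mk≈ (q * 𝕡 ^ j)
    (cong (λ z → y + z) (trans (cong (q *_) (ℤ.^-distribˡ-+-* 𝕡 j k)) (sym (ℤ.*-assoc q (𝕡 ^ j) (𝕡 ^ k)))))

  𝕡^*-≈ : ∀ j {k x y} → x ≈[ k ] y → 𝕡 ^ j * x ≈[ j ℕ.+ k ] 𝕡 ^ j * y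
  𝕡^*-≈ j {k} {y = y} (mk≈ q refl) = mk≈ q (trans (identity y q (𝕡 ^ j) (𝕡 ^ k))
    (cong (λ z → 𝕡 ^ j * y + q * z) (sym (ℤ.^-distribˡ-+-* 𝕡 j k))))
    where
    identity : ∀ y q a b → a * (y + q * b) ≡ a * y + q * (a * b)
    identity = ℤ-solve

  *-≈-zero : ∀ j k {x y} → x ≈[ j ] 0ℤ → y ≈[ k ] 0ℤ → x * y ≈[ j ℕ.+ k ] 0ℤ
  *-≈-zero j k (mk≈ q refl) (mk≈ r refl) = mk≈ (q * r) (trans (identity q r (𝕡 ^ j) (𝕡 ^ k))
    (cong (λ z → 0ℤ + q * r * z) (sym (ℤ.^-distribˡ-+-* 𝕡 j k))))
    where
    identity : ∀ q r a b → (0ℤ + q * a) * (0ℤ + r * b) ≡ 0ℤ + q * r * (a * b)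
    identity = ℤ-solve

  𝕡^≈0 : ∀ k → 𝕡 ^ k ≈[ k ] 0ℤ
  𝕡^≈0 k = mk≈ 1ℤ (identity (𝕡 ^ k))
    where
    identity : ∀ m → m ≡ 0ℤ + 1ℤ * m
    identity = ℤ-solve

  -‿≈0 : ∀ {k x y} → x ≈[ k ] y → x - y ≈[ k ] 0ℤ
  -‿≈0 {k} {y = y} (mk≈ q refl) = mk≈ q (identity y q (𝕡 ^ k))
    where
    identity : ∀ y q m → (y + q * m) - y ≡ 0ℤ + q * m
    identity = ℤ-solve

  ≈-by : ∀ {k x y d} → d ≈[ k ] 0ℤ → x ≡ y + d → x ≈[ k ] y
  ≈-by {y = y} d≈0 refl = ≈-trans (+-cong (≈-refl {x = y}) d≈0) (≈-reflexive (ℤ.+-identityʳ y))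

  ≈0-*ˡ : ∀ {k y} x → y ≈[ k ] 0ℤ → x * y ≈[ k ] 0ℤ
  ≈0-*ˡ x y≈0 = ≈-trans (*-congˡ x y≈0) (≈-reflexive (ℤ.*-zeroʳ x))

  ≈0-+ : ∀ {k x y} → x ≈[ k ] 0ℤ → y ≈[ k ] 0ℤ → x + y ≈[ k ] 0ℤ
  ≈0-+ = +-cong

  record Unit (c : ℤ) : Set where
    constructor unit
    field
      inverse   : ℤ
      isInverse : c * inverse ≈[ 1 ] 1ℤ

  Unit-resp : ∀ {x y} → x ≈[ 1 ] y → Unit x → Unit y
  Unit-resp x≈y (unit z xz≈1) = unit z (≈-trans (*-congʳ z (≈-sym x≈y)) xz≈1)

  Unit-* : ∀ {x y} → Unit x → Unit y → Unit (x * y)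
  Unit-* {x} {y} (unit z xz≈1) (unit w yw≈1) =
    unit (z * w) (≈-trans (≈-reflexive (identity x y z w)) (*-cong xz≈1 yw≈1))
    where
    identity : ∀ x y z w → x * y * (z * w) ≡ (x * z) * (y * w)
    identity = ℤ-solve

  Unit-^ : ∀ {x} n → Unit x → Unit (x ^ n)
  Unit-^ zero    _  = unit 1ℤ ≈-refl
  Unit-^ (suc n) ux = Unit-* ux (Unit-^ n ux)

  -- Hensel lifting: adding w (1 - c z) to z turns the error c z - 1 into (c w - 1)(1 - c z), which
  -- gains one power of `𝕡`.
  Unit-inverse : ∀ k {c} → Unit c → ∃[ z ] c * z ≈[ k ] 1ℤ
  Unit-inverse zero        {c} _  = 0ℤ , mk≈ (- 1ℤ) (identity c)
    where
    identity : ∀ c → c * 0ℤ ≡ 1ℤ + (- 1ℤ) * 1ℤ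
    identity = ℤ-solve
  Unit-inverse (suc k) {c} uc@(unit w cw≈1) with Unit-inverse k uc
  ... | z , cz≈1 = z + w * (1ℤ - c * z) ,
    ≈-by (*-≈-zero 1 k (-‿≈0 cw≈1) (-‿≈0 (≈-sym cz≈1))) (identity c z w)
    where
    identity : ∀ c z w → c * (z + w * (1ℤ - c * z)) ≡ 1ℤ + (c * w - 1ℤ) * (1ℤ - c * z)
    identity = ℤ-solve

  Unit-cancel : ∀ {k c x y} → Unit c → c * x ≈[ k ] c * y → x ≈[ k ] y
  Unit-cancel {k} {c} {x} {y} uc eq with Unit-inverse k uc
  ... | z , cz≈1 = begin
    x           ≡⟨ ℤ.*-identityˡ x ⟨
    1ℤ * x      ≈⟨ *-congʳ x cz≈1 ⟨
    c * z * x   ≡⟨ swap c z x ⟩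
    z * (c * x) ≈⟨ *-congˡ z eq ⟩
    z * (c * y) ≡⟨ swap c z y ⟨
    c * z * y   ≈⟨ *-congʳ y cz≈1 ⟩
    1ℤ * y      ≡⟨ ℤ.*-identityˡ y ⟩
    y           ∎
    where
    open ≈-Reasoning k
    swap : ∀ c z x → c * z * x ≡ z * (c * x)
    swap = ℤ-solve

  Unit-cancel-0 : ∀ {k c x} → Unit c → c * x ≈[ k ] 0ℤ → x ≈[ k ] 0ℤ
  Unit-cancel-0 {c = c} uc eq = Unit-cancel {c = c} uc (≈-trans eq (≈-reflexive (sym (ℤ.*-zeroʳ c))))

  Unit-ℕ : ∀ {p} → 𝕡 ≡ + p → Prime p → ∀ n → suc n < p → Unit (+ suc n)
  Unit-ℕ {p} refl isPrime n n<p = bézout (coprime-Bézout (prime⇒coprime isPrime n<p))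
    where
    bézout : Bézout.Identity 1 p (suc n) → Unit (+ suc n)
    bézout (Bézout.+- x y eq) = unit (- (+ y)) (mk≈ (- (+ x)) (identity (+ suc n) (+ y) (+ x) 𝕡
      (trans (cong (λ z → 1ℤ + z) (sym (ℤ.pos-* y (suc n)))) (trans (cong +_ eq) (ℤ.pos-* x p)))))
      where
      rearrange : ∀ c y → c * (- y) ≡ 1ℤ - (1ℤ + y * c)
      rearrange = ℤ-solve
      finish : ∀ x m → 1ℤ - x * m ≡ 1ℤ + (- x) * (m * 1ℤ)
      finish = ℤ-solve
      identity : ∀ c y x m → 1ℤ + y * c ≡ x * m → c * (- y) ≡ 1ℤ + (- x) * (m * 1ℤ)
      identity c y x m e = trans (rearrange c y) (trans (cong (λ z → 1ℤ - z) e) (finish x m))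
    bézout (Bézout.-+ x y eq) = unit (+ y) (mk≈ (+ x) (identity (+ suc n) (+ y) (+ x) 𝕡
      (trans (cong (λ z → 1ℤ + z) (sym (ℤ.pos-* x p))) (trans (cong +_ eq) (ℤ.pos-* y (suc n))))))
      where
      finish : ∀ x m → 1ℤ + x * m ≡ 1ℤ + x * (m * 1ℤ)
      finish = ℤ-solve
      identity : ∀ c y x m → 1ℤ + x * m ≡ y * c → c * y ≡ 1ℤ + x * (m * 1ℤ)
      identity c y x m e = trans (ℤ.*-comm c y) (trans (sym e) (finish x m))

module _ where

  open import Data.Integer using (_+_; _*_; _-_; -_; _^_)

  -- Finite products and truncated polynomials

  ∏ : ℕ → (ℕ → ℤ) → ℤ
  ∏ zero    f = 1ℤ
  ∏ (suc n) f = ∏ n f * f n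

  ∏-cong : ∀ n {f g : ℕ → ℤ} → (∀ k → k < n → f k ≡ g k) → ∏ n f ≡ ∏ n g
  ∏-cong zero    _   = refl
  ∏-cong (suc n) f≡g = cong₂ _*_ (∏-cong n (λ k k<n → f≡g k (ℕ.m<n⇒m<1+n k<n))) (f≡g n ℕ.≤-refl)

  ∏-split : ∀ m n f → ∏ (m ℕ.+ n) f ≡ ∏ m f * ∏ n (λ k → f (m ℕ.+ k))
  ∏-split m zero    f = trans (cong (λ k → ∏ k f) (ℕ.+-identityʳ m)) (sym (ℤ.*-identityʳ (∏ m f)))
  ∏-split m (suc n) f = trans (cong (λ k → ∏ k f) (ℕ.+-suc m n))
    (trans (cong (_* f (m ℕ.+ n)) (∏-split m n f)) (ℤ.*-assoc (∏ m f) (∏ n (λ k → f (m ℕ.+ k))) (f (m ℕ.+ n))))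

  ∏-front : ∀ n f → ∏ (suc n) f ≡ f 0 * ∏ n (f ∘ suc)
  ∏-front n f = trans (∏-split 1 n f) (cong (_* ∏ n (f ∘ suc)) (ℤ.*-identityˡ (f 0)))

  ∏-reverse : ∀ n f → ∏ n f ≡ ∏ n (λ k → f (n ∸ suc k))
  ∏-reverse zero    f = refl
  ∏-reverse (suc n) f = trans (ℤ.*-comm (∏ n f) (f n))
    (trans (cong (f n *_) (∏-reverse n f)) (sym (∏-front n (λ k → f (n ∸ k)))))

  ∏-neg : ∀ n f → ∏ (n ℕ.+ n) (λ k → - f k) ≡ ∏ (n ℕ.+ n) f
  ∏-neg n f = trans (signs (n ℕ.+ n)) (trans (cong (_* ∏ (n ℕ.+ n) f) (trans (∏-split n n (λ _ → - 1ℤ)) (squares n)))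
    (ℤ.*-identityˡ (∏ (n ℕ.+ n) f)))
    where
    signs : ∀ n → ∏ n (λ k → - f k) ≡ ∏ n (λ _ → - 1ℤ) * ∏ n f
    signs zero    = refl
    signs (suc n) = trans (cong (_* (- f n)) (signs n)) (identity (∏ n (λ _ → - 1ℤ)) (∏ n f) (f n))
      where
      identity : ∀ s x y → (s * x) * (- y) ≡ (s * (- 1ℤ)) * (x * y)
      identity = ℤ-solve
    squares : ∀ n → ∏ n (λ _ → - 1ℤ) * ∏ n (λ _ → - 1ℤ) ≡ 1ℤ
    squares zero    = refl
    squares (suc n) = trans (identity (∏ n (λ _ → - 1ℤ))) (squares n)
      where
      identity : ∀ s → (s * (- 1ℤ)) * (s * (- 1ℤ)) ≡ s * s
      identity = ℤ-solve

  rising-! : ∀ m n → + ((m ℕ.+ n) !) ≡ + (m !) * ∏ n (λ k → + m + + suc k)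
  rising-! m zero    = trans (cong (λ k → + (k !)) (ℕ.+-identityʳ m)) (sym (ℤ.*-identityʳ (+ (m !))))
  rising-! m (suc n) = trans (cong (λ k → + (k !)) (ℕ.+-suc m n))
    (trans (ℤ.pos-* (suc (m ℕ.+ n)) ((m ℕ.+ n) !))
    (trans (cong₂ _*_ (trans (cong +_ (sym (ℕ.+-suc m n))) (ℤ.pos-+ m (suc n))) (rising-! m n))
      (identity (+ m + + suc n) (+ (m !)) (∏ n (λ k → + m + + suc k)))))
    where
    identity : ∀ x y z → x * (y * z) ≡ y * (z * x)
    identity = ℤ-solve

  -- Coefficients of a polynomial after multiplication by c + a x.
  step : ℤ → ℤ → (ℕ → ℤ) → ℕ → ℤ
  step c a f zero    = c * f 0
  step c a f (suc k) = c * f (suc k) + a * f k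

  steps : ℕ → (ℕ → ℤ) → ℤ → (ℕ → ℤ) → ℕ → ℤ
  steps zero    c a f = f
  steps (suc n) c a f = step (c n) a (steps n c a f)

  steps-split : ∀ m n c a f → steps (m ℕ.+ n) c a f ≡ steps n (λ k → c (m ℕ.+ k)) a (steps m c a f)
  steps-split m zero    c a f = cong (λ k → steps k c a f) (ℕ.+-identityʳ m)
  steps-split m (suc n) c a f = trans (cong (λ k → steps k c a f) (ℕ.+-suc m n))
    (cong (step (c (m ℕ.+ n)) a) (steps-split m n c a f))

  -- The truncation to degree 3, which determines the value modulo p⁴ at multiples of p. It is opaque because conversion
  -- checking is exponential in the nesting depth of unfolded integer products.
  opaque
    cubic : (ℕ → ℤ) → ℤ → ℤ
    cubic e x = e 0 + x * (e 1 + x * (e 2 + x * e 3))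

  select : {A : Set} → Dec A → ℤ → ℤ
  select (yes _) x = x
  select (no  _) x = 0ℤ

  select-yes : ∀ {A : Set} (A? : Dec A) {x} → A → select A? x ≡ x
  select-yes (yes _) _ = refl
  select-yes (no ¬a) a = contradiction a ¬a

  select-no : ∀ {A : Set} (A? : Dec A) {x} → ¬ A → select A? x ≡ 0ℤ
  select-no (yes a) ¬a = contradiction a ¬a
  select-no (no  _) _  = refl

  -- `u` rests on the abstract `a-even` and does not compute, so its small values are obtained from
  -- the recurrence.
  u-value : ∀ n c c′ → u n ≡ c →
    + 6 * ((+ 1 + + 6 * + n) * (+ 1 + + 3 * + n)) * c ≡ + suc n * (+ suc n * c′) → u (suc n) ≡ c′
  u-value n c c′ refl eq = ℤ.*-cancelˡ-≡ (+ suc n) _ _ (ℤ.*-cancelˡ-≡ (+ suc n) _ _ (trans (u-recurrence n) eq))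

  u₁ : u 1 ≡ + 6
  u₁ = u-value 0 (+ 1) (+ 6) refl refl

  u₂ : u 2 ≡ + 252
  u₂ = u-value 1 (+ 6) (+ 252) u₁ refl

  u₃ : u 3 ≡ + 15288
  u₃ = u-value 2 (+ 252) (+ 15288) u₂ refl

  u₄ : u 4 ≡ + 1089270
  u₄ = u-value 3 (+ 15288) (+ 1089270) u₃ refl

  F³ : ℕ → ℤ
  F³ = u ℤ[[t]].⊛ (u ℤ[[t]].⊛ u)

  module Supercongruence (d p : ℕ) (𝕡 : ℤ) (0<d : 0 < d) (p≡6d+1 : p ≡ suc (6 ℕ.* d)) (𝕡≡p : 𝕡 ≡ + p) (isPrime : Prime p) where

    open Congruence 𝕡

    𝕡≡6d+1 : 𝕡 ≡ + suc (6 ℕ.* d)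
    𝕡≡6d+1 = trans 𝕡≡p (cong +_ p≡6d+1)

    𝕡≢0 : ℤ.NonZero 𝕡
    𝕡≢0 = subst ℤ.NonZero (sym 𝕡≡6d+1) _

    𝕡^≢0 : ∀ {k} → ℤ.NonZero (𝕡 ^ k)
    𝕡^≢0 {zero}  = _
    𝕡^≢0 {suc k} = ℤ.i*j≢0 𝕡 (𝕡 ^ k) {{𝕡≢0}} {{𝕡^≢0 {k}}}

    𝕡^-cancel : ∀ j k {x} → 𝕡 ^ j * x ≈[ j ℕ.+ k ] 0ℤ → x ≈[ k ] 0ℤ
    𝕡^-cancel j k {x} (mk≈ q eq) = mk≈ q (ℤ.*-cancelˡ-≡ (𝕡 ^ j) x (0ℤ + q * 𝕡 ^ k) {{𝕡^≢0 {j}}}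
      (trans eq (trans (cong (λ z → 0ℤ + q * z) (ℤ.^-distribˡ-+-* 𝕡 j k)) (identity q (𝕡 ^ j) (𝕡 ^ k)))))
      where
      identity : ∀ q a b → 0ℤ + q * (a * b) ≡ a * (0ℤ + q * b)
      identity = ℤ-solve

    7≤p : 7 ≤ p
    7≤p = subst (7 ≤_) (sym p≡6d+1) (s≤s (ℕ.*-monoʳ-≤ 6 0<d))

    unit< : ∀ n → suc n < p → Unit (+ suc n)
    unit< = Unit-ℕ 𝕡≡p isPrime

    unit-2 : Unit (+ 2)
    unit-2 = unit< 1 (ℕ.≤-trans (ℕ.m≤m+n 3 4) 7≤p)

    unit-3 : Unit (+ 3)
    unit-3 = unit< 2 (ℕ.≤-trans (ℕ.m≤m+n 4 3) 7≤p)

    unit-5 : Unit (+ 5)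
    unit-5 = unit< 4 (ℕ.≤-trans (ℕ.m≤m+n 6 1) 7≤p)

    unit-6 : Unit (+ 6)
    unit-6 = Unit-* unit-2 unit-3

    Unit-∏ : ∀ n {f} → (∀ k → k < n → Unit (f k)) → Unit (∏ n f)
    Unit-∏ zero    _  = unit 1ℤ ≈-refl
    Unit-∏ (suc n) uf = Unit-* (Unit-∏ n (λ k k<n → uf k (ℕ.m<n⇒m<1+n k<n))) (uf n ℕ.≤-refl)

    opaque
      unfolding cubic

      -- The truncation discards only the term a f₃ x⁴, a multiple of `𝕡` to the fourth at x = m 𝕡.
      cubic-step : ∀ c a f m → cubic (step c a f) (m * 𝕡) ≈[ 4 ] (c + a * (m * 𝕡)) * cubic f (m * 𝕡)
      cubic-step c a f m = mk≈ (- (a * f 3 * (m * (m * (m * m))))) (identity c a (f 0) (f 1) (f 2) (f 3) m 𝕡)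
        where
        identity : ∀ c a f₀ f₁ f₂ f₃ m q →
          c * f₀ + (m * q) * ((c * f₁ + a * f₀) + (m * q) * ((c * f₂ + a * f₁) + (m * q) * (c * f₃ + a * f₂))) ≡
          (c + a * (m * q)) * (f₀ + (m * q) * (f₁ + (m * q) * (f₂ + (m * q) * f₃))) +
          (- (a * f₃ * (m * (m * (m * m))))) * (q * (q * (q * (q * 1ℤ))))
        identity = ℤ-solve

    cubic-steps : ∀ n c a f m → cubic (steps n c a f) (m * 𝕡) ≈[ 4 ] ∏ n (λ k → c k + a * (m * 𝕡)) * cubic f (m * 𝕡)
    cubic-steps zero    c a f m = ≈-reflexive (sym (ℤ.*-identityˡ (cubic f (m * 𝕡))))
    cubic-steps (suc n) c a f m = ≈-trans (cubic-step (c n) a (steps n c a f) m)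
      (≈-trans (*-congˡ (c n + a * (m * 𝕡)) (cubic-steps n c a f m))
        (≈-reflexive (identity (c n + a * (m * 𝕡)) (∏ n (λ k → c k + a * (m * 𝕡))) (cubic f (m * 𝕡)))))
      where
      identity : ∀ x y z → x * (y * z) ≡ y * x * z
      identity = ℤ-solve

    opaque
      unfolding cubic

      cubic-1ₛ : ∀ x → cubic ℤ[[t]].1ₛ x ≡ 1ℤ
      cubic-1ₛ = identity
        where
        identity : ∀ x → 1ℤ + x * (0ℤ + x * (0ℤ + x * 0ℤ)) ≡ 1ℤ
        identity = ℤ-solve

    opaque
      unfolding cubic

      -- Write E for the cubic. Symmetry about -𝕡/2 is needed at i = 0 and i = 1 only: E(0) - E(-𝕡)
      -- = 𝕡 (e₁ - 𝕡 e₂ + 𝕡² e₃), and subtracting three times this from E(𝕡) - E(-2𝕡) leaves 6 𝕡³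
      -- e₃.
      symmetric-cubic : ∀ e → (∀ i → cubic e (i * 𝕡) ≈[ 4 ] cubic e ((- 1ℤ - i) * 𝕡)) →
        e 3 ≈[ 1 ] 0ℤ × e 1 ≈[ 3 ] 𝕡 * e 2
      symmetric-cubic e symm = e₃≈0 , e₁≈
        where
        at-0 : 𝕡 ^ 1 * (e 1 - 𝕡 * e 2 + 𝕡 ^ 2 * e 3) ≈[ 1 ℕ.+ 3 ] 0ℤ
        at-0 = ≈-trans (≈-reflexive (identity (e 0) (e 1) (e 2) (e 3) 𝕡)) (-‿≈0 (symm 0ℤ))
          where
          identity : ∀ e₀ e₁ e₂ e₃ q → (q * 1ℤ) * (e₁ - q * e₂ + (q * (q * 1ℤ)) * e₃) ≡
            (e₀ + (0ℤ * q) * (e₁ + (0ℤ * q) * (e₂ + (0ℤ * q) * e₃))) -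
            (e₀ + ((- 1ℤ - 0ℤ) * q) * (e₁ + ((- 1ℤ - 0ℤ) * q) * (e₂ + ((- 1ℤ - 0ℤ) * q) * e₃)))
          identity = ℤ-solve
        e₃≈0 : e 3 ≈[ 1 ] 0ℤ
        e₃≈0 = Unit-cancel-0 unit-6 (𝕡^-cancel 3 1 (≈-trans
          (≈-reflexive (identity (e 0) (e 1) (e 2) (e 3) 𝕡))
          (≈0-+ (-‿≈0 (symm 1ℤ)) (≈0-*ˡ (- + 3) at-0))))
          where
          identity : ∀ e₀ e₁ e₂ e₃ q → (q * (q * (q * 1ℤ))) * (+ 6 * e₃) ≡
            ((e₀ + (1ℤ * q) * (e₁ + (1ℤ * q) * (e₂ + (1ℤ * q) * e₃))) -
             (e₀ + ((- 1ℤ - 1ℤ) * q) * (e₁ + ((- 1ℤ - 1ℤ) * q) * (e₂ + ((- 1ℤ - 1ℤ) * q) * e₃)))) +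
            (- + 3) * ((q * 1ℤ) * (e₁ - q * e₂ + (q * (q * 1ℤ)) * e₃))
          identity = ℤ-solve
        e₁≈ : e 1 ≈[ 3 ] 𝕡 * e 2
        e₁≈ = ≈-by (≈0-+ (𝕡^-cancel 1 3 at-0) (≈0-*ˡ (- 1ℤ) (*-≈-zero 2 1 (𝕡^≈0 2) e₃≈0)))
          (identity (e 1) (e 2) (e 3) 𝕡)
          where
          identity : ∀ e₁ e₂ e₃ q → e₁ ≡ q * e₂ + ((e₁ - q * e₂ + (q * (q * 1ℤ)) * e₃) + (- 1ℤ) * ((q * (q * 1ℤ)) * e₃))
          identity = ℤ-solve

    -- The product (x + 1) ⋯ (x + p - 1) at multiples of p

    φ : ℤ → ℤ
    φ x = ∏ (6 ℕ.* d) (λ k → x + + suc k)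

    -- The map x ↦ -𝕡 - x sends the factor x + k to -(x + (p - k)). The number 6d of factors is
    -- even, so the signs cancel.
    φ-reflect : ∀ i → φ (i * 𝕡) ≡ φ ((- 1ℤ - i) * 𝕡)
    φ-reflect i = sym (trans (∏-cong (6 ℕ.* d) (λ k k<n → negate k k<n))
      (trans (subst (λ n → ∏ n (λ k → - f k) ≡ ∏ n f) (six d) (∏-neg (3 ℕ.* d) f))
        (sym (∏-reverse (6 ℕ.* d) (λ k → i * 𝕡 + + suc k)))))
      where
      f : ℕ → ℤ
      f k = i * 𝕡 + + suc (6 ℕ.* d ∸ suc k)
      six : ∀ d → 3 ℕ.* d ℕ.+ 3 ℕ.* d ≡ 6 ℕ.* d
      six = ℕ-solve
      negate : ∀ k → k < 6 ℕ.* d → (- 1ℤ - i) * 𝕡 + + suc k ≡ - f k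
      negate k k<n = trans (cong (λ z → (- 1ℤ - i) * z + + suc k) 𝕡≡) (trans (identity i (+ suc (6 ℕ.* d ∸ suc k)) (+ suc k))
          (cong (λ z → - (i * z + + suc (6 ℕ.* d ∸ suc k))) (sym 𝕡≡)))
        where
        𝕡≡ : 𝕡 ≡ + suc (6 ℕ.* d ∸ suc k) + + suc k
        𝕡≡ = trans 𝕡≡6d+1 (cong (λ z → + suc z) (sym (ℕ.m∸n+n≡m k<n)))
        identity : ∀ i a b → (- 1ℤ - i) * (a + b) + b ≡ - (i * (a + b) + a)
        identity = ℤ-solve

    times-φ : (ℕ → ℤ) → ℕ → ℤ
    times-φ = steps (6 ℕ.* d) (λ k → + suc k) 1ℤ

    cubic-times-φ : ∀ f m → cubic (times-φ f) (m * 𝕡) ≈[ 4 ] φ (m * 𝕡) * cubic f (m * 𝕡)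
    cubic-times-φ f m = ≈-trans (cubic-steps (6 ℕ.* d) (λ k → + suc k) 1ℤ f m)
      (≈-reflexive (cong (_* cubic f (m * 𝕡)) (∏-cong (6 ℕ.* d) (λ k _ → identity (+ suc k) (m * 𝕡)))))
      where
      identity : ∀ a b → a + 1ℤ * b ≡ b + a
      identity = ℤ-solve

    φ₀ φ₂ : ℤ
    φ₀ = times-φ ℤ[[t]].1ₛ 0
    φ₂ = times-φ ℤ[[t]].1ₛ 2

    φ-unit : ∀ m → Unit (φ (m * 𝕡))
    φ-unit m = Unit-∏ (6 ℕ.* d) (λ k k<n → Unit-resp (≈-by (≈0-*ˡ (- m) (𝕡^≈0 1)) (identity (+ suc k) m 𝕡)) (unit< k (subst (suc k <_) (sym p≡6d+1) (s≤s k<n))))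
      where
      identity : ∀ a m q → a ≡ (m * q + a) + (- m) * (q * 1ℤ)
      identity = ℤ-solve

    φ-cubic : ∀ m → cubic (times-φ ℤ[[t]].1ₛ) (m * 𝕡) ≈[ 4 ] φ (m * 𝕡)
    φ-cubic m = ≈-trans (cubic-times-φ ℤ[[t]].1ₛ m)
      (≈-reflexive (trans (cong (φ (m * 𝕡) *_) (cubic-1ₛ (m * 𝕡))) (ℤ.*-identityʳ (φ (m * 𝕡)))))

    opaque
      unfolding cubic

      cubic-even : ∀ e i → e 3 ≈[ 1 ] 0ℤ → e 1 ≈[ 3 ] 𝕡 * e 2 →
        cubic e (i * 𝕡) ≈[ 4 ] e 0 + 𝕡 ^ 2 * (e 2 * (i * i + i))
      cubic-even e i e₃≈0 e₁≈ = ≈-by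
        (≈0-+ (≈0-*ˡ i (*-≈-zero 1 3 (𝕡^≈0 1) (-‿≈0 e₁≈))) (≈0-*ˡ (i * (i * i)) (*-≈-zero 3 1 (𝕡^≈0 3) e₃≈0)))
        (identity (e 0) (e 1) (e 2) (e 3) i 𝕡)
        where
        identity : ∀ e₀ e₁ e₂ e₃ i q → e₀ + (i * q) * (e₁ + (i * q) * (e₂ + (i * q) * e₃)) ≡
          (e₀ + (q * (q * 1ℤ)) * (e₂ * (i * i + i))) +
          (i * ((q * 1ℤ) * (e₁ - q * e₂)) + (i * (i * i)) * ((q * (q * (q * 1ℤ))) * e₃))
        identity = ℤ-solve

    φ-expansion : ∀ i → φ (i * 𝕡) ≈[ 4 ] φ₀ + 𝕡 ^ 2 * (φ₂ * (i * i + i))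
    φ-expansion i = ≈-trans (≈-sym (φ-cubic i)) (cubic-even (times-φ ℤ[[t]].1ₛ) i (proj₁ odd) (proj₂ odd))
      where
      odd = symmetric-cubic (times-φ ℤ[[t]].1ₛ) (λ i → ≈-trans (φ-cubic i)
        (≈-trans (≈-reflexive (φ-reflect i)) (≈-sym (φ-cubic (- 1ℤ - i)))))

    φ₀-unit : Unit φ₀
    φ₀-unit = Unit-resp (≈-weaken 3 (≈-trans (φ-expansion 0ℤ) (≈-reflexive (identity φ₀ φ₂ (𝕡 ^ 2))))) (φ-unit 0ℤ)
      where
      identity : ∀ a b q → a + q * (b * (0ℤ * 0ℤ + 0ℤ)) ≡ a
      identity = ℤ-solve

    pos-*p : ∀ n → + (n ℕ.* p) ≡ + n * 𝕡
    pos-*p n = trans (ℤ.pos-* n p) (cong (+ n *_) (sym 𝕡≡p))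

    -- The expansion of v at multiples of p

    Φ : ℕ → ℤ
    Φ n = ∏ n (λ i → φ (+ i * 𝕡))

    -- The multiples of p up to n p contribute 𝕡ⁿ n!; the remaining factors form the blocks φ(i 𝕡)
    -- with i < n.
    multiple-! : ∀ n → + ((n ℕ.* p) !) ≡ 𝕡 ^ n * (+ (n !) * Φ n)
    multiple-! zero    = refl
    multiple-! (suc n) = trans (cong (λ k → + (k !)) (ℕ.+-comm p (n ℕ.* p)))
      (trans (rising-! (n ℕ.* p) p)
      (trans (cong₂ _*_ (multiple-! n) (trans (cong (λ k → ∏ k (λ k → + (n ℕ.* p) + + suc k)) p≡6d+1)
          (cong₂ _*_ (∏-cong (6 ℕ.* d) (λ k _ → cong (_+ + suc k) (pos-*p n))) (cong₂ _+_ (pos-*p n) (sym 𝕡≡6d+1)))))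
      (trans (identity 𝕡 (𝕡 ^ n) (+ (n !)) (Φ n) (φ (+ n * 𝕡)) (+ n))
        (cong (λ z → 𝕡 ^ suc n * (z * Φ (suc n))) (sym (ℤ.pos-* (suc n) (n !)))))))
      where
      identity : ∀ q a b x y n → (a * (b * x)) * (y * (n * q + q)) ≡ (q * a) * (((+ 1 + n) * b) * (x * y))
      identity = ℤ-solve

    fifth : ℤ → ℤ
    fifth x = (x * x) * (x * x) * x

    pos-5! : ∀ n → + 5! n ≡ fifth (+ (n !))
    pos-5! n = trans (ℤ.pos-* ((n ! ℕ.* n !) ℕ.* (n ! ℕ.* n !)) (n !)) (cong (_* + (n !))
      (trans (ℤ.pos-* (n ! ℕ.* n !) (n ! ℕ.* n !)) (cong₂ _*_ (ℤ.pos-* (n !) (n !)) (ℤ.pos-* (n !) (n !)))))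

    v-factorials : ∀ n → v n * fifth (+ (n !)) ≡ + ((n ℕ.+ n) !) * + ((n ℕ.+ (n ℕ.+ n)) !)
    v-factorials n = trans (cong (v n *_) (sym (pos-5! n))) (trans (sym (ℤ.pos-* (V n) (5! n)))
      (trans (cong +_ (V*n!⁵ n)) (ℤ.pos-* ((n ℕ.+ n) !) ((n ℕ.+ (n ℕ.+ n)) !))))

    -- In (2n)! (3n)! / n!⁵ taken at n p the powers of `𝕡` balance, since 2n + 3n = 5n. The same
    -- count removes the powers of `φ₀` in `quintic`.
    v-blocks : ∀ n → v (n ℕ.* p) * fifth (Φ n) ≡ v n * (Φ (n ℕ.+ n) * Φ (n ℕ.+ (n ℕ.+ n)))
    v-blocks n = ℤ.*-cancelˡ-≡ (fifth ab) _ _ {{nonZero}} (trans (gather (𝕡 ^ n) (+ (n !)) (Φ n) (v (n ℕ.* p)))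
      (trans (cong (λ z → v (n ℕ.* p) * fifth z) (sym (multiple-! n)))
      (trans (v-factorials (n ℕ.* p))
      (trans (cong₂ (λ i j → + (i !) * + (j !)) (sym (ℕ.*-distribʳ-+ p n n))
               (sym (trans (ℕ.*-distribʳ-+ p n (n ℕ.+ n)) (cong (n ℕ.* p ℕ.+_) (ℕ.*-distribʳ-+ p n n)))))
      (trans (cong₂ _*_
          (trans (multiple-! (n ℕ.+ n)) (cong (_* (+ ((n ℕ.+ n) !) * Φ (n ℕ.+ n))) (ℤ.^-distribˡ-+-* 𝕡 n n)))
          (trans (multiple-! (n ℕ.+ (n ℕ.+ n))) (cong (_* (+ ((n ℕ.+ (n ℕ.+ n)) !) * Φ (n ℕ.+ (n ℕ.+ n))))
            (trans (ℤ.^-distribˡ-+-* 𝕡 n (n ℕ.+ n)) (cong (𝕡 ^ n *_) (ℤ.^-distribˡ-+-* 𝕡 n n))))))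
      (trans (swap (𝕡 ^ n) (+ ((n ℕ.+ n) !)) (+ ((n ℕ.+ (n ℕ.+ n)) !)) (Φ (n ℕ.+ n)) (Φ (n ℕ.+ (n ℕ.+ n))))
      (trans (cong (λ z → fifth (𝕡 ^ n) * (z * (Φ (n ℕ.+ n) * Φ (n ℕ.+ (n ℕ.+ n))))) (sym (v-factorials n)))
        (regroup (𝕡 ^ n) (+ (n !)) (v n) (Φ (n ℕ.+ n) * Φ (n ℕ.+ (n ℕ.+ n)))))))))))
      where
      ab : ℤ
      ab = 𝕡 ^ n * + (n !)
      nonZero : ℤ.NonZero (fifth ab)
      nonZero = ℤ.i*j≢0 (ab * ab * (ab * ab)) ab {{ℤ.i*j≢0 (ab * ab) (ab * ab) {{ab²}} {{ab²}}}} {{ab¹}}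
        where
        ab¹ : ℤ.NonZero ab
        ab¹ = ℤ.i*j≢0 (𝕡 ^ n) (+ (n !)) {{𝕡^≢0 {n}}} {{n ℕ.!≢0}}
        ab² : ℤ.NonZero (ab * ab)
        ab² = ℤ.i*j≢0 ab ab {{ab¹}} {{ab¹}}
      gather : ∀ a b x y → ((a * b) * (a * b)) * ((a * b) * (a * b)) * (a * b) * (y * ((x * x) * (x * x) * x)) ≡
        y * (((a * (b * x)) * (a * (b * x))) * ((a * (b * x)) * (a * (b * x))) * (a * (b * x)))
      gather = ℤ-solve
      swap : ∀ a b c x y → ((a * a) * (b * x)) * ((a * (a * a)) * (c * y)) ≡ ((a * a) * (a * a) * a) * ((b * c) * (x * y))
      swap = ℤ-solve
      regroup : ∀ a b y z → ((a * a) * (a * a) * a) * ((y * ((b * b) * (b * b) * b)) * z) ≡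
        ((a * b) * (a * b)) * ((a * b) * (a * b)) * (a * b) * (y * z)
      regroup = ℤ-solve

    ω : ℤ
    ω = 𝕡 ^ 2 * φ₂

    ω²≈0 : ω * ω ≈[ 4 ] 0ℤ
    ω²≈0 = *-≈-zero 2 2 ω≈0 ω≈0
      where
      ω≈0 : ω ≈[ 2 ] 0ℤ
      ω≈0 = ≈-trans (*-congʳ φ₂ (𝕡^≈0 2)) (≈-reflexive (ℤ.*-zeroˡ φ₂))

    -- This is n³ - n = 3 Σ_{i<n} (i² + i), the accumulated correction of `φ-expansion`. The 3 on
    -- the left of `Φ-expansion` avoids dividing by it.
    χ : ℕ → ℤ
    χ n = + n * (+ n * + n) - + n

    Φ-expansion : ∀ n → + 3 * φ₀ * Φ n ≈[ 4 ] φ₀ ^ n * (+ 3 * φ₀ + ω * χ n)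
    Φ-expansion zero    = ≈-reflexive (identity φ₀ ω)
      where
      identity : ∀ a w → + 3 * a * 1ℤ ≡ 1ℤ * (+ 3 * a + w * (0ℤ * (0ℤ * 0ℤ) - 0ℤ))
      identity = ℤ-solve
    Φ-expansion (suc n) = ≈-trans (≈-reflexive (sym (ℤ.*-assoc (+ 3 * φ₀) (Φ n) (φ (+ n * 𝕡)))))
      (≈-trans (*-cong (Φ-expansion n) (φ-expansion (+ n)))
        (≈-by (≈0-*ˡ (φ₀ ^ n * (χ n * (+ n * + n + + n))) ω²≈0) (identity φ₀ (φ₀ ^ n) (𝕡 ^ 2) φ₂ (+ n))))
      where
      identity : ∀ a b q c n →
        (b * (+ 3 * a + (q * c) * (n * (n * n) - n))) * (a + q * (c * (n * n + n))) ≡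
        (a * b) * (+ 3 * a + (q * c) * ((+ 1 + n) * ((+ 1 + n) * (+ 1 + n)) - (+ 1 + n))) +
        (b * ((n * (n * n) - n) * (n * n + n))) * ((q * c) * (q * c))
      identity = ℤ-solve

    -- To first order in `ω` the correction is χ(2n) + χ(3n) - 5 χ(n) = 30 n³: the linear parts
    -- cancel because 2 + 3 = 5. Division by s = 3 φ₀ leaves the 10 of the witness.
    v-expansion : ∃[ c ] ∀ n → v (n ℕ.* p) ≈[ 4 ] v n + 𝕡 ^ 2 * (c * (+ n * (+ n * (+ n * v n))))
    v-expansion = + 10 * φ₂ * ι₀ , λ n → ≈-trans (solve-for-v n) (≈-reflexive (regroup ι₀ (𝕡 ^ 2) φ₂ (+ n) (v n)))
      where
      ι₀ = proj₁ (Unit-inverse 4 φ₀-unit)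
      s = + 3 * φ₀
      s-unit : Unit s
      s-unit = Unit-* unit-3 φ₀-unit

      quintic : ∀ n → v (n ℕ.* p) * fifth (s + ω * χ n) ≈[ 4 ]
        v n * ((s * (s * s)) * ((s + ω * χ (n ℕ.+ n)) * (s + ω * χ (n ℕ.+ (n ℕ.+ n)))))
      quintic n = Unit-cancel (Unit-^ n (Unit-fifth φ₀-unit)) (begin
        fifth φ₀ ^ n * (v (n ℕ.* p) * fifth X)       ≡⟨ cong (_* (v (n ℕ.* p) * fifth X)) (fifth-^ n) ⟩
        fifth (φ₀ ^ n) * (v (n ℕ.* p) * fifth X)     ≡⟨ gather (φ₀ ^ n) X (v (n ℕ.* p)) ⟩
        v (n ℕ.* p) * fifth (φ₀ ^ n * X)             ≈⟨ *-congˡ (v (n ℕ.* p)) (fifth-cong (Φ-expansion n)) ⟨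
        v (n ℕ.* p) * fifth (s * Φ n)                ≡⟨ pull s (Φ n) (v (n ℕ.* p)) ⟩
        fifth s * (v (n ℕ.* p) * fifth (Φ n))        ≡⟨ cong (fifth s *_) (v-blocks n) ⟩
        fifth s * (v n * (Φ n₂ * Φ n₃))              ≡⟨ push s (v n) (Φ n₂) (Φ n₃) ⟩
        v n * ((s * (s * s)) * ((s * Φ n₂) * (s * Φ n₃)))
          ≈⟨ *-congˡ (v n) (*-congˡ (s * (s * s)) (*-cong (Φ-expansion n₂) (Φ-expansion n₃))) ⟩
        v n * ((s * (s * s)) * ((φ₀ ^ n₂ * X₂) * (φ₀ ^ n₃ * X₃)))
          ≡⟨ cong₂ (λ y z → v n * ((s * (s * s)) * ((y * X₂) * (z * X₃)))) (ℤ.^-distribˡ-+-* φ₀ n n)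
               (trans (ℤ.^-distribˡ-+-* φ₀ n n₂) (cong (φ₀ ^ n *_) (ℤ.^-distribˡ-+-* φ₀ n n))) ⟩
        v n * ((s * (s * s)) * (((φ₀ ^ n * φ₀ ^ n) * X₂) * ((φ₀ ^ n * (φ₀ ^ n * φ₀ ^ n)) * X₃)))
          ≡⟨ collect (φ₀ ^ n) (s * (s * s)) X₂ X₃ (v n) ⟩
        fifth (φ₀ ^ n) * (v n * ((s * (s * s)) * (X₂ * X₃)))
          ≡⟨ cong (_* (v n * ((s * (s * s)) * (X₂ * X₃)))) (fifth-^ n) ⟨
        fifth φ₀ ^ n * (v n * ((s * (s * s)) * (X₂ * X₃))) ∎)
        where
        open ≈-Reasoning 4
        n₂ = n ℕ.+ n
        n₃ = n ℕ.+ (n ℕ.+ n)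
        X  = s + ω * χ n
        X₂ = s + ω * χ n₂
        X₃ = s + ω * χ n₃
        Unit-fifth : ∀ {x} → Unit x → Unit (fifth x)
        Unit-fifth ux = Unit-* (Unit-* (Unit-* ux ux) (Unit-* ux ux)) ux
        fifth-cong : ∀ {x y} → x ≈[ 4 ] y → fifth x ≈[ 4 ] fifth y
        fifth-cong e = *-cong (*-cong (*-cong e e) (*-cong e e)) e
        fifth-^ : ∀ n → fifth φ₀ ^ n ≡ fifth (φ₀ ^ n)
        fifth-^ zero    = refl
        fifth-^ (suc n) = trans (cong (fifth φ₀ *_) (fifth-^ n)) (multiply φ₀ (φ₀ ^ n))
          where
          multiply : ∀ x y → ((x * x) * (x * x) * x) * ((y * y) * (y * y) * y) ≡
            ((x * y) * (x * y)) * ((x * y) * (x * y)) * (x * y)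
          multiply = ℤ-solve
        gather : ∀ a x y → ((a * a) * (a * a) * a) * (y * ((x * x) * (x * x) * x)) ≡
          y * (((a * x) * (a * x)) * ((a * x) * (a * x)) * (a * x))
        gather = ℤ-solve
        pull : ∀ a x y → y * (((a * x) * (a * x)) * ((a * x) * (a * x)) * (a * x)) ≡
          ((a * a) * (a * a) * a) * (y * ((x * x) * (x * x) * x))
        pull = ℤ-solve
        push : ∀ a y x z → ((a * a) * (a * a) * a) * (y * (x * z)) ≡ y * ((a * (a * a)) * ((a * x) * (a * z)))
        push = ℤ-solve
        collect : ∀ a t x z y → y * (t * (((a * a) * x) * ((a * (a * a)) * z))) ≡ ((a * a) * (a * a) * a) * (y * (t * (x * z)))
        collect = ℤ-solve

      linear : ∀ n → s * v (n ℕ.* p) + (+ 5 * (χ n * v (n ℕ.* p))) * ω ≈[ 4 ]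
        s * v n + (v n * (χ (n ℕ.+ n) + χ (n ℕ.+ (n ℕ.+ n)))) * ω
      linear n = Unit-cancel (Unit-* (Unit-* s-unit s-unit) (Unit-* s-unit s-unit))
        (≈-trans (≈-sym (≈-by (≈0-*ˡ (v (n ℕ.* p) * (+ 10 * (s * (s * s)) * (y * y) + + 10 * (s * s) * ω * (y * (y * y)) +
                + 5 * s * (ω * ω) * ((y * y) * (y * y)) + (ω * (ω * ω)) * ((y * y) * (y * y) * y))) ω²≈0)
              (expand s ω y (v (n ℕ.* p)))))
          (≈-trans (quintic n) (≈-by (≈0-*ˡ (v n * ((s * (s * s)) * (χ (n ℕ.+ n) * χ (n ℕ.+ (n ℕ.+ n))))) ω²≈0)
            (expand′ s ω (χ (n ℕ.+ n)) (χ (n ℕ.+ (n ℕ.+ n))) (v n)))))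
        where
        y = χ n
        expand : ∀ s w y x → x * (((s + w * y) * (s + w * y)) * ((s + w * y) * (s + w * y)) * (s + w * y)) ≡
          ((s * s) * (s * s)) * (s * x + (+ 5 * (y * x)) * w) +
          (x * (+ 10 * (s * (s * s)) * (y * y) + + 10 * (s * s) * w * (y * (y * y)) +
                + 5 * s * (w * w) * ((y * y) * (y * y)) + (w * (w * w)) * ((y * y) * (y * y) * y))) * (w * w)
        expand = ℤ-solve
        expand′ : ∀ s w y z x → x * ((s * (s * s)) * ((s + w * y) * (s + w * z))) ≡
          ((s * s) * (s * s)) * (s * x + (x * (y + z)) * w) + (x * ((s * (s * s)) * (y * z))) * (w * w)
        expand′ = ℤ-solve

      -- Multiplying `linear` by `ω` kills its corrections, so v (n p) may be replaced by v n
      -- wherever `ω` already stands in front.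
      ω-v : ∀ n → v (n ℕ.* p) * ω ≈[ 4 ] v n * ω
      ω-v n = Unit-cancel s-unit (≈-trans (≈-by (≈0-*ˡ (- (+ 5 * (χ n * v (n ℕ.* p)))) ω²≈0) (left s ω (v (n ℕ.* p)) (χ n)))
        (≈-trans (*-congʳ ω (linear n))
          (≈-by (≈0-*ˡ (v n * (χ (n ℕ.+ n) + χ (n ℕ.+ (n ℕ.+ n)))) ω²≈0)
            (right s ω (v n) (χ (n ℕ.+ n) + χ (n ℕ.+ (n ℕ.+ n)))))))
        where
        left : ∀ s w x y → s * (x * w) ≡ (s * x + (+ 5 * (y * x)) * w) * w + (- (+ 5 * (y * x))) * (w * w)
        left = ℤ-solve
        right : ∀ s w x y → (s * x + (x * y) * w) * w ≡ s * (x * w) + (x * y) * (w * w)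
        right = ℤ-solve

      solve-for-v : ∀ n → v (n ℕ.* p) ≈[ 4 ] v n + (+ 10 * ι₀) * ((+ n * (+ n * + n)) * (v n * ω))
      solve-for-v n = Unit-cancel s-unit (≈-trans (≈-reflexive (left s (v (n ℕ.* p)) (χ n) ω))
        (≈-trans (+-cong (linear n) (*-congˡ (- (+ 5 * χ n)) (ω-v n)))
        (≈-trans (≈-reflexive (trans (cong₂ (λ y z → s * v n + (v n * (y + z)) * ω + (- (+ 5 * χ n)) * (v n * ω))
            (cong (λ k → k * (k * k) - k) (ℤ.pos-+ n n))
            (cong (λ k → k * (k * k) - k) (trans (ℤ.pos-+ n (n ℕ.+ n)) (cong (λ k → + n + k) (ℤ.pos-+ n n)))))
            (right φ₀ (v n) (+ n) ω)))
          (≈-sym (≈-by (≈0-*ˡ (+ 30 * ((+ n * (+ n * + n)) * (v n * ω))) (-‿≈0 (proj₂ (Unit-inverse 4 φ₀-unit))))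
            (inverse φ₀ ι₀ (v n) ((+ n * (+ n * + n)) * (v n * ω))))))))
        where
        left : ∀ s x y w → s * x ≡ (s * x + (+ 5 * (y * x)) * w) + (- (+ 5 * y)) * (x * w)
        left = ℤ-solve
        right : ∀ a x n w → + 3 * a * x + (x * (((n + n) * ((n + n) * (n + n)) - (n + n)) +
            ((n + (n + n)) * ((n + (n + n)) * (n + (n + n))) - (n + (n + n))))) * w +
            (- (+ 5 * (n * (n * n) - n))) * (x * w) ≡
          + 3 * a * x + + 30 * ((n * (n * n)) * (x * w))
        right = ℤ-solve
        inverse : ∀ a i x t → (+ 3 * a) * (x + (+ 10 * i) * t) ≡ (+ 3 * a * x + + 30 * t) + (+ 30 * t) * (a * i - 1ℤ)
        inverse = ℤ-solve

      regroup : ∀ i q c n x → x + (+ 10 * i) * ((n * (n * n)) * (x * (q * c))) ≡ x + q * ((+ 10 * c * i) * (n * (n * (n * x))))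
      regroup = ℤ-solve

    -- Values of u and v just below a multiple of p

    D : ℤ
    D = + d

    𝕡≡1+6D : 𝕡 ≡ + 1 + + 6 * D
    𝕡≡1+6D = trans 𝕡≡6d+1 (cong (λ z → + 1 + z) (ℤ.pos-* 6 d))

    unit-∸ : ∀ a j → j < a ℕ.* d → a ≤ 6 → Unit (+ a * D - + j)
    unit-∸ a j j<ad a≤6 = subst Unit (trans (cong +_ suc-pred) pos-∸)
      (unit< (ℕ.pred (a ℕ.* d ∸ j)) (subst (_< p) (sym suc-pred) (ℕ.≤-<-trans (ℕ.m∸n≤m (a ℕ.* d) j)
        (subst (a ℕ.* d <_) (sym p≡6d+1) (s≤s (ℕ.*-monoˡ-≤ d a≤6))))))
      where
      suc-pred : suc (ℕ.pred (a ℕ.* d ∸ j)) ≡ a ℕ.* d ∸ j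
      suc-pred = ℕ.suc-pred (a ℕ.* d ∸ j) {{ℕ.>-nonZero (ℕ.m<n⇒0<n∸m j<ad)}}
      pos-∸ : + (a ℕ.* d ∸ j) ≡ + a * D - + j
      pos-∸ = trans (sym (ℤ.⊖-≥ (ℕ.<⇒≤ j<ad))) (trans (sym (ℤ.m-n≡m⊖n (a ℕ.* d) j)) (cong (λ z → z - + j) (ℤ.pos-* a d)))

    below : ∀ {j k} m → k ℕ.+ suc j ≡ m ℕ.* p → + k ≡ + m * 𝕡 - (+ 1 + + j)
    below {j} {k} m eq = trans (identity (+ k) (+ suc j)) (cong (λ z → z - + suc j) (trans (sym (ℤ.pos-+ k (suc j)))
      (trans (cong +_ eq) (pos-*p m))))
      where
      identity : ∀ x y → x ≡ (x + y) - y
      identity = ℤ-solve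

    shift-index : ∀ {j m k} → k ℕ.+ suc (suc j) ≡ m ℕ.* p → suc k ℕ.+ suc j ≡ m ℕ.* p
    shift-index {j} {m} {k} eq = trans (sym (ℕ.+-suc k (suc j))) eq

    last-index : ∀ {m k} → k ℕ.+ 1 ≡ m ℕ.* p → suc k ≡ m ℕ.* p
    last-index {m} {k} eq = trans (sym (ℕ.+-comm k 1)) eq

    -- As 6 D ≡ -1 modulo p, the factor c + a k is congruent to a (b D - j) when a b = 6 t and c + t = a.
    factor-unit : ∀ a b c t {j k} m → a ℕ.* b ≡ 6 ℕ.* t → c ℕ.+ t ≡ a → b ≤ 6 → Unit (+ a) →
      suc j ≤ b ℕ.* d → k ℕ.+ suc j ≡ m ℕ.* p → Unit (+ c + + a * + k)
    factor-unit a b c t {j} {k} m ab≡6t c+t≡a b≤6 unit-a j<bd eq =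
      Unit-resp (≈-sym (≈-by (≈0-*ˡ (+ a * + m - + t) (𝕡^≈0 1)) expansion)) (Unit-* unit-a (unit-∸ b j j<bd b≤6))
      where
      identity : ∀ a b c t D m j → c + a * (m * (+ 1 + + 6 * D) - (+ 1 + j)) ≡
        (a * (b * D - j) + (a * m - t) * ((+ 1 + + 6 * D) * 1ℤ)) + (((c + t) - a) + (+ 6 * t - a * b) * D)
      identity = ℤ-solve
      drop : ∀ x D → x + ((+ a - + a) + (+ 6 * + t - + 6 * + t) * D) ≡ x
      drop x D = vanish x (+ a) (+ 6 * + t) D
        where
        vanish : ∀ x y z D → x + ((y - y) + (z - z) * D) ≡ x
        vanish = ℤ-solve
      expansion : + c + + a * + k ≡ + a * (+ b * D - + j) + (+ a * + m - + t) * (𝕡 * 1ℤ)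
      expansion = trans (cong (λ z → + c + + a * z) (trans (below m eq) (cong (λ z → + m * z - (+ 1 + + j)) 𝕡≡1+6D)))
        (trans (identity (+ a) (+ b) (+ c) (+ t) D (+ m) (+ j))
        (trans (cong₂ (λ y z → X + ((y - + a) + (+ 6 * + t - z) * D)) (trans (sym (ℤ.pos-+ c t)) (cong +_ c+t≡a))
            (trans (sym (ℤ.pos-* a b)) (trans (cong +_ ab≡6t) (ℤ.pos-* 6 t))))
        (trans (drop X D) (cong (λ z → + a * (+ b * D - + j) + (+ a * + m - + t) * (z * 1ℤ)) (sym 𝕡≡1+6D)))))
        where
        X = + a * (+ b * D - + j) + (+ a * + m - + t) * ((+ 1 + + 6 * D) * 1ℤ)

    K : ℤ → ℤ
    K x = + 6 * ((+ 1 + + 6 * x) * (+ 1 + + 3 * x))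

    -- Modulo p the factors of K are 6 (5d - j) and 3 (4d - j). The second one sets the bound 4d: it
    -- vanishes first, when k has residue 2d.
    K-unit : ∀ {j m k} → suc j ≤ 4 ℕ.* d → k ℕ.+ suc j ≡ m ℕ.* p → Unit (K (+ k))
    K-unit {m = m} j<4d eq = Unit-* unit-6 (Unit-*
      (factor-unit 6 5 1 5 m refl refl (ℕ.m≤m+n 5 1) unit-6 (ℕ.≤-trans j<4d (ℕ.*-monoˡ-≤ d (ℕ.m≤m+n 4 1))) eq)
      (factor-unit 3 4 1 2 m refl refl (ℕ.m≤m+n 4 2) unit-3 j<4d eq))

    L : ℤ → ℤ
    L x = + 6 * ((+ 1 + + 2 * x) * ((+ 1 + + 3 * x) * (+ 2 + + 3 * x)))

    -- The factors are multiples of 3d - j, 4d - j and 2d - j modulo p; the last one sets the bound.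
    L-unit : ∀ {j m k} → suc j ≤ 2 ℕ.* d → k ℕ.+ suc j ≡ m ℕ.* p → Unit (L (+ k))
    L-unit {m = m} j<2d eq = Unit-* unit-6 (Unit-*
      (factor-unit 2 3 1 1 m refl refl (ℕ.m≤m+n 3 3) unit-2 (ℕ.≤-trans j<2d (ℕ.*-monoˡ-≤ d (ℕ.m≤m+n 2 1))) eq) (Unit-*
      (factor-unit 3 4 1 2 m refl refl (ℕ.m≤m+n 4 2) unit-3 (ℕ.≤-trans j<2d (ℕ.*-monoˡ-≤ d (ℕ.m≤m+n 2 2))) eq)
      (factor-unit 3 2 2 1 m refl refl (ℕ.m≤m+n 2 4) unit-3 j<2d eq)))

    -- Run the recurrence downwards from the index m p. The first step has (m p)² on the side of u
    -- (m p), and every step divides by the unit K(k), so the factor p² persists.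
    u-small : ∀ j → suc j ≤ 4 ℕ.* d → ∀ m k → k ℕ.+ suc j ≡ m ℕ.* p → u k ≈[ 2 ] 0ℤ
    u-small j j<4d m k eq = Unit-cancel-0 (K-unit {m = m} j<4d eq) (≈-trans (≈-reflexive (sym (u-recurrence k))) (small j j<4d eq))
      where
      small : ∀ j → suc j ≤ 4 ℕ.* d → k ℕ.+ suc j ≡ m ℕ.* p → + suc k * (+ suc k * u (suc k)) ≈[ 2 ] 0ℤ
      small zero    _    eq = ≈-trans (≈-reflexive (trans (cong (λ z → + z * (+ z * u (suc k))) (last-index {m} eq))
          (trans (cong (λ z → z * (z * u (suc k))) (pos-*p m)) (identity (+ m) 𝕡 (u (suc k))))))
        (≈0-*ˡ (+ m * (+ m * u (suc k))) (𝕡^≈0 2))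
        where
        identity : ∀ m q x → m * q * (m * q * x) ≡ (m * (m * x)) * (q * (q * 1ℤ))
        identity = ℤ-solve
      small (suc j) j<4d eq = ≈0-*ˡ (+ suc k) (≈0-*ˡ (+ suc k) (u-small j (ℕ.<⇒≤ j<4d) m (suc k) (shift-index {j} {m} eq)))

    -- A Lucas congruence: modulo p the recurrence at a p + r is the one at r, and its leading
    -- coefficient is a unit while the index stays below p.
    u-forward : ∀ a r → r < p → u (a ℕ.* p ℕ.+ r) ≈[ 1 ] u (a ℕ.* p) * u r
    u-forward a zero    _   = ≈-reflexive (trans (cong u (ℕ.+-identityʳ (a ℕ.* p))) (sym (ℤ.*-identityʳ (u (a ℕ.* p)))))
    u-forward a (suc r) r<p = Unit-cancel (unit< r r<p) (Unit-cancel (unit< r r<p) (begin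
      + suc r * (+ suc r * u (a ℕ.* p ℕ.+ suc r))
        ≡⟨ cong (λ k → + suc r * (+ suc r * u k)) (ℕ.+-suc (a ℕ.* p) r) ⟩
      + suc r * (+ suc r * u (suc n))
        ≈⟨ *-cong suc≈ (*-congʳ (u (suc n)) suc≈) ⟨
      + suc n * (+ suc n * u (suc n))
        ≡⟨ u-recurrence n ⟩
      K (+ n) * u n
        ≈⟨ *-cong (*-congˡ (+ 6) (*-cong (+-cong (≈-refl {x = + 1}) (*-congˡ (+ 6) n≈)) (+-cong (≈-refl {x = + 1}) (*-congˡ (+ 3) n≈))))
             (u-forward a r (ℕ.<⇒≤ r<p)) ⟩
      K (+ r) * (u (a ℕ.* p) * u r)
        ≡⟨ swap (K (+ r)) (u (a ℕ.* p)) (u r) ⟩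
      u (a ℕ.* p) * (K (+ r) * u r)
        ≡⟨ cong (u (a ℕ.* p) *_) (u-recurrence r) ⟨
      u (a ℕ.* p) * (+ suc r * (+ suc r * u (suc r)))
        ≡⟨ swap′ (u (a ℕ.* p)) (+ suc r) (u (suc r)) ⟩
      + suc r * (+ suc r * (u (a ℕ.* p) * u (suc r))) ∎))
      where
      open ≈-Reasoning 1
      n = a ℕ.* p ℕ.+ r
      n≈ : + n ≈[ 1 ] + r
      n≈ = ≈-by (≈0-*ˡ (+ a) (𝕡^≈0 1)) (trans (ℤ.pos-+ (a ℕ.* p) r) (trans (cong (_+ + r) (pos-*p a)) (identity (+ a) 𝕡 (+ r))))
        where
        identity : ∀ a q r → a * q + r ≡ r + a * (q * 1ℤ)
        identity = ℤ-solve
      suc≈ : + suc n ≈[ 1 ] + suc r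
      suc≈ = +-cong (≈-refl {x = + 1}) n≈
      swap : ∀ x y z → x * (y * z) ≡ y * (x * z)
      swap = ℤ-solve
      swap′ : ∀ x y z → x * (y * (y * z)) ≡ y * (y * (x * z))
      swap′ = ℤ-solve

    v-weight : ℕ → ℤ
    v-weight m = + m * (+ m * (+ m * v m))

    -- The descent of `u-small`, now keeping the leading term. The constant depends on j alone: m
    -- enters through the start (m p)³ v (m p) ≡ 𝕡³ m³ v m, and later factors depend on m only
    -- modulo multiples of `𝕡`, invisible behind 𝕡³.
    v-back : ∀ j → suc j ≤ 2 ℕ.* d → ∃[ c ] ∀ m k → k ℕ.+ suc j ≡ m ℕ.* p → v k ≈[ 4 ] 𝕡 ^ 3 * (c * v-weight m)
    v-back j j<2d = divide (numerator j j<2d)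
      where
      x₀ = - (+ 1 + + j)
      L≈ : ∀ m k → k ℕ.+ suc j ≡ m ℕ.* p → L (+ k) ≈[ 1 ] L x₀
      L≈ m k eq = *-congˡ (+ 6) (*-cong (+-cong (≈-refl {x = + 1}) (*-congˡ (+ 2) k≈))
        (*-cong (+-cong (≈-refl {x = + 1}) (*-congˡ (+ 3) k≈)) (+-cong (≈-refl {x = + 2}) (*-congˡ (+ 3) k≈))))
        where
        k≈ : + k ≈[ 1 ] x₀
        k≈ = ≈-by (≈0-*ˡ (+ m) (𝕡^≈0 1)) (trans (below m eq) (identity (+ m) 𝕡 (+ j)))
          where
          identity : ∀ m q j → m * q - (+ 1 + j) ≡ - (+ 1 + j) + m * (q * 1ℤ)
          identity = ℤ-solve

      numerator : ∀ j → suc j ≤ 2 ℕ.* d → ∃[ c ] ∀ m k → k ℕ.+ suc j ≡ m ℕ.* p →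
        + suc k * (+ suc k * (+ suc k * v (suc k))) ≈[ 4 ] 𝕡 ^ 3 * (c * v-weight m)
      numerator zero    _    = 1ℤ , λ m k eq → ≈-trans
        (≈-reflexive (trans (cong (λ z → + z * (+ z * (+ z * v z))) (last-index {m} eq))
          (trans (cong (λ z → z * (z * (z * v (m ℕ.* p)))) (pos-*p m)) (gather (+ m) 𝕡 (v (m ℕ.* p))))))
        (≈-trans (𝕡^*-≈ 3 (*-congˡ (+ m * (+ m * + m)) (v≈ m)))
          (≈-reflexive (cong (𝕡 ^ 3 *_) (regroup (+ m) (v m)))))
        where
        regroup : ∀ m x → (m * (m * m)) * x ≡ 1ℤ * (m * (m * (m * x)))
        regroup = ℤ-solve
        v≈ : ∀ m → v (m ℕ.* p) ≈[ 1 ] v m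
        v≈ m = ≈-trans (≈-weaken 3 (proj₂ v-expansion m))
          (≈-by (≈-weaken {k = 1} 1 (≈-trans (*-congʳ t (𝕡^≈0 2)) (≈-reflexive (ℤ.*-zeroˡ t)))) refl)
          where
          t = proj₁ v-expansion * v-weight m
        gather : ∀ m q x → m * q * (m * q * (m * q * x)) ≡ (q * (q * (q * 1ℤ))) * ((m * (m * m)) * x)
        gather = ℤ-solve
      numerator (suc j) j<2d = let c , ih = v-back j (ℕ.<⇒≤ j<2d); y = - (+ 1 + + j) in y * (y * y) * c , λ m k eq →
        let e = shift-index {j} {m} eq
            s = + suc k in
        ≈-trans (*-congˡ s (*-congˡ s (*-congˡ s (ih m (suc k) e))))
          (≈-trans (≈-reflexive (cong (λ z → z * (z * (z * (𝕡 ^ 3 * (c * v-weight m))))) (below m e)))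
            (≈-by (≈0-*ˡ ((c * v-weight m) * (+ m * (+ 3 * (y * y) + + 3 * y * (+ m * 𝕡) + (+ m * 𝕡) * (+ m * 𝕡)))) (𝕡^≈0 4))
              (identity (+ m) 𝕡 (+ j) c (v-weight m))))
        where
        identity : ∀ m q j c w → (m * q - (+ 1 + j)) * ((m * q - (+ 1 + j)) * ((m * q - (+ 1 + j)) * ((q * (q * (q * 1ℤ))) * (c * w)))) ≡
          (q * (q * (q * 1ℤ))) * (((- (+ 1 + j)) * ((- (+ 1 + j)) * (- (+ 1 + j)))) * c * w) +
          ((c * w) * (m * (+ 3 * ((- (+ 1 + j)) * (- (+ 1 + j))) + + 3 * (- (+ 1 + j)) * (m * q) + (m * q) * (m * q)))) *
            (q * (q * (q * (q * 1ℤ))))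
        identity = ℤ-solve

      divide : (∃[ c ] ∀ m k → k ℕ.+ suc j ≡ m ℕ.* p → + suc k * (+ suc k * (+ suc k * v (suc k))) ≈[ 4 ] 𝕡 ^ 3 * (c * v-weight m)) →
        ∃[ c ] ∀ m k → k ℕ.+ suc j ≡ m ℕ.* p → v k ≈[ 4 ] 𝕡 ^ 3 * (c * v-weight m)
      divide (c , num) = i * c , λ m k eq → Unit-cancel (L-unit {m = m} j<2d eq)
        (≈-trans (≈-reflexive (sym (v-recurrence k))) (≈-trans (num m k eq)
          (≈-sym (≈-by (*-≈-zero 3 1 (𝕡^≈0 3) (≈0-*ˡ (c * v-weight m)
            (-‿≈0 (≈-trans (*-congʳ i (L≈ m k eq)) (proj₂ inv)))))
            (identity (L (+ k)) i c (v-weight m) (𝕡 ^ 3))))))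
        where
        -- `L x₀` does not involve m, so its invertibility can be read off at m = 1.
        inv = Unit-inverse 1 (L-unit-x₀)
          where
          2d≤p : 2 ℕ.* d ≤ p
          2d≤p = ℕ.≤-trans (ℕ.*-monoˡ-≤ d (ℕ.m≤m+n 2 4)) (subst (6 ℕ.* d ≤_) (sym p≡6d+1) (ℕ.n≤1+n (6 ℕ.* d)))
          e₁ : (p ∸ suc j) ℕ.+ suc j ≡ 1 ℕ.* p
          e₁ = trans (ℕ.m∸n+n≡m (ℕ.≤-trans j<2d 2d≤p)) (sym (ℕ.*-identityˡ p))
          L-unit-x₀ : Unit (L x₀)
          L-unit-x₀ = Unit-resp (L≈ 1 (p ∸ suc j) e₁) (L-unit {m = 1} j<2d e₁)
        i = proj₁ inv
        identity : ∀ l i c w q → l * (q * (i * c * w)) ≡ q * (c * w) + q * ((c * w) * (l * i - 1ℤ))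
        identity = ℤ-solve

    -- Over the p recurrence steps from u(ip) to u((i+1)p), ν (ip) collects the factors prime to p of the numerators,
    -- and φ (ip)² those of the denominators.
    ν₆ ν₃ ν : ℤ → ℤ
    ν₆ x = ∏ (5 ℕ.* d) (λ k → (𝕡 + + 6 * + suc k) + + 6 * x) * ∏ d (λ k → (+ 1 + + 6 * + k) + + 6 * x)
    ν₃ x = ∏ (4 ℕ.* d) (λ k → (𝕡 + + 3 * + suc k) + + 3 * x) * ∏ (2 ℕ.* d) (λ k → (+ 1 + + 3 * + k) + + 3 * x)
    ν x = (+ 6) ^ (6 ℕ.* d) * (ν₆ x * ν₃ x)

    -- The recurrence of u over a block of p steps

    progression : ∀ a b c x → b ℕ.+ c ≡ 6 ℕ.* d → + a * + b + + 1 ≡ 𝕡 →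
      ∏ p (λ k → + 1 + + a * (x * 𝕡 + + k)) ≡
      (𝕡 * (+ a * x + + 1)) * (∏ c (λ k → (𝕡 + + a * + suc k) + + a * (x * 𝕡)) * ∏ b (λ k → (+ 1 + + a * + k) + + a * (x * 𝕡)))
    progression a b c x b+c≡6d ab+1≡𝕡 = trans (cong (λ n → ∏ n f) (trans p≡6d+1 (trans (cong suc (sym b+c≡6d)) (sym (ℕ.+-suc b c)))))
      (trans (∏-split b (suc c) f) (trans (cong₂ _*_ (∏-cong b (λ k _ → low (+ a) (x * 𝕡) (+ k)))
          (trans (∏-front c (λ k → f (b ℕ.+ k))) (cong₂ _*_ middle (∏-cong c (λ k _ → high k)))))
        (rearrange (∏ b (λ k → (+ 1 + + a * + k) + + a * (x * 𝕡))) (𝕡 * (+ a * x + + 1)) _)))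
      where
      f : ℕ → ℤ
      f k = + 1 + + a * (x * 𝕡 + + k)
      low : ∀ a y k → + 1 + a * (y + k) ≡ (+ 1 + a * k) + a * y
      low = ℤ-solve
      middle : f (b ℕ.+ 0) ≡ 𝕡 * (+ a * x + + 1)
      middle = trans (cong f (ℕ.+-identityʳ b)) (trans (identity₁ (+ a) (x * 𝕡) (+ b))
        (trans (cong (_+ + a * (x * 𝕡)) ab+1≡𝕡) (identity₂ 𝕡 (+ a) x)))
        where
        identity₁ : ∀ a y b → + 1 + a * (y + b) ≡ (a * b + + 1) + a * y
        identity₁ = ℤ-solve
        identity₂ : ∀ q a x → q + a * (x * q) ≡ q * (a * x + + 1)
        identity₂ = ℤ-solve
      high : ∀ k → f (b ℕ.+ suc k) ≡ (𝕡 + + a * + suc k) + + a * (x * 𝕡)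
      high k = trans (cong (λ z → + 1 + + a * (x * 𝕡 + z)) (ℤ.pos-+ b (suc k))) (trans (identity (+ a) (x * 𝕡) (+ b) (+ suc k))
        (cong (λ z → (z + + a * + suc k) + + a * (x * 𝕡)) ab+1≡𝕡))
        where
        identity : ∀ a y b k → + 1 + a * (y + (b + k)) ≡ ((a * b + + 1) + a * k) + a * y
        identity = ℤ-solve
      rearrange : ∀ x y z → x * (y * z) ≡ y * (z * x)
      rearrange = ℤ-solve

    u-rising : ∀ i n → let x = + i * 𝕡 in
      (∏ n (λ k → x + + suc k) * ∏ n (λ k → x + + suc k)) * u (i ℕ.* p ℕ.+ n) ≡
      ((+ 6) ^ n * (∏ n (λ k → + 1 + + 6 * (x + + k)) * ∏ n (λ k → + 1 + + 3 * (x + + k)))) * u (i ℕ.* p)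
    u-rising i zero    = cong (λ k → (1ℤ * 1ℤ) * u k) (ℕ.+-identityʳ (i ℕ.* p))
    u-rising i (suc n) = trans (cong (λ z → ((R * (x + + suc n)) * (R * (x + + suc n))) * u z) (ℕ.+-suc (i ℕ.* p) n))
      (trans (gather R (x + + suc n) (u (suc m)))
      (trans (cong ((R * R) *_) (trans (cong (λ z → z * (z * u (suc m))) (sym suc-m≡)) (u-recurrence m)))
      (trans (swap (R * R) (K (+ m)) (u m)) (trans (cong (K (+ m) *_) (u-rising i n))
      (trans (cong (λ z → K z * ((+ 6) ^ n * (A * B) * u (i ℕ.* p))) m≡)
        (distribute (x + + n) ((+ 6) ^ n) A B (u (i ℕ.* p))))))))
      where
      m = i ℕ.* p ℕ.+ n
      x = + i * 𝕡
      R = ∏ n (λ k → x + + suc k)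
      A = ∏ n (λ k → + 1 + + 6 * (x + + k))
      B = ∏ n (λ k → + 1 + + 3 * (x + + k))
      m≡ : + m ≡ x + + n
      m≡ = trans (ℤ.pos-+ (i ℕ.* p) n) (cong (_+ + n) (pos-*p i))
      suc-m≡ : + suc m ≡ x + + suc n
      suc-m≡ = trans (cong +_ (sym (ℕ.+-suc (i ℕ.* p) n))) (trans (ℤ.pos-+ (i ℕ.* p) (suc n)) (cong (_+ + suc n) (pos-*p i)))
      gather : ∀ r y z → ((r * y) * (r * y)) * z ≡ (r * r) * (y * (y * z))
      gather = ℤ-solve
      swap : ∀ x y z → x * (y * z) ≡ y * (x * z)
      swap = ℤ-solve
      distribute : ∀ y s a b z → (+ 6 * ((+ 1 + + 6 * y) * (+ 1 + + 3 * y))) * ((s * (a * b)) * z) ≡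
        ((+ 6 * s) * ((a * (+ 1 + + 6 * y)) * (b * (+ 1 + + 3 * y)))) * z
      distribute = ℤ-solve

    -- The factor 1 + 6k at k = d and the factor 1 + 3k at k = 2d contribute 𝕡² (6i + 1)(3i + 1),
    -- and the denominators contribute 𝕡² (i + 1)². After cancelling 𝕡² these special factors
    -- reproduce the recurrence of u at i.
    u-block : ∀ i → let x = + i * 𝕡 in
      (φ x * φ x) * (+ suc i * (+ suc i * u (suc i ℕ.* p))) ≡ ν x * (K (+ i) * u (i ℕ.* p))
    u-block i = ℤ.*-cancelˡ-≡ (𝕡 * 𝕡) _ _ {{ℤ.i*j≢0 𝕡 𝕡 {{𝕡≢0}} {{𝕡≢0}}}} (trans (gather 𝕡 (φ x) (+ i) (u (suc i ℕ.* p)))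
      (trans (cong₂ (λ y z → (y * y) * u z) (sym R≡) (ℕ.+-comm p (i ℕ.* p)))
      (trans (u-rising i p)
      (trans (cong (_* u (i ℕ.* p)) (cong₂ _*_ (cong ((+ 6) ^_) p≡6d+1) (cong₂ _*_
          (progression 6 d (5 ℕ.* d) (+ i) refl six) (progression 3 (2 ℕ.* d) (4 ℕ.* d) (+ i) (sym (ℕ.*-distribʳ-+ d 2 4)) three))))
        (distribute 𝕡 ((+ 6) ^ (6 ℕ.* d)) (+ i) (ν₆ x) (ν₃ x) (u (i ℕ.* p)))))))
      where
      x = + i * 𝕡
      R≡ : ∏ p (λ k → x + + suc k) ≡ φ x * (x + 𝕡)
      R≡ = trans (cong (λ n → ∏ n (λ k → x + + suc k)) p≡6d+1) (cong (λ z → φ x * (x + z)) (sym 𝕡≡6d+1))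
      six : + 6 * + d + + 1 ≡ 𝕡
      six = trans (ℤ.+-comm (+ 6 * + d) (+ 1)) (sym 𝕡≡1+6D)
      three : + 3 * + (2 ℕ.* d) + + 1 ≡ 𝕡
      three = trans (cong (λ z → + 3 * z + + 1) (ℤ.pos-* 2 d)) (trans (identity D) six)
        where
        identity : ∀ D → + 3 * (+ 2 * D) + + 1 ≡ + 6 * D + + 1
        identity = ℤ-solve
      gather : ∀ q f i z → (q * q) * ((f * f) * ((+ 1 + i) * ((+ 1 + i) * z))) ≡
        ((f * (i * q + q)) * (f * (i * q + q))) * z
      gather = ℤ-solve
      distribute : ∀ q s i a b z →
        ((+ 6 * s) * (((q * (+ 6 * i + + 1)) * a) * ((q * (+ 3 * i + + 1)) * b))) * z ≡
        (q * q) * ((s * (a * b)) * ((+ 6 * ((+ 1 + + 6 * i) * (+ 1 + + 3 * i))) * z))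
      distribute = ℤ-solve

    Δ Ν : ℕ → ℤ
    Δ n = ∏ n (λ i → φ (+ i * 𝕡) * φ (+ i * 𝕡))
    Ν n = ∏ n (λ i → ν (+ i * 𝕡))

    u-blocks : ∀ n → u (n ℕ.* p) * Δ n ≡ u n * Ν n
    u-blocks zero    = refl
    u-blocks (suc n) = ℤ.*-cancelˡ-≡ (+ suc n * + suc n) _ _ {{ℤ.i*j≢0 (+ suc n) (+ suc n)}}
      (trans (gather (+ suc n) (u (suc n ℕ.* p)) (Δ n) (φ x * φ x))
      (trans (cong (Δ n *_) (u-block n))
      (trans (swap (Δ n) (ν x) (K (+ n)) (u (n ℕ.* p)))
      (trans (cong (ν x * K (+ n) *_) (u-blocks n))
      (trans (swap′ (ν x) (K (+ n)) (u n) (Ν n))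
      (trans (cong (_* (Ν n * ν x)) (sym (u-recurrence n)))
        (regroup (+ suc n) (u (suc n)) (Ν n * ν x))))))))
      where
      x = + n * 𝕡
      gather : ∀ s z D f → (s * s) * (z * (D * f)) ≡ D * (f * (s * (s * z)))
      gather = ℤ-solve
      swap : ∀ D n k z → D * (n * (k * z)) ≡ (n * k) * (z * D)
      swap = ℤ-solve
      swap′ : ∀ n k z N → (n * k) * (z * N) ≡ (k * z) * (N * n)
      swap′ = ℤ-solve
      regroup : ∀ s z N → (s * (s * z)) * N ≡ (s * s) * (z * N)
      regroup = ℤ-solve

    -- Comparison of the numerators ν with φ²

    steps-scale : ∀ n {c c′ : ℕ → ℤ} b s {f g : ℕ → ℤ} → (∀ k → c k ≈[ 1 ] b * c′ k) → (∀ k → f k ≈[ 1 ] s * g k) →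
      ∀ k → steps n c b f k ≈[ 1 ] (b ^ n * s) * steps n c′ 1ℤ g k
    steps-scale zero    b s {f} {g} _    f≈ k = ≈-trans (f≈ k) (≈-reflexive (cong (_* g k) (sym (ℤ.*-identityˡ s))))
    steps-scale (suc n) {c} {c′} b s {f} {g} c≈ f≈ = λ
      { zero    → ≈-trans (*-cong (c≈ n) (ih 0)) (≈-reflexive (low b (b ^ n) s (c′ n) (h 0)))
      ; (suc k) → ≈-trans (+-cong (*-cong (c≈ n) (ih (suc k))) (*-congˡ b (ih k)))
          (≈-reflexive (high b (b ^ n) s (c′ n) (h (suc k)) (h k)))
      }
      where
      h = steps n c′ 1ℤ g
      ih = steps-scale n b s c≈ f≈
      low : ∀ b t s c x → (b * c) * ((t * s) * x) ≡ ((b * t) * s) * (c * x)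
      low = ℤ-solve
      high : ∀ b t s c x y → (b * c) * ((t * s) * x) + b * ((t * s) * y) ≡ ((b * t) * s) * (c * x + 1ℤ * y)
      high = ℤ-solve

    times-progression : ℕ → ℕ → ℕ → (ℕ → ℤ) → ℕ → ℤ
    times-progression a b c f = steps b (λ k → + 1 + + a * + k) (+ a) (steps c (λ k → 𝕡 + + a * + suc k) (+ a) f)

    -- With the factors above the omitted multiple of `𝕡` placed first, the progression is a · 1, a
    -- · 2, ..., a · 6d modulo `𝕡`: the first c factors are a (k + 1), and the rest continue them
    -- because 1 ≡ a (c + 1).
    times-progression≈ : ∀ a b c s f g → c ℕ.+ b ≡ 6 ℕ.* d → (∃[ q ] + a * (+ c + + 1) ≡ + 1 + q * 𝕡) →
      (∀ k → f k ≈[ 1 ] s * g k) →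
      ∀ k → times-progression a b c f k ≈[ 1 ] ((+ a) ^ b * ((+ a) ^ c * s)) * times-φ g k
    times-progression≈ a b c s f g c+b≡6d (q , ac≡) f≈ k = ≈-trans
      (steps-scale b (+ a) ((+ a) ^ c * s) high (steps-scale c (+ a) s low f≈) k)
      (≈-reflexive (cong (λ h → ((+ a) ^ b * ((+ a) ^ c * s)) * h k)
        (trans (sym (steps-split c b (λ k → + suc k) 1ℤ g)) (cong (λ n → steps n (λ k → + suc k) 1ℤ g) c+b≡6d))))
      where
      low : ∀ k → 𝕡 + + a * + suc k ≈[ 1 ] + a * + suc k
      low k = ≈-by (𝕡^≈0 1) (identity 𝕡 (+ a * + suc k))
        where
        identity : ∀ q x → q + x ≡ x + q * 1ℤ
        identity = ℤ-solve
      high : ∀ k → + 1 + + a * + k ≈[ 1 ] + a * + suc (c ℕ.+ k)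
      high k = ≈-by (≈0-*ˡ (- q) (𝕡^≈0 1)) (trans (expand (+ a * + k) q 𝕡)
        (cong (λ z → z + (- q) * (𝕡 * 1ℤ)) (trans (cong (_+ + a * + k) (sym ac≡)) (trans (collect (+ a) (+ c) (+ k))
          (cong (λ z → + a * (+ 1 + z)) (sym (ℤ.pos-+ c k)))))))
        where
        expand : ∀ x q p → + 1 + x ≡ ((+ 1 + q * p) + x) + (- q) * (p * 1ℤ)
        expand = ℤ-solve
        collect : ∀ a c k → a * (c + + 1) + a * k ≡ a * (+ 1 + (c + k))
        collect = ℤ-solve

    ν-series φ²-series ε-series : ℕ → ℤ
    ν-series = times-progression 3 (2 ℕ.* d) (4 ℕ.* d) (times-progression 6 d (5 ℕ.* d) (λ k → (+ 6) ^ (6 ℕ.* d) * ℤ[[t]].1ₛ k))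
    φ²-series = times-φ (times-φ ℤ[[t]].1ₛ)
    ε-series k = ν-series k - φ²-series k

    opaque
      unfolding cubic

      cubic-scale : ∀ s f x → cubic (λ k → s * f k) x ≡ s * cubic f x
      cubic-scale s f x = identity s x (f 0) (f 1) (f 2) (f 3)
        where
        identity : ∀ s x a b c e → s * a + x * (s * b + x * (s * c + x * (s * e))) ≡ s * (a + x * (b + x * (c + x * e)))
        identity = ℤ-solve

      cubic-difference : ∀ f g x → cubic f x ≡ cubic g x + cubic (λ k → f k - g k) x
      cubic-difference f g x = identity x (f 0) (f 1) (f 2) (f 3) (g 0) (g 1) (g 2) (g 3)
        where
        identity : ∀ x a b c e a′ b′ c′ e′ → a + x * (b + x * (c + x * e)) ≡
          (a′ + x * (b′ + x * (c′ + x * e′))) + ((a - a′) + x * ((b - b′) + x * ((c - c′) + x * (e - e′))))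
        identity = ℤ-solve

      cubic-quadratic : ∀ e m → e 3 ≈[ 1 ] 0ℤ → cubic e (m * 𝕡) ≈[ 4 ] e 0 + (m * 𝕡) * (e 1 + (m * 𝕡) * e 2)
      cubic-quadratic e m e₃≈0 = ≈-by (≈0-*ˡ (m * (m * m)) (*-≈-zero 3 1 (𝕡^≈0 3) e₃≈0)) (identity (e 0) (e 1) (e 2) (e 3) m 𝕡)
        where
        identity : ∀ e₀ e₁ e₂ e₃ m q → e₀ + (m * q) * (e₁ + (m * q) * (e₂ + (m * q) * e₃)) ≡
          (e₀ + (m * q) * (e₁ + (m * q) * e₂)) + (m * (m * m)) * ((q * (q * (q * 1ℤ))) * e₃)
        identity = ℤ-solve

    cubic-times-progression : ∀ a b c f m → cubic (times-progression a b c f) (m * 𝕡) ≈[ 4 ]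
      (∏ c (λ k → (𝕡 + + a * + suc k) + + a * (m * 𝕡)) * ∏ b (λ k → (+ 1 + + a * + k) + + a * (m * 𝕡))) * cubic f (m * 𝕡)
    cubic-times-progression a b c f m = ≈-trans (cubic-steps b _ (+ a) (steps c (λ k → 𝕡 + + a * + suc k) (+ a) f) m)
      (≈-trans (*-congˡ Y (cubic-steps c (λ k → 𝕡 + + a * + suc k) (+ a) f m)) (≈-reflexive (identity Y X (cubic f (m * 𝕡)))))
      where
      X = ∏ c (λ k → (𝕡 + + a * + suc k) + + a * (m * 𝕡))
      Y = ∏ b (λ k → (+ 1 + + a * + k) + + a * (m * 𝕡))
      identity : ∀ x y z → x * (y * z) ≡ (y * x) * z
      identity = ℤ-solve

    ν-cubic : ∀ m → cubic ν-series (m * 𝕡) ≈[ 4 ] ν (m * 𝕡)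
    ν-cubic m = ≈-trans (cubic-times-progression 3 (2 ℕ.* d) (4 ℕ.* d) _ m)
      (≈-trans (*-congˡ (ν₃ (m * 𝕡)) (cubic-times-progression 6 d (5 ℕ.* d) _ m))
        (≈-reflexive (trans (cong (λ z → ν₃ (m * 𝕡) * (ν₆ (m * 𝕡) * z))
            (trans (cubic-scale ((+ 6) ^ (6 ℕ.* d)) ℤ[[t]].1ₛ (m * 𝕡)) (cong ((+ 6) ^ (6 ℕ.* d) *_) (cubic-1ₛ (m * 𝕡)))))
          (identity (ν₃ (m * 𝕡)) (ν₆ (m * 𝕡)) ((+ 6) ^ (6 ℕ.* d))))))
      where
      identity : ∀ x y z → x * (y * (z * 1ℤ)) ≡ z * (y * x)
      identity = ℤ-solve

    φ²-cubic : ∀ m → cubic φ²-series (m * 𝕡) ≈[ 4 ] φ (m * 𝕡) * φ (m * 𝕡)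
    φ²-cubic m = ≈-trans (cubic-times-φ (times-φ ℤ[[t]].1ₛ) m) (*-congˡ (φ (m * 𝕡)) (φ-cubic m))

    φ²-symmetric : φ²-series 3 ≈[ 1 ] 0ℤ × φ²-series 1 ≈[ 3 ] 𝕡 * φ²-series 2
    φ²-symmetric = symmetric-cubic φ²-series (λ i → ≈-trans (φ²-cubic i)
      (≈-trans (≈-reflexive (cong (λ z → z * z) (φ-reflect i))) (≈-sym (φ²-cubic (- 1ℤ - i)))))

    ν≈φ²-mod-p : ∃[ κ ] ∀ k → ν-series k ≈[ 1 ] κ * φ²-series k
    ν≈φ²-mod-p = (+ 3) ^ (2 ℕ.* d) * ((+ 3) ^ (4 ℕ.* d) * s) ,
      times-progression≈ 3 (2 ℕ.* d) (4 ℕ.* d) s f (times-φ ℤ[[t]].1ₛ) (sym (ℕ.*-distribʳ-+ d 4 2))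
        (+ 2 , trans (cong (λ z → + 3 * (z + + 1)) (ℤ.pos-* 4 d)) (trans (three D) (cong (λ z → + 1 + + 2 * z) (sym 𝕡≡1+6D))))
        (times-progression≈ 6 d (5 ℕ.* d) t (λ k → t * ℤ[[t]].1ₛ k) ℤ[[t]].1ₛ (ℕ.+-comm (5 ℕ.* d) d)
          (+ 5 , trans (cong (λ z → + 6 * (z + + 1)) (ℤ.pos-* 5 d)) (trans (six D) (cong (λ z → + 1 + + 5 * z) (sym 𝕡≡1+6D))))
          (λ k → ≈-refl))
      where
      t = (+ 6) ^ (6 ℕ.* d)
      s = (+ 6) ^ d * ((+ 6) ^ (5 ℕ.* d) * t)
      f = times-progression 6 d (5 ℕ.* d) (λ k → t * ℤ[[t]].1ₛ k)
      three : ∀ D → + 3 * (+ 4 * D + + 1) ≡ + 1 + + 2 * (+ 1 + + 6 * D)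
      three = ℤ-solve
      six : ∀ D → + 6 * (+ 5 * D + + 1) ≡ + 1 + + 5 * (+ 1 + + 6 * D)
      six = ℤ-solve

    -- Modulo `𝕡` the coefficients of ν are proportional to those of φ², whose coefficients of index
    -- 1 and 3 vanish by symmetry. Hence `ε` needs no cubic term and its linear term gains a factor
    -- `𝕡`.
    ε-odd : ∀ k → φ²-series k ≈[ 1 ] 0ℤ → ε-series k ≈[ 1 ] 0ℤ
    ε-odd k φ²≈0 = ≈0-+ (≈-trans (proj₂ ν≈φ²-mod-p k) (≈0-*ˡ (proj₁ ν≈φ²-mod-p) φ²≈0)) (neg-cong φ²≈0)

    ε₃≈0 : ε-series 3 ≈[ 1 ] 0ℤ
    ε₃≈0 = ε-odd 3 (proj₁ φ²-symmetric)

    ε₁≈0 : ε-series 1 ≈[ 1 ] 0ℤ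
    ε₁≈0 = ε-odd 1 (≈-trans (≈-weaken 2 (proj₂ φ²-symmetric)) (≈-trans (≈-reflexive (identity 𝕡 (φ²-series 2))) (≈0-*ˡ (φ²-series 2) (𝕡^≈0 1))))
      where
      identity : ∀ q x → q * x ≡ x * (q * 1ℤ)
      identity = ℤ-solve

    ε : ℤ → ℤ
    ε m = ε-series 0 + (m * 𝕡) * (ε-series 1 + (m * 𝕡) * ε-series 2)

    ν-expansion : ∀ m → ν (m * 𝕡) ≈[ 4 ] φ (m * 𝕡) * φ (m * 𝕡) + ε m
    ν-expansion m = ≈-trans (≈-sym (ν-cubic m)) (≈-trans (≈-reflexive (cubic-difference ν-series φ²-series (m * 𝕡)))
      (+-cong (φ²-cubic m) (cubic-quadratic ε-series m ε₃≈0)))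

    0<p : 0 < p
    0<p = ℕ.≤-trans (s≤s z≤n) 7≤p

    instance
      p≢0 : ℕ.NonZero p
      p≢0 = ℕ.>-nonZero 0<p

    _mod-p : ℕ → ℕ
    n mod-p = n ℕ.% p

    ad≤6d : ∀ {a} → a ≤ 6 → a ℕ.* d < p
    ad≤6d {a} a≤6 = subst (a ℕ.* d <_) (sym p≡6d+1) (s≤s (ℕ.*-monoˡ-≤ d a≤6))

    below-multiple : ∀ a b n → a ℕ.+ b ≡ 6 → a ℕ.* d < n mod-p → ∃[ m ] ∃[ j ] (suc j ≤ b ℕ.* d × n ℕ.+ suc j ≡ m ℕ.* p)
    below-multiple a b n a+b≡6 ad<s = suc (n ℕ./ p) , ℕ.pred (p ∸ s) , bound , index
      where
      s = n mod-p
      s<p : s < p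
      s<p = m%n<n n p
      suc-pred : suc (ℕ.pred (p ∸ s)) ≡ p ∸ s
      suc-pred = ℕ.suc-pred (p ∸ s) {{ℕ.>-nonZero (ℕ.m<n⇒0<n∸m s<p)}}
      bound : suc (ℕ.pred (p ∸ s)) ≤ b ℕ.* d
      bound = subst (_≤ b ℕ.* d) (sym suc-pred) (ℕ.≤-trans (ℕ.∸-monoʳ-≤ p ad<s)
        (ℕ.≤-reflexive (trans (cong (_∸ suc (a ℕ.* d)) p≡6d+1) (trans (cong (λ z → z ℕ.* d ∸ a ℕ.* d) (sym a+b≡6))
          (trans (cong (_∸ a ℕ.* d) (ℕ.*-distribʳ-+ d a b)) (ℕ.m+n∸m≡n (a ℕ.* d) (b ℕ.* d)))))))
      index : n ℕ.+ suc (ℕ.pred (p ∸ s)) ≡ suc (n ℕ./ p) ℕ.* p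
      index = trans (cong₂ ℕ._+_ (m≡m%n+[m/n]*n n p) suc-pred) (trans (regroup s (n ℕ./ p ℕ.* p) (p ∸ s))
        (cong (ℕ._+ n ℕ./ p ℕ.* p) (ℕ.m+[n∸m]≡n (ℕ.<⇒≤ s<p))))
        where
        regroup : ∀ x y z → (x ℕ.+ y) ℕ.+ z ≡ (x ℕ.+ z) ℕ.+ y
        regroup = ℕ-solve

    u-high : ∀ n → 2 ℕ.* d < n mod-p → u n ≈[ 2 ] 0ℤ
    u-high n lt = let m , j , j<4d , eq = below-multiple 2 4 n refl lt in u-small j j<4d m n eq

    v-high : ∀ n → 4 ℕ.* d < n mod-p → v n ≈[ 3 ] 0ℤ
    v-high n lt = let m , j , j<2d , eq = below-multiple 4 2 n refl lt
                      c , vk≈ = v-back j j<2d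
                  in ≈-trans (≈-weaken 1 (vk≈ m n eq))
                       (≈-trans (≈-reflexive (ℤ.*-comm (𝕡 ^ 3) (c * v-weight m))) (≈0-*ˡ (c * v-weight m) (𝕡^≈0 3)))

    module ℤ/[[t]] (k : ℕ) = Series (ℤ/ k)

    -- Both series modules use the same integers and operations, so the sums agree exactly; general
    -- facts about series thus apply modulo any power of `𝕡`.
    ⊛-same : ∀ k f g n → ℤ/[[t]]._⊛_ k f g n ≡ (f ℤ[[t]].⊛ g) n
    ⊛-same k f g n = ∑-same (suc n) (λ i → f i * g (n ∸ i))
      where
      ∑-same : ∀ n f → ℤ/[[t]].∑ k n f ≡ ℤ[[t]].∑ n f
      ∑-same zero    f = refl
      ∑-same (suc n) f = cong (λ z → f 0 + z) (∑-same n (f ∘ suc))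

    u⊛u≡v : ∀ k n → ℤ/[[t]]._⊛_ k u u n ≡ v n
    u⊛u≡v k n = trans (⊛-same k u u n) (clausen n)

    -- Clausen's identity at index p: modulo p² only the two products with u₀ survive, so 2 u_p ≡
    -- v_p ≡ v₁ = 12.
    up≈6 : u (1 ℕ.* p) ≈[ 2 ] + 6
    up≈6 = Unit-cancel unit-2 (≈-trans (≈-reflexive (double (u (1 ℕ.* p))))
      (≈-trans (≈-sym (C-⊛-supported 4d<p u-high u-high 1))
      (≈-trans (≈-reflexive (u⊛u≡v 2 (1 ℕ.* p)))
      (≈-trans (≈-weaken 2 (proj₂ v-expansion 1)) (≈-by (≈0-*ˡ (t 1) (𝕡^≈0 2)) (identity (t 1) (𝕡 ^ 2)))))))
      where
      open ℤ/[[t]].Sections 2 p 0<p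
      4d<p : 2 ℕ.* d ℕ.+ 2 ℕ.* d < p
      4d<p = subst (_< p) (ℕ.*-distribʳ-+ d 2 2) (ad≤6d (ℕ.m≤m+n 4 2))
      t : ℕ → ℤ
      t n = proj₁ v-expansion * v-weight n
      double : ∀ x → + 2 * x ≡ 1ℤ * x + (x * 1ℤ + 0ℤ)
      double = ℤ-solve
      identity : ∀ t q → + 12 + q * t ≡ + 12 + t * q
      identity = ℤ-solve

    D₀ : ℤ
    D₀ = φ₀ * φ₀

    D₀-unit : Unit D₀
    D₀-unit = Unit-* φ₀-unit φ₀-unit

    φ²≈D₀ : ∀ m → φ (m * 𝕡) * φ (m * 𝕡) ≈[ 2 ] D₀
    φ²≈D₀ m = *-cong φ≈ φ≈
      where
      φ≈ : φ (m * 𝕡) ≈[ 2 ] φ₀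
      φ≈ = ≈-trans (≈-weaken 2 (φ-expansion m)) (≈-by (≈0-*ˡ (φ₂ * (m * m + m)) (𝕡^≈0 2)) (cong (λ z → φ₀ + z) (ℤ.*-comm (𝕡 ^ 2) _)))

    -- The comparison of ν with φ² modulo `𝕡` leaves a scalar undetermined. The exact relation u_p
    -- φ(0)² = 6 ν(0) together with `up≈6` shows that ν(0) and φ(0)² agree even modulo p².
    ε₀≈0 : ε-series 0 ≈[ 2 ] 0ℤ
    ε₀≈0 = Unit-cancel-0 unit-6 (begin
      + 6 * ε-series 0                             ≡⟨ split φ² (ε-series 0) (ε-series 1) (ε-series 2) 𝕡 ⟩
      + 6 * (φ² + ε 0ℤ) - + 6 * φ²                 ≈⟨ +-cong (*-congˡ (+ 6) (≈-weaken 2 (ν-expansion 0ℤ))) (≈-refl {x = - (+ 6 * φ²)}) ⟨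
      + 6 * ν (0ℤ * 𝕡) - + 6 * φ²                  ≡⟨ cong (λ z → z - + 6 * φ²) block ⟨
      u (1 ℕ.* p) * φ² - + 6 * φ²                  ≡⟨ factor (u (1 ℕ.* p)) φ² ⟩
      φ² * (u (1 ℕ.* p) - + 6)                     ≈⟨ ≈0-*ˡ φ² (-‿≈0 up≈6) ⟩
      0ℤ                                           ∎)
      where
      open ≈-Reasoning 2
      φ² = φ (0ℤ * 𝕡) * φ (0ℤ * 𝕡)
      block : u (1 ℕ.* p) * φ² ≡ + 6 * ν (0ℤ * 𝕡)
      block = trans (cong (u (1 ℕ.* p) *_) (sym (ℤ.*-identityˡ φ²))) (trans (u-blocks 1)
        (cong₂ _*_ u₁ (ℤ.*-identityˡ (ν (0ℤ * 𝕡)))))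
      split : ∀ f a b c q → + 6 * a ≡ + 6 * (f + (a + (0ℤ * q) * (b + (0ℤ * q) * c))) - + 6 * f
      split = ℤ-solve
      factor : ∀ x f → x * f - + 6 * f ≡ f * (x - + 6)
      factor = ℤ-solve

    ε≈0 : ∀ m → ε m ≈[ 2 ] 0ℤ
    ε≈0 m = ≈-trans (≈-reflexive (identity (ε-series 0) (ε-series 1) (ε-series 2) m 𝕡))
      (≈0-+ ε₀≈0 (≈0-+ (≈0-*ˡ m (*-≈-zero 1 1 (𝕡^≈0 1) ε₁≈0)) (≈0-*ˡ (m * m * ε-series 2) (𝕡^≈0 2))))
      where
      identity : ∀ a b c m q → a + (m * q) * (b + (m * q) * c) ≡ a + (m * ((q * 1ℤ) * b) + (m * m * c) * (q * (q * 1ℤ)))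
      identity = ℤ-solve

    -- Expansions of u at and below multiples of p

    σ : ℕ → ℤ
    σ zero    = 0ℤ
    σ (suc n) = σ n + ε (+ n)

    σ≈0 : ∀ n → σ n ≈[ 2 ] 0ℤ
    σ≈0 zero    = ≈-refl
    σ≈0 (suc n) = ≈0-+ (σ≈0 n) (ε≈0 (+ n))

    Δ≈ : ∀ n → Δ n ≈[ 2 ] D₀ ^ n
    Δ≈ zero    = ≈-refl
    Δ≈ (suc n) = ≈-trans (*-cong (Δ≈ n) (φ²≈D₀ (+ n))) (≈-reflexive (ℤ.*-comm (D₀ ^ n) D₀))

    -- First-order expansion of the product of the φ² + ε. Both ε and φ² - D₀ are multiples of p²,
    -- so the corrections add up to `σ` and may be multiplied by powers of `D₀` in place of the
    -- other φ².
    Ν≈ : ∀ n → D₀ * Ν n ≈[ 4 ] D₀ * Δ n + D₀ ^ n * σ n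
    Ν≈ zero    = ≈-reflexive (identity D₀)
      where
      identity : ∀ x → x * 1ℤ ≡ x * 1ℤ + 1ℤ * 0ℤ
      identity = ℤ-solve
    Ν≈ (suc n) = ≈-trans (≈-reflexive (sym (ℤ.*-assoc D₀ (Ν n) (ν (+ n * 𝕡)))))
      (≈-trans (*-cong (Ν≈ n) (ν-expansion (+ n)))
        (≈-by (≈0-+ (≈0-*ˡ D₀ (*-≈-zero 2 2 (-‿≈0 (Δ≈ n)) (ε≈0 (+ n))))
                (≈0-*ˡ (D₀ ^ n) (≈0-+ (*-≈-zero 2 2 (σ≈0 n) (-‿≈0 (φ²≈D₀ (+ n)))) (*-≈-zero 2 2 (σ≈0 n) (ε≈0 (+ n))))))
          (identity D₀ (D₀ ^ n) (Δ n) (σ n) (φ (+ n * 𝕡) * φ (+ n * 𝕡)) (ε (+ n)))))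
      where
      identity : ∀ D P x s f e → (D * x + P * s) * (f + e) ≡
        (D * (x * f) + (D * P) * (s + e)) + (D * ((x - P) * e) + P * (s * (f - D) + s * e))
      identity = ℤ-solve

    u-expansion : ∀ n → D₀ * (u (n ℕ.* p) - u n) ≈[ 4 ] u n * σ n
    u-expansion n = Unit-cancel (Unit-^ n D₀-unit) (≈-trans (≈-sym (≈-by (*-≈-zero 2 2 (-‿≈0 (Δ≈ n)) (≈0-*ˡ D₀ difference≈0))
        (replace (D₀ ^ n) D₀ (Δ n) (u (n ℕ.* p) - u n))))
      (≈-trans scaled (≈-reflexive (swap (u n) (D₀ ^ n) (σ n)))))
      where
      scaled : Δ n * (D₀ * (u (n ℕ.* p) - u n)) ≈[ 4 ] u n * (D₀ ^ n * σ n)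
      scaled = ≈-trans (≈-reflexive (trans (expand (Δ n) D₀ (u (n ℕ.* p)) (u n)) (trans (cong (λ z → D₀ * z - u n * (D₀ * Δ n)) (u-blocks n))
          (regroup D₀ (u n) (Ν n) (D₀ * Δ n)))))
        (≈-trans (*-congˡ (u n) (+-cong (Ν≈ n) (≈-refl {x = - (D₀ * Δ n)})))
          (≈-reflexive (cancel (u n) (D₀ * Δ n) (D₀ ^ n * σ n))))
        where
        expand : ∀ x D y z → x * (D * (y - z)) ≡ D * (y * x) - z * (D * x)
        expand = ℤ-solve
        regroup : ∀ D z N y → D * (z * N) - z * y ≡ z * (D * N - y)
        regroup = ℤ-solve
        cancel : ∀ z y s → z * ((y + s) - y) ≡ z * s
        cancel = ℤ-solve
      difference≈0 : u (n ℕ.* p) - u n ≈[ 2 ] 0ℤ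
      difference≈0 = Unit-cancel-0 D₀-unit (Unit-cancel-0 (Unit-resp (≈-weaken 1 (≈-sym (Δ≈ n))) (Unit-^ n D₀-unit))
        (≈-trans (≈-weaken 2 scaled) (≈0-*ˡ (u n) (≈0-*ˡ (D₀ ^ n) (σ≈0 n)))))
      replace : ∀ P D x y → x * (D * y) ≡ P * (D * y) + (x - P) * (D * y)
      replace = ℤ-solve
      swap : ∀ x y z → x * (y * z) ≡ y * (x * z)
      swap = ℤ-solve

    u-multiple≈ : ∀ n → u (n ℕ.* p) ≈[ 2 ] u n
    u-multiple≈ n = ≈-by (Unit-cancel-0 D₀-unit (≈-trans (≈-weaken 2 (u-expansion n)) (≈0-*ˡ (u n) (σ≈0 n)))) (identity (u (n ℕ.* p)) (u n))
      where
      identity : ∀ x y → x ≡ y + (x - y)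
      identity = ℤ-solve

    -- The 6 clears the denominators in the sums of i and of i² over i < n.
    6σ : ∀ n → + 6 * σ n ≡ + n * (+ 6 * ε-series 0 - + 3 * ε-series 1 * 𝕡 + ε-series 2 * (𝕡 * 𝕡)) +
      (+ n * + n) * (+ 3 * ε-series 1 * 𝕡 - + 3 * ε-series 2 * (𝕡 * 𝕡)) + (+ n * (+ n * + n)) * (+ 2 * ε-series 2 * (𝕡 * 𝕡))
    6σ zero    = identity (ε-series 0) (ε-series 1) (ε-series 2) 𝕡
      where
      identity : ∀ a b c q → + 6 * 0ℤ ≡ 0ℤ * (+ 6 * a - + 3 * b * q + c * (q * q)) + (0ℤ * 0ℤ) * (+ 3 * b * q - + 3 * c * (q * q)) +
        (0ℤ * (0ℤ * 0ℤ)) * (+ 2 * c * (q * q))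
      identity = ℤ-solve
    6σ (suc n) = trans (ℤ.*-distribˡ-+ (+ 6) (σ n) (ε (+ n))) (trans (cong (_+ + 6 * ε (+ n)) (6σ n))
      (identity (ε-series 0) (ε-series 1) (ε-series 2) 𝕡 (+ n)))
      where
      identity : ∀ a b c q n → (n * (+ 6 * a - + 3 * b * q + c * (q * q)) + (n * n) * (+ 3 * b * q - + 3 * c * (q * q)) +
          (n * (n * n)) * (+ 2 * c * (q * q))) + + 6 * (a + (n * q) * (b + (n * q) * c)) ≡
        (+ 1 + n) * (+ 6 * a - + 3 * b * q + c * (q * q)) + ((+ 1 + n) * (+ 1 + n)) * (+ 3 * b * q - + 3 * c * (q * q)) +
        ((+ 1 + n) * ((+ 1 + n) * (+ 1 + n))) * (+ 2 * c * (q * q))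
      identity = ℤ-solve

    u-weight : ℕ → ℤ
    u-weight m = + m * (+ m * u m)

    -- To first order 1/(q₀ + q₁ y) is i - i² q₁ y. The neglected y² is divisible by 𝕡² and stands
    -- behind another 𝕡².
    affine-divide : ∀ {q i} q₀ q₁ k₀ k₁ y w X → y ≈[ 1 ] 0ℤ → Unit q → q ≈[ 2 ] q₀ + q₁ * y → q₀ * i ≈[ 2 ] 1ℤ →
      q * X ≈[ 4 ] 𝕡 ^ 2 * (w * (k₀ + k₁ * y)) → X ≈[ 4 ] 𝕡 ^ 2 * (w * (i * k₀ + i * (k₁ - i * q₁ * k₀) * y))
    affine-divide {q} {i} q₀ q₁ k₀ k₁ y w X y≈0 uq q≈ q₀i≈1 qX≈ = Unit-cancel uq (≈-trans qX≈ (≈-sym (≈-by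
      (*-≈-zero 2 2 (𝕡^≈0 2) (≈0-*ˡ w (≈0-+ (≈0-*ˡ (i * k₀ + i * (k₁ - i * q₁ * k₀) * y) (-‿≈0 q≈))
        (≈0-+ (≈0-*ˡ (k₀ + (k₁ - i * q₁ * k₀) * y) (-‿≈0 q₀i≈1))
          (≈0-*ˡ (q₁ * (i * (k₁ - i * q₁ * k₀))) (*-≈-zero 1 1 y≈0 y≈0))))))
      (identity q i q₀ q₁ k₀ k₁ y w (𝕡 ^ 2)))))
      where
      identity : ∀ q i q₀ q₁ k₀ k₁ y w Q → q * (Q * (w * (i * k₀ + i * (k₁ - i * q₁ * k₀) * y))) ≡
        Q * (w * (k₀ + k₁ * y)) + Q * (w * ((i * k₀ + i * (k₁ - i * q₁ * k₀) * y) * (q - (q₀ + q₁ * y)) +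
          ((k₀ + (k₁ - i * q₁ * k₀) * y) * (q₀ * i - 1ℤ) + (q₁ * (i * (k₁ - i * q₁ * k₀))) * (y * y))))
      identity = ℤ-solve

    m𝕡≈0 : ∀ m → m * 𝕡 ≈[ 1 ] 0ℤ
    m𝕡≈0 m = ≈-trans (≈-reflexive (cong (m *_) (sym (ℤ.*-identityʳ 𝕡)))) (≈0-*ˡ m (𝕡^≈0 1))

    -- The analogue of `v-back`. The start (m p)² u (m p) supplies only 𝕡², so two further digits
    -- matter and the dependence on m has to be kept to first order in m 𝕡. It is these affine terms
    -- that make P a cubic.
    u-back : ∀ j → suc j ≤ 4 ℕ.* d → ∃[ k₀ ] ∃[ k₁ ] ∀ m k → k ℕ.+ suc j ≡ m ℕ.* p →
      u k ≈[ 4 ] 𝕡 ^ 2 * (u-weight m * (k₀ + k₁ * (+ m * 𝕡)))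
    u-back j j<4d = divide (numerator j j<4d)
      where
      x₀ = - (+ 1 + + j)
      q₁ = + 6 * (+ 6 * (+ 1 + + 3 * x₀) + + 3 * (+ 1 + + 6 * x₀))

      K≈ : ∀ m k → k ℕ.+ suc j ≡ m ℕ.* p → K (+ k) ≈[ 2 ] K x₀ + q₁ * (+ m * 𝕡)
      K≈ m k eq = ≈-by (≈0-*ˡ (+ 108) (*-≈-zero 1 1 (m𝕡≈0 (+ m)) (m𝕡≈0 (+ m))))
        (trans (cong K (below m eq)) (identity (+ m * 𝕡) (+ j)))
        where
        identity : ∀ y j → + 6 * ((+ 1 + + 6 * (y - (+ 1 + j))) * (+ 1 + + 3 * (y - (+ 1 + j)))) ≡
          (+ 6 * ((+ 1 + + 6 * (- (+ 1 + j))) * (+ 1 + + 3 * (- (+ 1 + j)))) +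
           (+ 6 * (+ 6 * (+ 1 + + 3 * (- (+ 1 + j))) + + 3 * (+ 1 + + 6 * (- (+ 1 + j))))) * y) + + 108 * (y * y)
        identity = ℤ-solve

      numerator : ∀ j → suc j ≤ 4 ℕ.* d → ∃[ k₀ ] ∃[ k₁ ] ∀ m k → k ℕ.+ suc j ≡ m ℕ.* p →
        + suc k * (+ suc k * u (suc k)) ≈[ 4 ] 𝕡 ^ 2 * (u-weight m * (k₀ + k₁ * (+ m * 𝕡)))
      numerator zero    _    = 1ℤ , 0ℤ , λ m k eq → ≈-trans
        (≈-reflexive (trans (cong (λ z → + z * (+ z * u z)) (last-index {m} eq))
          (trans (cong (λ z → z * (z * u (m ℕ.* p))) (pos-*p m)) (gather (+ m) 𝕡 (u (m ℕ.* p))))))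
        (≈-trans (𝕡^*-≈ 2 (*-congˡ (+ m * + m) (u-multiple≈ m)))
          (≈-reflexive (cong (𝕡 ^ 2 *_) (regroup (+ m) (u m) 𝕡))))
        where
        gather : ∀ m q x → m * q * (m * q * x) ≡ (q * (q * 1ℤ)) * ((m * m) * x)
        gather = ℤ-solve
        regroup : ∀ m x q → (m * m) * x ≡ (m * (m * x)) * (1ℤ + 0ℤ * (m * q))
        regroup = ℤ-solve
      numerator (suc j) j<4d = next (u-back j (ℕ.<⇒≤ j<4d))
        where
        next : (∃[ k₀ ] ∃[ k₁ ] ∀ m k → k ℕ.+ suc j ≡ m ℕ.* p → u k ≈[ 4 ] 𝕡 ^ 2 * (u-weight m * (k₀ + k₁ * (+ m * 𝕡)))) →
          ∃[ k₀ ] ∃[ k₁ ] ∀ m k → k ℕ.+ suc (suc j) ≡ m ℕ.* p →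
          + suc k * (+ suc k * u (suc k)) ≈[ 4 ] 𝕡 ^ 2 * (u-weight m * (k₀ + k₁ * (+ m * 𝕡)))
        next (k₀ , k₁ , ih) = y * y * k₀ , + 2 * y * k₀ + y * y * k₁ , λ m k eq →
          let e = shift-index {j} {m} eq
              s = + suc k
              z = + m * 𝕡 in
          ≈-trans (*-congˡ s (*-congˡ s (ih m (suc k) e)))
            (≈-trans (≈-reflexive (cong (λ s → s * (s * (𝕡 ^ 2 * (u-weight m * (k₀ + k₁ * z))))) (below m e)))
              (≈-by (*-≈-zero 2 2 (𝕡^≈0 2) (≈0-*ˡ (u-weight m * (k₀ + (+ 2 * y) * k₁ + k₁ * z)) (*-≈-zero 1 1 (m𝕡≈0 (+ m)) (m𝕡≈0 (+ m)))))
                (identity (u-weight m) k₀ k₁ z (+ j) (𝕡 ^ 2))))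
          where
          y = - (+ 1 + + j)
          identity : ∀ w k₀ k₁ z j Q → (z - (+ 1 + j)) * ((z - (+ 1 + j)) * (Q * (w * (k₀ + k₁ * z)))) ≡
            Q * (w * ((- (+ 1 + j)) * (- (+ 1 + j)) * k₀ +
              (+ 2 * (- (+ 1 + j)) * k₀ + (- (+ 1 + j)) * (- (+ 1 + j)) * k₁) * z)) +
            Q * ((w * (k₀ + (+ 2 * (- (+ 1 + j))) * k₁ + k₁ * z)) * (z * z))
          identity = ℤ-solve

      divide : (∃[ k₀ ] ∃[ k₁ ] ∀ m k → k ℕ.+ suc j ≡ m ℕ.* p →
          + suc k * (+ suc k * u (suc k)) ≈[ 4 ] 𝕡 ^ 2 * (u-weight m * (k₀ + k₁ * (+ m * 𝕡)))) →
        ∃[ k₀ ] ∃[ k₁ ] ∀ m k → k ℕ.+ suc j ≡ m ℕ.* p → u k ≈[ 4 ] 𝕡 ^ 2 * (u-weight m * (k₀ + k₁ * (+ m * 𝕡)))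
      divide (k₀ , k₁ , num) = i * k₀ , i * (k₁ - i * q₁ * k₀) , λ m k eq →
        affine-divide {K (+ k)} {i} (K x₀) q₁ k₀ k₁ (+ m * 𝕡) (u-weight m) (u k) (m𝕡≈0 (+ m)) (K-unit {m = m} j<4d eq) (K≈ m k eq) (proj₂ inv)
          (≈-trans (≈-reflexive (sym (u-recurrence k))) (num m k eq))
        where
        e₁ : (p ∸ suc j) ℕ.+ suc j ≡ 1 ℕ.* p
        e₁ = trans (ℕ.m∸n+n≡m (ℕ.≤-trans j<4d (ℕ.<⇒≤ (ad≤6d (ℕ.m≤m+n 4 2))))) (sym (ℕ.*-identityˡ p))
        inv : ∃[ z ] K x₀ * z ≈[ 2 ] 1ℤ
        inv = Unit-inverse 2 {K x₀} (Unit-resp (≈-trans (≈-weaken {1} 1 (K≈ 1 (p ∸ suc j) e₁))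
            (≈-by (≈0-*ˡ q₁ (m𝕡≈0 (+ 1))) refl)) (K-unit {m = 1} j<4d e₁))
        i = proj₁ inv

    -- Low and high residues of u

    open ℤ[[t]] using (_⊛_; _⊕_; 1ₛ; ∑; ⊛-cong; ⊛-comm; ⊛-assoc; ⊛-distribʳ; ⊛-identityˡ; ⊛-scaleˡ; seriesSemiring; _≋_)
    open ℤ[[t]].Sections p 0<p
    open SemiringSolver seriesSemiring using (solve; _:=_; _:+_; _:*_)

    ⊛-cong≈ : ∀ k {f f′ g g′} n → (∀ i → f i ≈[ k ] f′ i) → (∀ i → g i ≈[ k ] g′ i) → (f ⊛ g) n ≈[ k ] (f′ ⊛ g′) n
    ⊛-cong≈ k {f} {f′} {g} {g′} n f≈ g≈ = ≈-trans (≈-reflexive (sym (⊛-same k f g n)))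
      (≈-trans (ℤ/[[t]].⊛-cong k f≈ g≈ n) (≈-reflexive (⊛-same k f′ g′ n)))

    ⊛-≈0 : ∀ k f g n → (∀ i → i ≤ n → f i * g (n ∸ i) ≈[ k ] 0ℤ) → (f ⊛ g) n ≈[ k ] 0ℤ
    ⊛-≈0 k f g n fg≈0 = ≈-trans (≈-reflexive (sym (⊛-same k f g n)))
      (ℤ/[[t]].∑-zero k (suc n) (λ { i (s≤s i≤n) → fg≈0 i i≤n }))

    C-⊛≈ : ∀ k f g m → (∀ i → i ≤ m ℕ.* p → ¬ i mod-p ≡ 0 → f i * g (m ℕ.* p ∸ i) ≈[ k ] 0ℤ) →
      C (f ⊛ g) m ≈[ k ] (C f ⊛ C g) m
    C-⊛≈ k f g m vanish = ≈-trans (≈-reflexive (sym (⊛-same k f g (m ℕ.* p))))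
      (≈-trans (ℤ/[[t]].Sections.C-⊛ k p 0<p f g m vanish) (≈-reflexive (⊛-same k (C f) (C g) m)))

    cancel≈0 : ∀ k f g → f 0 ≡ 1ℤ → (∀ n → (f ⊛ g) n ≈[ k ] 0ℤ) → ∀ n → g n ≈[ k ] 0ℤ
    cancel≈0 k f g f0≡1 fg≈0 = ℤ/[[t]].⊛-cancel-0 k {f} {g} (≈-reflexive f0≡1)
      (λ n → ≈-trans (≈-reflexive (⊛-same k f g n)) (fg≈0 n))

    Low? : ∀ n → Dec (n mod-p ≤ 2 ℕ.* d)
    Low? n = n mod-p ℕ.≤? 2 ℕ.* d

    -- u split by residue modulo p: lo keeps the residues ≤ 2d, where u is not forced to vanish
    -- modulo p²; base is the polynomial of residue representatives, and multiples ⊛ base is lo modulo p.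
    lo hi base multiples ρ : ℕ → ℤ
    lo n        = select (Low? n) (u n)
    hi n        = u n - lo n
    base n      = select (n ℕ.≤? 2 ℕ.* d) (u n)
    multiples n = select (n mod-p ℕ.≟ 0) (u n)
    ρ n         = lo n - (multiples ⊛ base) n

    u≋ : u ≋ lo ⊕ hi
    u≋ n = identity (u n) (lo n)
      where
      identity : ∀ x y → x ≡ y + (x - y)
      identity = ℤ-solve

    hi≈0 : ∀ n → hi n ≈[ 2 ] 0ℤ
    hi≈0 n = cases (Low? n)
      where
      cases : (l : Dec (n mod-p ≤ 2 ℕ.* d)) → u n - select l (u n) ≈[ 2 ] 0ℤ
      cases (yes _) = ≈-reflexive (ℤ.+-inverseʳ (u n))
      cases (no ¬l) = ≈-trans (≈-reflexive (ℤ.+-identityʳ (u n))) (u-high n (ℕ.≰⇒> ¬l))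

    lo-supported : Supported (2 ℕ.* d) lo
    lo-supported n lt = select-no (Low? n) (ℕ.<⇒≱ lt)

    n≡ : ∀ n → n ≡ (n ℕ./ p) ℕ.* p ℕ.+ n mod-p
    n≡ n = trans (m≡m%n+[m/n]*n n p) (ℕ.+-comm (n mod-p) (n ℕ./ p ℕ.* p))

    mod-p< : ∀ n → n mod-p < p
    mod-p< n = m%n<n n p

    base-low : ∀ {n} → n ≤ 2 ℕ.* d → base n ≡ u n
    base-low {n} n≤2d = select-yes (n ℕ.≤? 2 ℕ.* d) n≤2d

    base-high : ∀ {n} → 2 ℕ.* d < n → base n ≡ 0ℤ
    base-high {n} lt = select-no (n ℕ.≤? 2 ℕ.* d) (ℕ.<⇒≱ lt)

    2d<p : 2 ℕ.* d < p
    2d<p = ad≤6d (ℕ.m≤m+n 2 4)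

    base-supported : Supported (2 ℕ.* d) base
    base-supported n lt = base-high (ℕ.<-≤-trans lt (m%n≤m n p))

    C-base : C base ≋ 1ₛ
    C-base zero    = base-low z≤n
    C-base (suc m) = base-high (ℕ.<-≤-trans 2d<p (ℕ.m≤m+n p (m ℕ.* p)))

    û : ℕ → ℤ
    û = C u

    C-lo : C lo ≋ û
    C-lo m = select-yes (Low? (m ℕ.* p)) (subst (_≤ 2 ℕ.* d) (sym (residue-0 m)) z≤n)

    C-multiples : C multiples ≋ û
    C-multiples m = select-yes ((m ℕ.* p) mod-p ℕ.≟ 0) (residue-0 m)

    multiples-section : ∀ g m {s} → s < p → section s (multiples ⊛ g) m ≡ (û ⊛ section s g) m
    multiples-section g m {s} s<p = trans
      (⊛-section multiples g m s<p (λ i _ i≢0 → cong (_* g (m ℕ.* p ℕ.+ s ∸ i)) (select-no (i mod-p ℕ.≟ 0) i≢0)))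
      (⊛-cong {g = section s g} C-multiples (λ _ → refl) m)

    C-multiples-⊛ : ∀ g → C (multiples ⊛ g) ≋ û ⊛ C g
    C-multiples-⊛ g m = trans
      (C-⊛ multiples g m (λ i _ i≢0 → cong (_* g (m ℕ.* p ∸ i)) (select-no (i mod-p ℕ.≟ 0) i≢0)))
      (⊛-cong {g = C g} C-multiples (λ _ → refl) m)

    multiples-base : ∀ a r → r < p → (multiples ⊛ base) (a ℕ.* p ℕ.+ r) ≡ u (a ℕ.* p) * base r
    multiples-base a r r<p = trans (multiples-section base a r<p) (trans (⊛-comm û (section r base) a)
      (trans (cong (λ z → base r * û a + z) (ℤ[[t]].∑-zero a (λ i _ → cong (_* û (a ∸ suc i))
          (base-high (ℕ.<-≤-trans 2d<p (ℕ.≤-trans (ℕ.m≤m+n p (i ℕ.* p)) (ℕ.m≤m+n (suc i ℕ.* p) r)))))))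
        (trans (ℤ.+-identityʳ _) (ℤ.*-comm (base r) (û a)))))

    ρ-multiple : ∀ m → C ρ m ≡ 0ℤ
    ρ-multiple m = trans (cong₂ _-_ (C-lo m) (trans (cong (multiples ⊛ base) (sym (ℕ.+-identityʳ (m ℕ.* p))))
      (trans (multiples-base m 0 0<p) (trans (cong (û m *_) (base-low z≤n)) (ℤ.*-identityʳ (û m)))))) (ℤ.+-inverseʳ (û m))

    lo-at : ∀ a r → r < p → lo (a ℕ.* p ℕ.+ r) ≡ select (r ℕ.≤? 2 ℕ.* d) (u (a ℕ.* p ℕ.+ r))
    lo-at a r r<p = cong (λ s → select (s ℕ.≤? 2 ℕ.* d) (u (a ℕ.* p ℕ.+ r))) (residue a r<p)

    ρ-at : ∀ a r → r < p → ρ (a ℕ.* p ℕ.+ r) ≡ select (r ℕ.≤? 2 ℕ.* d) (u (a ℕ.* p ℕ.+ r)) - u (a ℕ.* p) * base r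
    ρ-at a r r<p = cong₂ _-_ (lo-at a r r<p) (multiples-base a r r<p)

    ρ≈0 : ∀ n → ρ n ≈[ 1 ] 0ℤ
    ρ≈0 n = ≈-trans (≈-reflexive (trans (cong ρ (n≡ n)) (ρ-at q r (mod-p< n)))) (cases (r ℕ.≤? 2 ℕ.* d))
      where
      q = n ℕ./ p
      r = n mod-p
      cases : (l : Dec (r ≤ 2 ℕ.* d)) → select l (u (q ℕ.* p ℕ.+ r)) - u (q ℕ.* p) * select l (u r) ≈[ 1 ] 0ℤ
      cases (yes _) = -‿≈0 (u-forward q r (mod-p< n))
      cases (no  _) = ≈-reflexive (identity (u (q ℕ.* p)))
        where
        identity : ∀ x → 0ℤ - x * 0ℤ ≡ 0ℤ
        identity = ℤ-solve

    ρ-supported : ∀ n → 2 ℕ.* d < n mod-p → ρ n ≡ 0ℤ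
    ρ-supported n lt = trans (cong ρ (n≡ n)) (trans (ρ-at (n ℕ./ p) (n mod-p) (mod-p< n))
      (trans (cong₂ (λ x y → x - u (n ℕ./ p ℕ.* p) * y) (select-no (n mod-p ℕ.≤? 2 ℕ.* d) (ℕ.<⇒≱ lt)) (base-high lt))
        (identity (u (n ℕ./ p ℕ.* p)))))
      where
      identity : ∀ x → 0ℤ - x * 0ℤ ≡ 0ℤ
      identity = ℤ-solve

    lo≋ : lo ≋ multiples ⊛ base ⊕ ρ
    lo≋ n = identity (lo n) ((multiples ⊛ base) n)
      where
      identity : ∀ x y → x ≡ y + (x - y)
      identity = ℤ-solve

    -- Residues up to 2d and up to 4d add without a carry, so at a multiple of p both are 0, where
    -- `ρ` vanishes exactly. If the residue on the side of g exceeds 4d, then `ρ` gives one power of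
    -- p and g gives three.
    C-ρ-⊛ : ∀ g → (∀ n → 4 ℕ.* d < n mod-p → g n ≈[ 3 ] 0ℤ) → ∀ m → C (ρ ⊛ g) m ≈[ 4 ] 0ℤ
    C-ρ-⊛ g g-high m = ≈-trans (C-⊛≈ 4 ρ g m vanish) (⊛-≈0 4 (C ρ) (C g) m
        (λ i _ → ≈-reflexive (cong (_* C g (m ∸ i)) (ρ-multiple i))))
      where
      vanish : ∀ i → i ≤ m ℕ.* p → ¬ i mod-p ≡ 0 → ρ i * g (m ℕ.* p ∸ i) ≈[ 4 ] 0ℤ
      vanish i i≤n i≢0 = cases (i mod-p ℕ.≤? 2 ℕ.* d) ((m ℕ.* p ∸ i) mod-p ℕ.≤? 4 ℕ.* d)
        where
        cases : Dec (i mod-p ≤ 2 ℕ.* d) → Dec ((m ℕ.* p ∸ i) mod-p ≤ 4 ℕ.* d) → ρ i * g (m ℕ.* p ∸ i) ≈[ 4 ] 0ℤ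
        cases (no i>) _        = ≈-reflexive (cong (_* g (m ℕ.* p ∸ i)) (ρ-supported i (ℕ.≰⇒> i>)))
        cases (yes _) (no >4d) = *-≈-zero 1 3 (ρ≈0 i) (g-high (m ℕ.* p ∸ i) (ℕ.≰⇒> >4d))
        cases (yes ≤2d) (yes ≤4d) = contradiction
          (ℕ.m+n≡0⇒m≡0 (i mod-p) (trans (sym (residue-+ i≤n (ℕ.≤-<-trans (ℕ.+-mono-≤ ≤2d ≤4d)
            (subst (_< p) (ℕ.*-distribʳ-+ d 2 4) (ad≤6d ℕ.≤-refl))))) (residue-0 m))) i≢0

    C-lo-⊛ : ∀ g → (∀ n → 4 ℕ.* d < n mod-p → g n ≈[ 3 ] 0ℤ) → ∀ m → C (lo ⊛ g) m ≈[ 4 ] (û ⊛ C (base ⊛ g)) m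
    C-lo-⊛ g g-high m = begin
      (lo ⊛ g) (m ℕ.* p)                                                ≡⟨ ⊛-cong {g = g} lo≋ (λ _ → refl) (m ℕ.* p) ⟩
      ((multiples ⊛ base ⊕ ρ) ⊛ g) (m ℕ.* p)                            ≡⟨ ⊛-distribʳ g (multiples ⊛ base) ρ (m ℕ.* p) ⟩
      ((multiples ⊛ base) ⊛ g) (m ℕ.* p) + (ρ ⊛ g) (m ℕ.* p)            ≈⟨ +-cong (≈-reflexive (trans (⊛-assoc multiples base g (m ℕ.* p))
                                                                             (C-multiples-⊛ (base ⊛ g) m))) (C-ρ-⊛ g g-high m) ⟩
      (û ⊛ C (base ⊛ g)) m + 0ℤ                                         ≡⟨ ℤ.+-identityʳ _ ⟩
      (û ⊛ C (base ⊛ g)) m                                              ∎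
      where open ≈-Reasoning 4

    -- Extraction after multiplication by base and base²

    ⊛-polynomial : ∀ g h L n → (∀ j → L < j → g j ≡ 0ℤ) → L ≤ n →
      (g ⊛ h) n ≡ g 0 * h n + ∑ L (λ j → g (suc j) * h (n ∸ suc j))
    ⊛-polynomial g h L n g≡0 L≤n = cong (λ z → g 0 * h n + z)
      (trans (cong (λ k → ∑ k t) (sym (ℕ.m+[n∸m]≡n L≤n)))
      (trans (ℤ[[t]].∑-split L (n ∸ L) t)
      (trans (cong (λ z → ∑ L t + z) (ℤ[[t]].∑-zero (n ∸ L) (λ i _ → cong (_* h (n ∸ suc (L ℕ.+ i))) (g≡0 (suc (L ℕ.+ i)) (s≤s (ℕ.m≤m+n L i))))))
        (ℤ.+-identityʳ (∑ L t)))))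
      where
      t : ℕ → ℤ
      t j = g (suc j) * h (n ∸ suc j)

    4d<p : 4 ℕ.* d < p
    4d<p = ad≤6d (ℕ.m≤m+n 4 2)

    4d≤mp : ∀ m → 4 ℕ.* d ≤ suc m ℕ.* p
    4d≤mp m = ℕ.≤-trans (ℕ.<⇒≤ 4d<p) (ℕ.m≤m+n p (m ℕ.* p))

    2d≤4d : 2 ℕ.* d ≤ 4 ℕ.* d
    2d≤4d = ℕ.*-monoˡ-≤ d (ℕ.m≤m+n 2 2)

    back-index : ∀ m j → suc j ≤ 4 ℕ.* d → (suc m ℕ.* p ∸ suc j) ℕ.+ suc j ≡ suc m ℕ.* p
    back-index m j j<4d = ℕ.m∸n+n≡m (ℕ.≤-trans j<4d (4d≤mp m))

    v-tail : ∀ (c : ℕ → ℤ) L → L ≤ 2 ℕ.* d →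
      ∃[ k ] ∀ m → ∑ L (λ j → c j * v (suc m ℕ.* p ∸ suc j)) ≈[ 4 ] 𝕡 ^ 3 * (k * v-weight (suc m))
    v-tail c zero    _   = 0ℤ , λ m → ≈-reflexive (identity (𝕡 ^ 3) (v-weight (suc m)))
      where
      identity : ∀ q w → 0ℤ ≡ q * (0ℤ * w)
      identity = ℤ-solve
    v-tail c (suc L) L<2d =
      let k , ih = v-tail c L (ℕ.<⇒≤ L<2d)
          l , vL = v-back L L<2d
      in k + c L * l , λ m → ≈-trans (≈-reflexive (ℤ[[t]].∑-snoc L (λ j → c j * v (suc m ℕ.* p ∸ suc j))))
        (≈-trans (+-cong (ih m) (*-congˡ (c L) (vL (suc m) _ (back-index m L (ℕ.≤-trans L<2d 2d≤4d)))))
          (≈-reflexive (identity (𝕡 ^ 3) (v-weight (suc m)) k l (c L))))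
      where
      identity : ∀ q w k l c → q * (k * w) + c * (q * (l * w)) ≡ q * ((k + c * l) * w)
      identity = ℤ-solve

    u-tail : ∀ (c : ℕ → ℤ) L → L ≤ 4 ℕ.* d →
      ∃[ k₀ ] ∃[ k₁ ] ∀ m → ∑ L (λ j → c j * u (suc m ℕ.* p ∸ suc j)) ≈[ 4 ] 𝕡 ^ 2 * (u-weight (suc m) * (k₀ + k₁ * (+ suc m * 𝕡)))
    u-tail c zero    _   = 0ℤ , 0ℤ , λ m → ≈-reflexive (identity (𝕡 ^ 2) (u-weight (suc m)) (+ suc m * 𝕡))
      where
      identity : ∀ q w y → 0ℤ ≡ q * (w * (0ℤ + 0ℤ * y))
      identity = ℤ-solve
    u-tail c (suc L) L<4d =
      let k₀ , k₁ , ih = u-tail c L (ℕ.<⇒≤ L<4d)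
          l₀ , l₁ , uL = u-back L L<4d
      in k₀ + c L * l₀ , k₁ + c L * l₁ , λ m → ≈-trans (≈-reflexive (ℤ[[t]].∑-snoc L (λ j → c j * u (suc m ℕ.* p ∸ suc j))))
        (≈-trans (+-cong (ih m) (*-congˡ (c L) (uL (suc m) _ (back-index m L L<4d))))
          (≈-reflexive (identity (𝕡 ^ 2) (u-weight (suc m)) (+ suc m * 𝕡) k₀ k₁ l₀ l₁ (c L))))
      where
      identity : ∀ q w y k₀ k₁ l₀ l₁ c → q * (w * (k₀ + k₁ * y)) + c * (q * (w * (l₀ + l₁ * y))) ≡
        q * (w * ((k₀ + c * l₀) + (k₁ + c * l₁) * y))
      identity = ℤ-solve

    -- Two sources: the constant term 1 of `base` meets v (m p) with its correction of order 𝕡², and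
    -- the other terms of `base` meet the values of v just below m p, of order 𝕡³.
    κ : ℤ
    κ = proj₁ v-expansion + 𝕡 * proj₁ (v-tail (base ∘ suc) (2 ℕ.* d) ℕ.≤-refl)

    e : ℕ → ℤ
    e m = 𝕡 ^ 2 * (κ * v-weight m)

    C-base-v : ∀ m → C (base ⊛ v) m ≈[ 4 ] v m + e m
    C-base-v zero    = ≈-reflexive (identity (𝕡 ^ 2) κ)
      where
      identity : ∀ q k → 1ℤ * 1ℤ + 0ℤ ≡ 1ℤ + q * (k * (0ℤ * (0ℤ * (0ℤ * 1ℤ))))
      identity = ℤ-solve
    C-base-v (suc m) = ≈-trans (≈-reflexive (⊛-polynomial base v (2 ℕ.* d) (suc m ℕ.* p) (λ j → base-high) (ℕ.≤-trans 2d≤4d (4d≤mp m))))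
      (≈-trans (+-cong (*-congˡ 1ℤ (proj₂ v-expansion (suc m))) (proj₂ (v-tail (base ∘ suc) (2 ℕ.* d) ℕ.≤-refl) m))
        (≈-reflexive (identity (v (suc m)) 𝕡 (proj₁ v-expansion) (proj₁ (v-tail (base ∘ suc) (2 ℕ.* d) ℕ.≤-refl)) (v-weight (suc m)))))
      where
      identity : ∀ x q c k w → 1ℤ * (x + (q * (q * 1ℤ)) * (c * w)) + (q * (q * (q * 1ℤ))) * (k * w) ≡ x + (q * (q * 1ℤ)) * ((c + q * k) * w)
      identity = ℤ-solve

    base² : ℕ → ℤ
    base² = base ⊛ base

    base²-high : ∀ j → 4 ℕ.* d < j → base² j ≡ 0ℤ
    base²-high j 4d<j = ℤ[[t]].∑-zero (suc j) (λ i _ → cases i (i ℕ.≤? 2 ℕ.* d))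
      where
      cases : ∀ i → Dec (i ≤ 2 ℕ.* d) → base i * base (j ∸ i) ≡ 0ℤ
      cases i (no i>)   = cong (_* base (j ∸ i)) (base-high (ℕ.≰⇒> i>))
      cases i (yes i≤) = trans (cong (base i *_) (base-high (ℕ.+-cancelˡ-< (2 ℕ.* d) (2 ℕ.* d) (j ∸ i)
        (ℕ.<-≤-trans (subst (_< j) (ℕ.*-distribʳ-+ d 2 2) 4d<j)
          (ℕ.≤-trans (ℕ.m≤n+m∸n j i) (ℕ.+-monoˡ-≤ (j ∸ i) i≤)))))) (ℤ.*-zeroʳ (base i))

    B : ℕ → ℤ
    B = C (base² ⊛ u)

    private
      tail = u-tail (base² ∘ suc) (4 ℕ.* d) ℕ.≤-refl
      k₀ = proj₁ tail
      k₁ = proj₁ (proj₂ tail)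

    B-expansion : ∀ m → B (suc m) ≈[ 4 ] û (suc m) + 𝕡 ^ 2 * (u-weight (suc m) * (k₀ + k₁ * (+ suc m * 𝕡)))
    B-expansion m = ≈-trans (≈-reflexive (⊛-polynomial base² u (4 ℕ.* d) (suc m ℕ.* p) base²-high (4d≤mp m)))
      (+-cong (≈-reflexive (ℤ.*-identityˡ (û (suc m)))) (proj₂ (proj₂ tail) m))

    β η : ℕ → ℤ
    β m = B m - u m
    η m = û m - u m

    η≈0 : ∀ m → η m ≈[ 2 ] 0ℤ
    η≈0 m = -‿≈0 (u-multiple≈ m)

    β≈0 : ∀ m → β m ≈[ 2 ] 0ℤ
    β≈0 zero    = ≈-refl
    β≈0 (suc m) = -‿≈0 (≈-trans (≈-weaken 2 (B-expansion m)) (≈-by (≈0-+ (η≈0 (suc m))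
        (≈0-*ˡ (u-weight (suc m) * (k₀ + k₁ * (+ suc m * 𝕡))) (𝕡^≈0 2)))
      (identity (û (suc m)) (u (suc m)) (𝕡 ^ 2) (u-weight (suc m) * (k₀ + k₁ * (+ suc m * 𝕡))))))
      where
      identity : ∀ x y q w → x + q * w ≡ y + ((x - y) + w * q)
      identity = ℤ-solve

    -- The coefficients of P. They are those of `6σ`, coming from û - u, and the tail of
    -- `B-expansion` times 6 D₀ is added in degrees 2 and 3.
    x₁ x₂ x₃ : ℤ
    x₁ = + 6 * ε-series 0 - + 3 * ε-series 1 * 𝕡 + ε-series 2 * (𝕡 * 𝕡)
    x₂ = (+ 3 * ε-series 1 * 𝕡 - + 3 * ε-series 2 * (𝕡 * 𝕡)) + + 6 * D₀ * (𝕡 * 𝕡) * k₀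
    x₃ = + 2 * ε-series 2 * (𝕡 * 𝕡) + + 6 * D₀ * (𝕡 * 𝕡) * (k₁ * 𝕡)

    cubicAt : ℤ → ℤ → ℤ → ℤ → ℤ
    cubicAt x y z m = m * x + (m * m) * y + (m * (m * m)) * z

    6D₀β : ∀ m → + 6 * D₀ * β m ≈[ 4 ] u m * cubicAt x₁ x₂ x₃ (+ m)
    6D₀β zero    = ≈-reflexive (identity D₀ x₁ x₂ x₃)
      where
      identity : ∀ D x y z → + 6 * D * 0ℤ ≡ 1ℤ * (0ℤ * x + (0ℤ * 0ℤ) * y + (0ℤ * (0ℤ * 0ℤ)) * z)
      identity = ℤ-solve
    6D₀β (suc m) = begin
      + 6 * D₀ * (B (suc m) - u n)
        ≈⟨ *-congˡ (+ 6 * D₀) (+-cong (B-expansion m) (≈-refl {x = - u n})) ⟩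
      + 6 * D₀ * ((û n + 𝕡 ^ 2 * (u-weight n * (k₀ + k₁ * (+ n * 𝕡)))) - u n)
        ≡⟨ expand D₀ (û n) (u n) 𝕡 (+ n) k₀ k₁ ⟩
      + 6 * (D₀ * (û n - u n)) + u n * rest
        ≈⟨ +-cong (*-congˡ (+ 6) (u-expansion n)) (≈-refl {x = u n * rest}) ⟩
      + 6 * (u n * σ n) + u n * rest
        ≡⟨ gather (u n) (σ n) rest ⟩
      u n * (+ 6 * σ n + rest)
        ≡⟨ cong (λ z → u n * (z + rest)) (6σ n) ⟩
      u n * ((+ n * (+ 6 * ε-series 0 - + 3 * ε-series 1 * 𝕡 + ε-series 2 * (𝕡 * 𝕡)) +
        (+ n * + n) * (+ 3 * ε-series 1 * 𝕡 - + 3 * ε-series 2 * (𝕡 * 𝕡)) + (+ n * (+ n * + n)) * (+ 2 * ε-series 2 * (𝕡 * 𝕡))) + rest)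
        ≡⟨ cong (u n *_) (collect (+ n) x₁ (+ 3 * ε-series 1 * 𝕡 - + 3 * ε-series 2 * (𝕡 * 𝕡)) (+ 2 * ε-series 2 * (𝕡 * 𝕡)) (+ 6 * D₀ * (𝕡 * 𝕡)) k₀ (k₁ * 𝕡)) ⟩
      u n * cubicAt x₁ x₂ x₃ (+ n) ∎
      where
      open ≈-Reasoning 4
      n = suc m
      rest = (+ n * + n) * (+ 6 * D₀ * (𝕡 * 𝕡) * k₀) + (+ n * (+ n * + n)) * (+ 6 * D₀ * (𝕡 * 𝕡) * (k₁ * 𝕡))
      expand : ∀ D x y q n k l → + 6 * D * ((x + (q * (q * 1ℤ)) * ((n * (n * y)) * (k + l * (n * q)))) - y) ≡
        + 6 * (D * (x - y)) + y * ((n * n) * (+ 6 * D * (q * q) * k) + (n * (n * n)) * (+ 6 * D * (q * q) * (l * q)))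
      expand = ℤ-solve
      gather : ∀ y s r → + 6 * (y * s) + y * r ≡ y * (+ 6 * s + r)
      gather = ℤ-solve
      collect : ∀ n x y z D k l → (n * x + (n * n) * y + (n * (n * n)) * z) + ((n * n) * (D * k) + (n * (n * n)) * (D * l)) ≡
        n * x + (n * n) * (y + D * k) + (n * (n * n)) * (z + D * l)
      collect = ℤ-solve

    -- The second evaluation of e

    ⊛-≈0ʳ : ∀ k f g → (∀ n → g n ≈[ k ] 0ℤ) → ∀ n → (f ⊛ g) n ≈[ k ] 0ℤ
    ⊛-≈0ʳ k f g g≈0 n = ⊛-≈0 k f g n (λ i _ → ≈0-*ˡ (f i) (g≈0 (n ∸ i)))

    ⊛-≈0-+ : ∀ j k f g → (∀ n → f n ≈[ j ] 0ℤ) → (∀ n → g n ≈[ k ] 0ℤ) → ∀ n → (f ⊛ g) n ≈[ j ℕ.+ k ] 0ℤ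
    ⊛-≈0-+ j k f g f≈0 g≈0 n = ⊛-≈0 (j ℕ.+ k) f g n (λ i _ → *-≈-zero j k (f≈0 i) (g≈0 (n ∸ i)))

    hi²≈0 : ∀ n → (hi ⊛ hi) n ≈[ 4 ] 0ℤ
    hi²≈0 = ⊛-≈0-+ 2 2 hi hi hi≈0 hi≈0

    2d+2d<p : 2 ℕ.* d ℕ.+ 2 ℕ.* d < p
    2d+2d<p = subst (_< p) (ℕ.*-distribʳ-+ d 2 2) 4d<p

    2d+4d<p : 2 ℕ.* d ℕ.+ (2 ℕ.* d ℕ.+ 2 ℕ.* d) < p
    2d+4d<p = subst (_< p) (trans (ℕ.*-distribʳ-+ d 2 4) (cong (2 ℕ.* d ℕ.+_) (ℕ.*-distribʳ-+ d 2 2))) (ad≤6d ℕ.≤-refl)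

    lo²-supported : Supported (2 ℕ.* d ℕ.+ 2 ℕ.* d) (lo ⊛ lo)
    lo²-supported = ⊛-supported 2d+2d<p lo-supported lo-supported

    C-base-⊛ : ∀ f → Supported (2 ℕ.* d ℕ.+ 2 ℕ.* d) f → C (base ⊛ f) ≋ C f
    C-base-⊛ f sf m = trans (C-⊛-supported 2d+4d<p base-supported sf m)
      (trans (⊛-cong {g = C f} C-base (λ _ → refl) m) (⊛-identityˡ (C f) m))

    C-lo² : C (lo ⊛ lo) ≋ û ⊛ û
    C-lo² m = trans (C-⊛-supported 2d+2d<p lo-supported lo-supported m) (⊛-cong C-lo C-lo m)

    -- In u² = lo² + 2 lo hi + hi² all the other terms vanish modulo p³ at these residues: lo² by
    -- its support, hi² because hi is divisible by p², and u² = v by `v-high`.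
    lo⊛hi-high : ∀ n → 4 ℕ.* d < n mod-p → (lo ⊛ hi) n ≈[ 3 ] 0ℤ
    lo⊛hi-high n 4d<n = Unit-cancel-0 unit-2 (begin
      + 2 * (lo ⊛ hi) n                                     ≡⟨ double ((lo ⊛ hi) n) ⟩
      0ℤ + ((lo ⊛ hi) n + (lo ⊛ hi) n) + 0ℤ                 ≈⟨ +-cong (+-cong (≈-reflexive (lo²-supported n (subst (_< n mod-p) (ℕ.*-distribʳ-+ d 2 2) 4d<n)))
                                                                 (≈-refl {x = (lo ⊛ hi) n + (lo ⊛ hi) n})) (≈-weaken 1 (hi²≈0 n)) ⟨
      (lo ⊛ lo) n + ((lo ⊛ hi) n + (lo ⊛ hi) n) + (hi ⊛ hi) n ≡⟨ square n ⟨
      ((lo ⊕ hi) ⊛ (lo ⊕ hi)) n                             ≡⟨ ⊛-cong u≋ u≋ n ⟨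
      (u ⊛ u) n                                             ≡⟨ clausen n ⟩
      v n                                                   ≈⟨ v-high n 4d<n ⟩
      0ℤ                                                    ∎)
      where
      open ≈-Reasoning 3
      double : ∀ x → + 2 * x ≡ 0ℤ + (x + x) + 0ℤ
      double = ℤ-solve
      square : (lo ⊕ hi) ⊛ (lo ⊕ hi) ≋ lo ⊛ lo ⊕ (lo ⊛ hi ⊕ lo ⊛ hi) ⊕ hi ⊛ hi
      square = solve 2 (λ a b → (a :+ b) :* (a :+ b) := a :* a :+ (a :* b :+ a :* b) :+ b :* b) (λ _ → refl) lo hi

    -- As lo ≡ multiples ⊛ base modulo p and hi is divisible by p², `lo⊛hi-high` carries over to
    -- multiples ⊛ (base ⊛ hi). On each section this is a convolution with `û`, which cancels
    -- because its constant term is 1.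
    base⊛hi-high : ∀ n → 4 ℕ.* d < n mod-p → (base ⊛ hi) n ≈[ 3 ] 0ℤ
    base⊛hi-high n 4d<n = ≈-trans (≈-reflexive (cong (base ⊛ hi) (n≡ n)))
      (cancel≈0 3 û (section s (base ⊛ hi)) refl (λ m → begin
        (û ⊛ section s (base ⊛ hi)) m               ≡⟨ multiples-section (base ⊛ hi) m s<p ⟨
        (multiples ⊛ (base ⊛ hi)) (k m)             ≡⟨ ⊛-assoc multiples base hi (k m) ⟨
        ((multiples ⊛ base) ⊛ hi) (k m)             ≡⟨ ℤ.+-identityʳ _ ⟨
        ((multiples ⊛ base) ⊛ hi) (k m) + 0ℤ        ≈⟨ +-cong (≈-refl {x = ((multiples ⊛ base) ⊛ hi) (k m)}) (⊛-≈0-+ 1 2 ρ hi ρ≈0 hi≈0 (k m)) ⟨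
        ((multiples ⊛ base) ⊛ hi) (k m) + (ρ ⊛ hi) (k m) ≡⟨ ⊛-distribʳ hi (multiples ⊛ base) ρ (k m) ⟨
        ((multiples ⊛ base ⊕ ρ) ⊛ hi) (k m)         ≡⟨ ⊛-cong {g = hi} lo≋ (λ _ → refl) (k m) ⟨
        (lo ⊛ hi) (k m)                             ≈⟨ lo⊛hi-high (k m) (subst (4 ℕ.* d <_) (sym (residue m s<p)) 4d<n) ⟩
        0ℤ                                          ∎) (n ℕ./ p))
      where
      open ≈-Reasoning 3
      s = n mod-p
      s<p = mod-p< n
      k : ℕ → ℕ
      k m = m ℕ.* p ℕ.+ s

    G : ℕ → ℤ
    G = C (base ⊛ (base ⊛ hi))

    -- Both sides are `B`. Splitting u in base² ⊛ u, the low part base² ⊛ lo has residues adding up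
    -- to at most 6d, so extraction gives û exactly.
    û⊕G≋u⊕β : û ⊕ G ≋ u ⊕ β
    û⊕G≋u⊕β m = sym (trans (identity (u m) (B m)) (trans (expand (m ℕ.* p)) (cong (_+ G m)
        (trans (C-base-⊛ (base ⊛ lo) (⊛-supported 2d+2d<p base-supported lo-supported) m)
          (trans (C-⊛-supported 2d+2d<p base-supported lo-supported m)
            (trans (⊛-cong C-base C-lo m) (⊛-identityˡ û m)))))))
      where
      identity : ∀ x y → x + (y - x) ≡ y
      identity = ℤ-solve
      expand : base² ⊛ u ≋ base ⊛ (base ⊛ lo) ⊕ base ⊛ (base ⊛ hi)
      expand n = trans (⊛-cong {f = base²} (λ _ → refl) u≋ n)
        (solve 3 (λ c a b → (c :* c) :* (a :+ b) := c :* (c :* a) :+ c :* (c :* b)) (λ _ → refl) base lo hi n)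

    u≋û : û ≋ u ⊕ η
    u≋û m = identity (û m) (u m)
      where
      identity : ∀ x y → x ≡ y + (x - y)
      identity = ℤ-solve

    -- Splitting u in base ⊛ u² gives û² + 2 û G = 2 û (û + G) - û² after extraction. With û = u + η
    -- and û + G = u + β this is u² + 2 u β + 2 η β - η², and the last two terms vanish modulo p⁴.
    e≈2uβ : ∀ m → e m ≈[ 4 ] (u ⊛ β) m + (u ⊛ β) m
    e≈2uβ m = ≈-trans (≈-reflexive (isolate (e m) X S)) (≈-trans (+-cong total (≈-refl {x = - (S + X)})) (≈-reflexive (cancel X S Y)))
      where
      open ≈-Reasoning 4
      X = (u ⊛ u) m
      S = (û ⊛ û) m
      Y = (u ⊛ β) m
      isolate : ∀ e X S → e ≡ ((X + e) + S) + - (S + X)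
      isolate = ℤ-solve
      cancel : ∀ X S Y → (X + S + (Y + Y)) + - (S + X) ≡ Y + Y
      cancel = ℤ-solve
      -- The solver for series knows only semirings, so û² is added on both sides instead of being
      -- subtracted.
      total : (X + e m) + S ≈[ 4 ] X + S + (Y + Y)
      total = begin
        (X + e m) + S
          ≡⟨ cong (λ z → (z + e m) + S) (clausen m) ⟩
        (v m + e m) + S
          ≈⟨ +-cong (C-base-v m) (≈-refl {x = S}) ⟨
        (base ⊛ v) (m ℕ.* p) + S
          ≡⟨ cong (_+ S) (trans (⊛-cong {f = base} (λ _ → refl) (λ i → sym (clausen i)) (m ℕ.* p))
               (trans (⊛-cong {f = base} (λ _ → refl) (⊛-cong u≋ u≋) (m ℕ.* p)) (split (m ℕ.* p)))) ⟩
        (C (base ⊛ (lo ⊛ lo)) m + (C (lo ⊛ (base ⊛ hi)) m + C (lo ⊛ (base ⊛ hi)) m) + C (base ⊛ (hi ⊛ hi)) m) + S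
          ≈⟨ +-cong (+-cong (+-cong (≈-reflexive (trans (C-base-⊛ (lo ⊛ lo) lo²-supported m) (C-lo² m))) (+-cong low low))
               (⊛-≈0ʳ 4 base (hi ⊛ hi) hi²≈0 (m ℕ.* p))) (≈-refl {x = S}) ⟩
        (S + ((û ⊛ G) m + (û ⊛ G) m) + 0ℤ) + S
          ≡⟨ trans (rearrange S ((û ⊛ G) m)) (sym (distribute m)) ⟩
        (û ⊛ (û ⊕ G)) m + (û ⊛ (û ⊕ G)) m
          ≡⟨ cong (λ z → z + z) (⊛-cong u≋û û⊕G≋u⊕β m) ⟩
        ((u ⊕ η) ⊛ (u ⊕ β)) m + ((u ⊕ η) ⊛ (u ⊕ β)) m
          ≡⟨ ℤ.+-identityʳ _ ⟨
        (((u ⊕ η) ⊛ (u ⊕ β)) m + ((u ⊕ η) ⊛ (u ⊕ β)) m) + 0ℤ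
          ≈⟨ +-cong (≈-refl {x = ((u ⊕ η) ⊛ (u ⊕ β)) m + ((u ⊕ η) ⊛ (u ⊕ β)) m}) (⊛-≈0-+ 2 2 η η η≈0 η≈0 m) ⟨
        (((u ⊕ η) ⊛ (u ⊕ β)) m + ((u ⊕ η) ⊛ (u ⊕ β)) m) + (η ⊛ η) m
          ≡⟨ expand m ⟩
        ((X + ((u ⊕ η) ⊛ (u ⊕ η)) m) + (Y + Y)) + ((η ⊛ β) m + (η ⊛ β) m)
          ≈⟨ +-cong (≈-reflexive (cong (λ z → (X + z) + (Y + Y)) (sym (⊛-cong u≋û u≋û m)))) (≈0-+ ηβ≈0 ηβ≈0) ⟩
        (X + S + (Y + Y)) + 0ℤ
          ≡⟨ ℤ.+-identityʳ _ ⟩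
        X + S + (Y + Y) ∎
        where
        low = C-lo-⊛ (base ⊛ hi) base⊛hi-high m
        ηβ≈0 = ⊛-≈0-+ 2 2 η β η≈0 β≈0 m
        split : base ⊛ ((lo ⊕ hi) ⊛ (lo ⊕ hi)) ≋
          base ⊛ (lo ⊛ lo) ⊕ (lo ⊛ (base ⊛ hi) ⊕ lo ⊛ (base ⊛ hi)) ⊕ base ⊛ (hi ⊛ hi)
        split = solve 3 (λ c a b → c :* ((a :+ b) :* (a :+ b)) := c :* (a :* a) :+ (a :* (c :* b) :+ a :* (c :* b)) :+ c :* (b :* b))
          (λ _ → refl) base lo hi
        rearrange : ∀ S T → (S + (T + T) + 0ℤ) + S ≡ (S + T) + (S + T)
        rearrange = ℤ-solve
        distribute : û ⊛ (û ⊕ G) ⊕ û ⊛ (û ⊕ G) ≋ (û ⊛ û ⊕ û ⊛ G) ⊕ (û ⊛ û ⊕ û ⊛ G)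
        distribute = solve 2 (λ a b → a :* (a :+ b) :+ a :* (a :+ b) := (a :* a :+ a :* b) :+ (a :* a :+ a :* b)) (λ _ → refl) û G
        expand : ((u ⊕ η) ⊛ (u ⊕ β) ⊕ (u ⊕ η) ⊛ (u ⊕ β)) ⊕ η ⊛ η ≋
          ((u ⊛ u ⊕ (u ⊕ η) ⊛ (u ⊕ η)) ⊕ (u ⊛ β ⊕ u ⊛ β)) ⊕ (η ⊛ β ⊕ η ⊛ β)
        expand = solve 3 (λ x y z → ((x :+ y) :* (x :+ z) :+ (x :+ y) :* (x :+ z)) :+ y :* y :=
          ((x :* x :+ (x :+ y) :* (x :+ y)) :+ (x :* z :+ x :* z)) :+ (y :* z :+ y :* z)) (λ _ → refl) u η β

    -- Elimination of the unknown constants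

    Λ : ℤ
    Λ = + 6 * D₀ * (𝕡 ^ 2 * κ)

    γ : ℕ → ℤ
    γ n = u n * cubicAt x₁ x₂ x₃ (+ n)

    -- For each m this is a linear relation between the constant `Λ` and the values P(1), ..., P(m),
    -- with explicit integer coefficients.
    Λ-relation : ∀ m → Λ * v-weight m ≈[ 4 ] (u ⊛ γ) m + (u ⊛ γ) m
    Λ-relation m = begin
      Λ * v-weight m                                     ≡⟨ regroup (+ 6 * D₀) (𝕡 ^ 2) κ (v-weight m) ⟩
      + 6 * D₀ * e m                                     ≈⟨ *-congˡ (+ 6 * D₀) (e≈2uβ m) ⟩
      + 6 * D₀ * ((u ⊛ β) m + (u ⊛ β) m)                 ≡⟨ ℤ.*-distribˡ-+ (+ 6 * D₀) ((u ⊛ β) m) ((u ⊛ β) m) ⟩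
      + 6 * D₀ * (u ⊛ β) m + + 6 * D₀ * (u ⊛ β) m        ≈⟨ +-cong scaled scaled ⟩
      (u ⊛ γ) m + (u ⊛ γ) m                              ∎
      where
      open ≈-Reasoning 4
      regroup : ∀ a q k w → (a * (q * k)) * w ≡ a * (q * (k * w))
      regroup = ℤ-solve
      scaled : + 6 * D₀ * (u ⊛ β) m ≈[ 4 ] (u ⊛ γ) m
      scaled = ≈-trans (≈-reflexive (trans (cong (+ 6 * D₀ *_) (⊛-comm u β m)) (trans (sym (⊛-scaleˡ (+ 6 * D₀) β u m))
          (⊛-comm (λ n → + 6 * D₀ * β n) u m))))
        (⊛-cong≈ 4 {u} {u} {λ n → + 6 * D₀ * β n} {γ} m (λ _ → ≈-refl) 6D₀β)

    -- The multipliers μ₁, μ₂, μ₃ turn the relations for m = 1, 2, 3, 4 into a multiple of the fourth difference of a cubic,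
    -- while keeping a unit multiple of Λ. They are opaque because a large literal times a variable normalises in unary.
    opaque
      μ₁ μ₂ μ₃ μ₄ μ₀ : ℤ
      μ₁ = + 832710
      μ₂ = + 27429
      μ₃ = + 291
      μ₄  = + 2178540
      μ₀  = + 262440

      -- The prime factors 2, 3 and 5 are all below p ≥ 7.
      μ₀-unit : Unit μ₀
      μ₀-unit = subst Unit μ₀≡ (Unit-* (Unit-^ 3 unit-2) (Unit-* (Unit-^ 8 unit-3) unit-5))
        where
        μ₀≡ : (+ 2) ^ 3 * ((+ 3) ^ 8 * + 5) ≡ μ₀
        μ₀≡ = refl

      weights : μ₁ * v-weight 1 - μ₂ * v-weight 2 + μ₃ * v-weight 3 - v-weight 4 ≡ μ₀
      weights = refl

      -- The system is triangular. With the relation for m = 4 taken with weight -1, P(4) fixes μ₄ =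
      -- 2 u₄; demanding 4 μ₄, -6 μ₄ and 4 μ₄ in front of P(3), P(2) and P(1) then determines μ₃ =
      -- 291, μ₂ = 27429 and μ₁ = 832710 in turn.
      coefficients : ∀ {a₁ a₂ a₃ a₄} → a₁ ≡ + 6 → a₂ ≡ + 252 → a₃ ≡ + 15288 → a₄ ≡ + 1089270 →
        (μ₁ * (a₁ + a₁) - μ₂ * (a₁ * a₁ + a₁ * a₁) + μ₃ * (a₁ * a₂ + a₁ * a₂) - (a₁ * a₃ + a₁ * a₃) ≡ + 4 * μ₄) ×
        (- (μ₂ * (a₂ + a₂)) + μ₃ * (a₁ * a₂ + a₁ * a₂) - (a₂ * a₂ + a₂ * a₂) ≡ - (+ 6 * μ₄)) ×
        (μ₃ * (a₃ + a₃) - (a₁ * a₃ + a₁ * a₃) ≡ + 4 * μ₄) ×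
        (- (a₄ + a₄) ≡ - μ₄)
      coefficients refl refl refl refl = refl , refl , refl , refl

    -- Stated for variables, so that the ring solver meets no large literals.
    expand-relations : ∀ {a₀} a₁ a₂ a₃ a₄ {g₀ g₁ g₂ g₃ g₄} q₁ q₂ q₃ q₄ μ₁ μ₂ μ₃ → a₀ ≡ + 1 →
      g₀ ≡ 0ℤ → g₁ ≡ a₁ * q₁ → g₂ ≡ a₂ * q₂ → g₃ ≡ a₃ * q₃ → g₄ ≡ a₄ * q₄ →
      let c₁ = a₀ * g₁ + (a₁ * g₀ + 0ℤ)
          c₂ = a₀ * g₂ + (a₁ * g₁ + (a₂ * g₀ + 0ℤ))
          c₃ = a₀ * g₃ + (a₁ * g₂ + (a₂ * g₁ + (a₃ * g₀ + 0ℤ)))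
          c₄ = a₀ * g₄ + (a₁ * g₃ + (a₂ * g₂ + (a₃ * g₁ + (a₄ * g₀ + 0ℤ))))
      in μ₁ * (c₁ + c₁) - μ₂ * (c₂ + c₂) + μ₃ * (c₃ + c₃) - (c₄ + c₄) ≡
        (μ₁ * (a₁ + a₁) - μ₂ * (a₁ * a₁ + a₁ * a₁) + μ₃ * (a₁ * a₂ + a₁ * a₂) - (a₁ * a₃ + a₁ * a₃)) * q₁ +
        (- (μ₂ * (a₂ + a₂)) + μ₃ * (a₁ * a₂ + a₁ * a₂) - (a₂ * a₂ + a₂ * a₂)) * q₂ +
        (μ₃ * (a₃ + a₃) - (a₁ * a₃ + a₁ * a₃)) * q₃ + (- (a₄ + a₄)) * q₄
    expand-relations a₁ a₂ a₃ a₄ q₁ q₂ q₃ q₄ μ₁ μ₂ μ₃ refl refl refl refl refl refl = identity a₁ a₂ a₃ a₄ q₁ q₂ q₃ q₄ μ₁ μ₂ μ₃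
      where
      identity : ∀ a₁ a₂ a₃ a₄ q₁ q₂ q₃ q₄ μ₁ μ₂ μ₃ →
        μ₁ * ((+ 1 * (a₁ * q₁) + (a₁ * 0ℤ + 0ℤ)) + (+ 1 * (a₁ * q₁) + (a₁ * 0ℤ + 0ℤ))) -
        μ₂ * ((+ 1 * (a₂ * q₂) + (a₁ * (a₁ * q₁) + (a₂ * 0ℤ + 0ℤ))) + (+ 1 * (a₂ * q₂) + (a₁ * (a₁ * q₁) + (a₂ * 0ℤ + 0ℤ)))) +
        μ₃ * ((+ 1 * (a₃ * q₃) + (a₁ * (a₂ * q₂) + (a₂ * (a₁ * q₁) + (a₃ * 0ℤ + 0ℤ)))) +
              (+ 1 * (a₃ * q₃) + (a₁ * (a₂ * q₂) + (a₂ * (a₁ * q₁) + (a₃ * 0ℤ + 0ℤ))))) -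
        ((+ 1 * (a₄ * q₄) + (a₁ * (a₃ * q₃) + (a₂ * (a₂ * q₂) + (a₃ * (a₁ * q₁) + (a₄ * 0ℤ + 0ℤ))))) +
         (+ 1 * (a₄ * q₄) + (a₁ * (a₃ * q₃) + (a₂ * (a₂ * q₂) + (a₃ * (a₁ * q₁) + (a₄ * 0ℤ + 0ℤ)))))) ≡
        (μ₁ * (a₁ + a₁) - μ₂ * (a₁ * a₁ + a₁ * a₁) + μ₃ * (a₁ * a₂ + a₁ * a₂) - (a₁ * a₃ + a₁ * a₃)) * q₁ +
        (- (μ₂ * (a₂ + a₂)) + μ₃ * (a₁ * a₂ + a₁ * a₂) - (a₂ * a₂ + a₂ * a₂)) * q₂ +
        (μ₃ * (a₃ + a₃) - (a₁ * a₃ + a₁ * a₃)) * q₃ + (- (a₄ + a₄)) * q₄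
      identity = ℤ-solve

    -- The weights 4, -6, 4, -1 are the fourth difference with its sign reversed; the missing value
    -- is P(0) = 0.
    fourth-difference : ∀ {C₁ C₂ C₃ C₄} m x y z → C₁ ≡ + 4 * m → C₂ ≡ - (+ 6 * m) → C₃ ≡ + 4 * m → C₄ ≡ - m →
      C₁ * cubicAt x y z (+ 1) + C₂ * cubicAt x y z (+ 2) + C₃ * cubicAt x y z (+ 3) + C₄ * cubicAt x y z (+ 4) ≡ 0ℤ
    fourth-difference m x y z refl refl refl refl = identity m x y z
      where
      identity : ∀ m x y z →
        (+ 4 * m) * (+ 1 * x + (+ 1 * + 1) * y + (+ 1 * (+ 1 * + 1)) * z) +
        (- (+ 6 * m)) * (+ 2 * x + (+ 2 * + 2) * y + (+ 2 * (+ 2 * + 2)) * z) +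
        (+ 4 * m) * (+ 3 * x + (+ 3 * + 3) * y + (+ 3 * (+ 3 * + 3)) * z) +
        (- m) * (+ 4 * x + (+ 4 * + 4) * y + (+ 4 * (+ 4 * + 4)) * z) ≡ 0ℤ
      identity = ℤ-solve

    Λ≈0 : Λ ≈[ 4 ] 0ℤ
    Λ≈0 = Unit-cancel-0 μ₀-unit (begin
      μ₀ * Λ
        ≡⟨ cong (_* Λ) weights ⟨
      (μ₁ * v-weight 1 - μ₂ * v-weight 2 + μ₃ * v-weight 3 - v-weight 4) * Λ
        ≡⟨ distribute μ₁ μ₂ μ₃ (v-weight 1) (v-weight 2) (v-weight 3) (v-weight 4) Λ ⟩
      μ₁ * (Λ * v-weight 1) - μ₂ * (Λ * v-weight 2) + μ₃ * (Λ * v-weight 3) - Λ * v-weight 4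
        ≈⟨ +-cong (+-cong (+-cong (*-congˡ μ₁ (Λ-relation 1)) (neg-cong (*-congˡ μ₂ (Λ-relation 2))))
             (*-congˡ μ₃ (Λ-relation 3))) (neg-cong (Λ-relation 4)) ⟩
      μ₁ * (r 1 + r 1) - μ₂ * (r 2 + r 2) + μ₃ * (r 3 + r 3) - (r 4 + r 4)
        ≡⟨ expand-relations {u 0} (u 1) (u 2) (u 3) (u 4) (P 1) (P 2) (P 3) (P 4) μ₁ μ₂ μ₃ refl (zero-term x₁ x₂ x₃) refl refl refl refl ⟩
      _ ≡⟨ (let c₁ , c₂ , c₃ , c₄ = coefficients u₁ u₂ u₃ u₄ in fourth-difference μ₄ x₁ x₂ x₃ c₁ c₂ c₃ c₄) ⟩
      0ℤ ∎)
      where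
      open ≈-Reasoning 4
      r P : ℕ → ℤ
      r m = (u ⊛ γ) m
      P n = cubicAt x₁ x₂ x₃ (+ n)
      distribute : ∀ μ₁ μ₂ μ₃ a b c e l → (μ₁ * a - μ₂ * b + μ₃ * c - e) * l ≡ μ₁ * (l * a) - μ₂ * (l * b) + μ₃ * (l * c) - l * e
      distribute = ℤ-solve
      zero-term : ∀ x y z → 1ℤ * (0ℤ * x + (0ℤ * 0ℤ) * y + (0ℤ * (0ℤ * 0ℤ)) * z) ≡ 0ℤ
      zero-term = ℤ-solve

    e≈0 : ∀ m → e m ≈[ 4 ] 0ℤ
    e≈0 m = ≈-trans (≈-reflexive (regroup (𝕡 ^ 2) κ (v-weight m)))
      (≈0-*ˡ (v-weight m) (Unit-cancel-0 (Unit-* unit-6 D₀-unit) Λ≈0))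
      where
      regroup : ∀ q k w → q * (k * w) ≡ w * (q * k)
      regroup = ℤ-solve

    -- The congruence for the cube

    C-base-v≈ : ∀ m → C (base ⊛ (u ⊛ u)) m ≈[ 4 ] (u ⊛ u) m
    C-base-v≈ m = ≈-trans (≈-reflexive (⊛-cong {f = base} (λ _ → refl) clausen (m ℕ.* p)))
      (≈-trans (C-base-v m) (≈-trans (+-cong (≈-reflexive (sym (clausen m))) (e≈0 m)) (≈-reflexive (ℤ.+-identityʳ _))))

    u²-high : ∀ n → 4 ℕ.* d < n mod-p → (u ⊛ u) n ≈[ 3 ] 0ℤ
    u²-high n lt = ≈-trans (≈-reflexive (clausen n)) (v-high n lt)

    -- Once e ≡ 0, extraction gives 2 F³(m p) ≡ 3 û u² - û³ at m. As 3 x u² - x³ is stationary at x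
    -- = u with value 2 u³, passing from û to u costs only multiples of η² ≡ 0 (mod p⁴).
    F³-supercongruence : ∀ m → F³ (m ℕ.* p) ≈[ 4 ] F³ m
    F³-supercongruence m = Unit-cancel unit-2 (≈-trans (≈-reflexive (isolate X S)) (≈-trans (+-cong total (≈-refl {x = - S})) (≈-reflexive (cancel (F³ m) S))))
      where
      open ≈-Reasoning 4
      n = m ℕ.* p
      X = F³ n
      S = (û ⊛ (û ⊛ û)) m
      T = (û ⊛ (u ⊛ u)) m
      isolate : ∀ X S → + 2 * X ≡ (X + X + S) + - S
      isolate = ℤ-solve
      cancel : ∀ Y S → (S + Y + Y) + - S ≡ + 2 * Y
      cancel = ℤ-solve
      lo³ : (lo ⊛ (lo ⊛ lo)) n ≡ S
      lo³ = trans (C-⊛-supported 2d+4d<p lo-supported lo²-supported m) (⊛-cong C-lo C-lo² m)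
      lou² : (lo ⊛ (u ⊛ u)) n ≈[ 4 ] T
      lou² = ≈-trans (C-lo-⊛ (u ⊛ u) u²-high m) (⊛-cong≈ 4 {û} {û} m (λ _ → ≈-refl) C-base-v≈)
      -- The subtraction-free form of 2u³ = 3 lo u² - lo³ + (3 lo + 2 hi) hi²; `û³` below plays the
      -- same part for û = u + η.
      cube : u ⊛ (u ⊛ u) ⊕ u ⊛ (u ⊛ u) ⊕ lo ⊛ (lo ⊛ lo) ≋
        (lo ⊛ (u ⊛ u) ⊕ lo ⊛ (u ⊛ u) ⊕ lo ⊛ (u ⊛ u)) ⊕ (lo ⊕ lo ⊕ lo ⊕ hi ⊕ hi) ⊛ (hi ⊛ hi)
      cube k = trans (cong (_+ (lo ⊛ (lo ⊛ lo)) k) (cong₂ _+_ u³ u³)) (trans (identity k)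
        (cong (_+ ((lo ⊕ lo ⊕ lo ⊕ hi ⊕ hi) ⊛ (hi ⊛ hi)) k) (sym (cong₂ _+_ (cong₂ _+_ lu² lu²) lu²))))
        where
        u³ = ⊛-cong u≋ (⊛-cong u≋ u≋) k
        lu² = ⊛-cong {f = lo} (λ _ → refl) (⊛-cong u≋ u≋) k
        identity : (lo ⊕ hi) ⊛ ((lo ⊕ hi) ⊛ (lo ⊕ hi)) ⊕ (lo ⊕ hi) ⊛ ((lo ⊕ hi) ⊛ (lo ⊕ hi)) ⊕ lo ⊛ (lo ⊛ lo) ≋
          (lo ⊛ ((lo ⊕ hi) ⊛ (lo ⊕ hi)) ⊕ lo ⊛ ((lo ⊕ hi) ⊛ (lo ⊕ hi)) ⊕ lo ⊛ ((lo ⊕ hi) ⊛ (lo ⊕ hi))) ⊕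
          (lo ⊕ lo ⊕ lo ⊕ hi ⊕ hi) ⊛ (hi ⊛ hi)
        identity = solve 2 (λ a b → (a :+ b) :* ((a :+ b) :* (a :+ b)) :+ (a :+ b) :* ((a :+ b) :* (a :+ b)) :+ a :* (a :* a) :=
          (a :* ((a :+ b) :* (a :+ b)) :+ a :* ((a :+ b) :* (a :+ b)) :+ a :* ((a :+ b) :* (a :+ b))) :+
          (a :+ a :+ a :+ b :+ b) :* (b :* b)) (λ _ → refl) lo hi
      û³ : û ⊛ (u ⊛ u) ⊕ û ⊛ (u ⊛ u) ⊕ û ⊛ (u ⊛ u) ⊕ (u ⊕ u ⊕ u ⊕ η) ⊛ (η ⊛ η) ≋
        û ⊛ (û ⊛ û) ⊕ u ⊛ (u ⊛ u) ⊕ u ⊛ (u ⊛ u)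
      û³ k = trans (cong (_+ ((u ⊕ u ⊕ u ⊕ η) ⊛ (η ⊛ η)) k) (cong₂ _+_ (cong₂ _+_ ûu² ûu²) ûu²)) (trans (identity k)
        (cong (λ z → z + F³ k + F³ k) (sym (⊛-cong u≋û (⊛-cong u≋û u≋û) k))))
        where
        ûu² = ⊛-cong {g = u ⊛ u} u≋û (λ _ → refl) k
        identity : (u ⊕ η) ⊛ (u ⊛ u) ⊕ (u ⊕ η) ⊛ (u ⊛ u) ⊕ (u ⊕ η) ⊛ (u ⊛ u) ⊕ (u ⊕ u ⊕ u ⊕ η) ⊛ (η ⊛ η) ≋
          (u ⊕ η) ⊛ ((u ⊕ η) ⊛ (u ⊕ η)) ⊕ u ⊛ (u ⊛ u) ⊕ u ⊛ (u ⊛ u)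
        identity = solve 2 (λ x y → (x :+ y) :* (x :* x) :+ (x :+ y) :* (x :* x) :+ (x :+ y) :* (x :* x) :+ (x :+ x :+ x :+ y) :* (y :* y) :=
          (x :+ y) :* ((x :+ y) :* (x :+ y)) :+ x :* (x :* x) :+ x :* (x :* x)) (λ _ → refl) u η
      total : X + X + S ≈[ 4 ] S + F³ m + F³ m
      total = begin
        X + X + S
          ≡⟨ cong (λ z → X + X + z) lo³ ⟨
        X + X + (lo ⊛ (lo ⊛ lo)) n
          ≡⟨ cube n ⟩
        ((lo ⊛ (u ⊛ u)) n + (lo ⊛ (u ⊛ u)) n + (lo ⊛ (u ⊛ u)) n) + ((lo ⊕ lo ⊕ lo ⊕ hi ⊕ hi) ⊛ (hi ⊛ hi)) n
          ≈⟨ +-cong (+-cong (+-cong lou² lou²) lou²) (⊛-≈0ʳ 4 (lo ⊕ lo ⊕ lo ⊕ hi ⊕ hi) (hi ⊛ hi) hi²≈0 n) ⟩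
        (T + T + T) + 0ℤ
          ≈⟨ +-cong (≈-refl {x = T + T + T}) (⊛-≈0ʳ 4 (u ⊕ u ⊕ u ⊕ η) (η ⊛ η) (⊛-≈0-+ 2 2 η η η≈0 η≈0) m) ⟨
        (T + T + T) + ((u ⊕ u ⊕ u ⊕ η) ⊛ (η ⊛ η)) m
          ≡⟨ û³ m ⟩
        S + F³ m + F³ m ∎

  -- The form of p and the return to the rational coefficients

  p≡1+6d : ∀ p → Prime p → 7 ≤ p → p ℕ.% 3 ≡ 1 → ∃[ d ] p ≡ suc (6 ℕ.* d)
  p≡1+6d p isPrime 7≤p p%3≡1 = q ℕ./ 2 , parity (q ℕ.% 2) refl (m%n<n q 2)
    where
    q = p ℕ./ 3
    p≡1+3q : p ≡ 1 ℕ.+ q ℕ.* 3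
    p≡1+3q = trans (m≡m%n+[m/n]*n p 3) (cong (ℕ._+ q ℕ.* 3) p%3≡1)
    parity : ∀ r → q ℕ.% 2 ≡ r → r < 2 → p ≡ suc (6 ℕ.* (q ℕ./ 2))
    parity zero       e _ = trans p≡1+3q (trans (cong (λ z → 1 ℕ.+ z ℕ.* 3) (trans (m≡m%n+[m/n]*n q 2) (cong (ℕ._+ q ℕ./ 2 ℕ.* 2) e)))
      (identity (q ℕ./ 2)))
      where
      identity : ∀ h → 1 ℕ.+ (0 ℕ.+ h ℕ.* 2) ℕ.* 3 ≡ suc (6 ℕ.* h)
      identity = ℕ-solve
    -- Here p = 1 + 3q with q odd, so 2 divides the prime p, against p ≥ 7.
    parity (suc zero) e _ = odd (prime⇒irreducible isPrime {2} (ℕ∣.divides (2 ℕ.+ 3 ℕ.* (q ℕ./ 2)) (trans p≡1+3q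
      (trans (cong (λ z → 1 ℕ.+ z ℕ.* 3) (trans (m≡m%n+[m/n]*n q 2) (cong (ℕ._+ q ℕ./ 2 ℕ.* 2) e))) (identity (q ℕ./ 2))))))
      where
      identity : ∀ h → 1 ℕ.+ (1 ℕ.+ h ℕ.* 2) ℕ.* 3 ≡ (2 ℕ.+ 3 ℕ.* h) ℕ.* 2
      identity = ℕ-solve
      odd : 2 ≡ 1 ⊎ 2 ≡ p → p ≡ suc (6 ℕ.* (q ℕ./ 2))
      odd (inj₂ 2≡p) = contradiction (subst (7 ≤_) (sym 2≡p) 7≤p) (λ { (s≤s (s≤s ())) })
    parity (suc (suc _)) _ (s≤s (s≤s ()))

  F³-integral-congruence : ∀ p → Prime p → 7 ≤ p → p ℕ.% 3 ≡ 1 → ∀ m → ∃[ t ] F³ (m ℕ.* p) ≡ F³ m + t * (+ p) ^ 4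
  F³-integral-congruence p isPrime 7≤p p%3≡1 m with p≡1+6d p isPrime 7≤p p%3≡1
  ... | zero  , refl with s≤s () ← 7≤p
  ... | suc d , p≡   = quotient , equality
    where
    open Congruence._≈[_]_ (Supercongruence.F³-supercongruence (suc d) p (+ p) (s≤s z≤n) p≡ refl isPrime m)

open import Data.Nat using (ℕ; _≤_; _%_; _^_)
open import Data.Rational using (ℚ; _-_; _*_; _/_)

theorem4p33 : ∀ (p : ℕ) → Prime p → 7 ≤ p → p % 3 ≡ 1 →
    ∀ (m : ℕ) → 1 ≤ m →
    ∃[ t ] (Amix (m Data.Nat.* p) - Amix m ≡ ℕ→ℚ (p ^ 4) * (t / 1))
theorem4p33 p isPrime 7≤p p%3≡1 m _ = t , (begin
  Amix (m ℕ.* p) - Amix m            ≡⟨ cong₂ ℚ._-_ (Amix≡u³ (m ℕ.* p)) (Amix≡u³ m) ⟩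
  ι (F³ (m ℕ.* p)) - ι (F³ m)          ≡⟨ cong (λ z → ι z - ι (F³ m)) F³≡ ⟩
  ι (F³ m ℤ.+ t ℤ.* (+ p) ℤ.^ 4) - ι (F³ m)  ≡⟨ cong (_- ι (F³ m)) (ι-+ (F³ m) (t ℤ.* (+ p) ℤ.^ 4)) ⟩
  ι (F³ m) ℚ.+ ι (t ℤ.* (+ p) ℤ.^ 4) - ι (F³ m) ≡⟨ cancel (ι (F³ m)) (ι (t ℤ.* (+ p) ℤ.^ 4)) ⟩
  ι (t ℤ.* (+ p) ℤ.^ 4)                    ≡⟨ cong ι (trans (ℤ.*-comm t ((+ p) ℤ.^ 4)) (cong (ℤ._* t) (sym (pos-^ p 4)))) ⟩
  ι (+ (p ^ 4) ℤ.* t)                  ≡⟨ ι-* (+ (p ^ 4)) t ⟩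
  ℕ→ℚ (p ^ 4) * (t / 1)            ∎)
  where
  open ≡.≡-Reasoning
  quotient = F³-integral-congruence p isPrime 7≤p p%3≡1 m
  t = proj₁ quotient
  F³≡ = proj₂ quotient
  pos-^ : ∀ a n → + (a ^ n) ≡ (+ a) ℤ.^ n
  pos-^ a zero    = refl
  pos-^ a (suc n) = trans (ℤ.pos-* a (a ^ n)) (cong (+ a ℤ.*_) (pos-^ a n))
  cancel : ∀ x y → x ℚ.+ y - x ≡ y
  cancel x y = trans (cong (_- x) (ℚ.+-comm x y)) (trans (ℚ.+-assoc y x (ℚ.- x))
    (trans (cong (y ℚ.+_) (ℚ.+-inverseʳ x)) (ℚ.+-identityʳ y)))
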